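{- Let $p$ be an odd prime and let $g$, $g'$ both be of the form \[F(x)+G\!\left(\tfrac1x\right)+H\!\left(\tfrac1{x-1}\right)+\sum_{j=4}^{r+1}J_j\!\left(\tfrac{1}{x-\theta_j}\right)\] described below, with the same pole orders, where $d_1>d_2>d_3$ and $\{d_1,d_2,d_3\}\cap\{d_4,\dots,d_{r+1}\}=\emptyset$. If $(M,\lambda,h)$ transforms $C_g$ into $C_{g'}$, then $M(x)=x$ and $h$ is a constant in $\mathbb{F}_p$; i.e., up to composition with $(x,y)\mapsto(x,y+c)$, $c\in\mathbb{F}_p$, every isomorphism preserving this form is $(x,y)\mapsto(x,\lambda y)$ for some $\lambda\in\mathbb{F}_p^\times$ (and then $g'=g/\lambda$ up to the relabeling of the $\theta_j$).
   Context: Form: $F(x)=\sum_{i=1}^{d_1}a_ix^i$, $G(x)=\sum_{i=1}^{d_2}b_ix^i$, $H(x)=\sum_{i=1}^{d_3}c_ix^i$, $J_j(x)=\sum_{i=1}^{d_j}e_{ij}x^i$ with all $d_i$ not divisible by $p$, $a_i=b_i=c_i=e_{ij}=0$ whenever $p\mid i$, $a_{d_1},b_{d_2},c_{d_3},e_{d_jj}\ne0$, and $\theta_4,\dots,\theta_{r+1}\in\overline{\mathbb{F}}_p\setminus\{0,1\}$ distinct. For $f\in\overline{\mathbb{F}}_p(x)$, $C_f$ is the curve $y^p-y=f(x)$. For a Möbius transformation $M(x)=\frac{\alpha x+\beta}{\gamma x+\delta}$ ($\alpha\delta-\beta\gamma\ne0$), $\lambda\in\mathbb{F}_p^\times$,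 $h\in\overline{\mathbb{F}}_p(x)$, we say $(M,\lambda,h)$ transforms $C_f$ into $C_{f'}$ if $f(M(x))=\lambda f'(x)+h(x)^p-h(x)$. -}

module Defs where

open import Level using (_⊔_)
open import Algebra.Bundles using (CommutativeRing; Semiring)
open import Algebra.Bundles.Raw using (RawRing)
open import Algebra.Apartness.Bundles using (HeytingCommutativeRing; HeytingField)
import Algebra.Apartness.Properties.HeytingCommutativeRing as HCRProperties
import Algebra.Definitions.RawSemiring as RawSemiringDefinitions
open import Data.Empty using (⊥-elim)
open import Data.Fin.Base using (Fin; toℕ)
open import Data.List.Base using (List; []; _∷_; map; foldr)
open import Data.List.Relation.Unary.All using (All)
open import Data.List.Relation.Unary.Any using (Any; here; there; any?)
open import Data.Nat.Base using (ℕ; zero; suc)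
open import Data.Nat.Divisibility using (_∣_; _∤_)
open import Data.Product.Base using (∃; _×_; _,_; proj₁)
open import Relation.Binary.Definitions using (Decidable)
open import Relation.Binary.PropositionalEquality using (_≡_; _≢_)
open import Relation.Nullary using (¬_; yes; no)

module Polynomials {c ℓ₁ ℓ₂} (K : HeytingField c ℓ₁ ℓ₂) where

  open HeytingField K

  -- Coefficients in increasing degree; trailing zeros are allowed, so
  -- equality is coefficientwise rather than equality of lists.
  Poly : Set c
  Poly = List Carrier

  coeff : Poly → ℕ → Carrier
  coeff []      _       = 0#
  coeff (a ∷ f) zero    = a
  coeff (a ∷ f) (suc i) = coeff f i

  infix 4 _≈ᴾ_
  _≈ᴾ_ : Poly → Poly → Set ℓ₁
  f ≈ᴾ g = ∀ i → coeff f i ≈ coeff g i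

  NonZeroᴾ : Poly → Set (c ⊔ ℓ₂)
  NonZeroᴾ = Any (_# 0#)

  infixl 6 _+ᴾ_
  _+ᴾ_ : Poly → Poly → Poly
  []      +ᴾ g       = g
  (a ∷ f) +ᴾ []      = a ∷ f
  (a ∷ f) +ᴾ (b ∷ g) = (a + b) ∷ (f +ᴾ g)

  infix 8 -ᴾ_
  -ᴾ_ : Poly → Poly
  -ᴾ_ = map (-_)

  infixl 7 _*ᴾ_
  _*ᴾ_ : Poly → Poly → Poly
  []      *ᴾ g = []
  (a ∷ f) *ᴾ g = map (a *_) g +ᴾ (0# ∷ (f *ᴾ g))

  eval : Poly → Carrier → Carrier
  eval f x = foldr (λ a r → a + x * r) 0# f

-- K is an algebraic closure of the field with p elements.  Together with
-- p prime, `characteristic` says that K has characteristic p (1# # 0# holds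
-- in every HeytingField).  Decidability of _#_ makes K a discrete field, as
-- an algebraic closure of a finite field is.
module _ {c ℓ₁ ℓ₂} (p : ℕ) (K : HeytingField c ℓ₁ ℓ₂) where

  open HeytingField K
  open Polynomials K

  open HeytingCommutativeRing heytingCommutativeRing using (commutativeRing)
  open CommutativeRing commutativeRing using (semiring)
  open RawSemiringDefinitions (Semiring.rawSemiring semiring)
    using () renaming (_×_ to _·_)

  InPrimeField : Carrier → Set ℓ₁
  InPrimeField x = ∃ λ (i : Fin p) → x ≈ toℕ i · 1#

  record IsAlgebraicClosureOf𝔽 : Set (c ⊔ ℓ₁ ⊔ ℓ₂) where
    field
      _#?_                : Decidable _#_
      characteristic      : p · 1# ≈ 0#
      -- a ∷ f is a₀ + x f(x), which is nonconstant exactly when f ≠ 0.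
      algebraicallyClosed : ∀ a f → NonZeroᴾ f → ∃ λ x → eval (a ∷ f) x ≈ 0#
      algebraic           : ∀ x → ∃ λ f →
                            All InPrimeField f × NonZeroᴾ f × eval f x ≈ 0#

module RationalFunctions {c ℓ₁ ℓ₂} (K : HeytingField c ℓ₁ ℓ₂)
                         (_#?_ : Decidable (HeytingField._#_ K)) where

  open HeytingField K hiding (zero)
  open HCRProperties heytingCommutativeRing
    using (1#0; x#0y#0→xy#0; #-congʳ)
  open Polynomials K

  private

    ¬#0⇒≈0 : ∀ {x} → ¬ (x # 0#) → x ≈ 0#
    ¬#0⇒≈0 {x} = proj₁ (tight x 0#)

    coeff-+ : ∀ f g i → coeff (f +ᴾ g) i ≈ coeff f i + coeff g i
    coeff-+ []      g       i       = sym (+-identityˡ _)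
    coeff-+ (a ∷ f) []      i       = sym (+-identityʳ _)
    coeff-+ (a ∷ f) (b ∷ g) zero    = refl
    coeff-+ (a ∷ f) (b ∷ g) (suc i) = coeff-+ f g i

    +ᴾ-cong : ∀ f f′ g g′ → f ≈ᴾ f′ → g ≈ᴾ g′ → f +ᴾ g ≈ᴾ f′ +ᴾ g′
    +ᴾ-cong f f′ g g′ f≈f′ g≈g′ i =
      trans (coeff-+ f g i)
        (trans (+-cong (f≈f′ i) (g≈g′ i)) (sym (coeff-+ f′ g′ i)))

    NonZeroᴾ-resp : ∀ f g → f ≈ᴾ g → NonZeroᴾ f → NonZeroᴾ g
    NonZeroᴾ-resp (a ∷ f) [] f≈g (here a#0) =
      ⊥-elim (#-irrefl (f≈g zero) a#0)
    NonZeroᴾ-resp (a ∷ f) [] f≈g (there f≠0)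
      with () ← NonZeroᴾ-resp f [] (λ i → f≈g (suc i)) f≠0
    NonZeroᴾ-resp (a ∷ f) (b ∷ g) f≈g (here a#0) =
      here (#-congʳ (f≈g zero) a#0)
    NonZeroᴾ-resp (a ∷ f) (b ∷ g) f≈g (there f≠0) =
      there (NonZeroᴾ-resp f g (λ i → f≈g (suc i)) f≠0)

    scale-0 : ∀ {a} f → a ≈ 0# → map (a *_) f ≈ᴾ []
    scale-0 []      a≈0 i       = refl
    scale-0 (b ∷ f) a≈0 zero    = trans (*-congʳ a≈0) (zeroˡ b)
    scale-0 (b ∷ f) a≈0 (suc i) = scale-0 f a≈0 i

    *ᴾ-shift : ∀ f {b} g → b ≈ 0# → f *ᴾ (b ∷ g) ≈ᴾ 0# ∷ (f *ᴾ g)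
    *ᴾ-shift []      g b≈0 zero    = refl
    *ᴾ-shift []      g b≈0 (suc i) = refl
    *ᴾ-shift (a ∷ f) g b≈0 zero    =
      trans (+-identityʳ _) (trans (*-congˡ b≈0) (zeroʳ a))
    *ᴾ-shift (a ∷ f) {b} g b≈0 (suc i) =
      +ᴾ-cong (map (a *_) g) (map (a *_) g) (f *ᴾ (b ∷ g)) (0# ∷ (f *ᴾ g))
        (λ _ → refl) (*ᴾ-shift f g b≈0) i

  *ᴾ-nonZero : ∀ f g → NonZeroᴾ f → NonZeroᴾ g → NonZeroᴾ (f *ᴾ g)
  *ᴾ-nonZero (a ∷ f) (b ∷ g) af≠0 bg≠0 with a #? 0# | b #? 0#
  ... | yes a#0 | yes b#0 =
    here (#-congʳ (sym (+-identityʳ _)) (x#0y#0→xy#0 a#0 b#0))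
  *ᴾ-nonZero (a ∷ f) (b ∷ g) (here a#0)  bg≠0 | no a¬#0 | _ = ⊥-elim (a¬#0 a#0)
  *ᴾ-nonZero (a ∷ f) (b ∷ g) (there f≠0) bg≠0 | no a¬#0 | _ =
    there (NonZeroᴾ-resp (f *ᴾ (b ∷ g)) (map (a *_) g +ᴾ f *ᴾ (b ∷ g))
      (λ i → sym (+ᴾ-cong (map (a *_) g) [] (f *ᴾ (b ∷ g)) (f *ᴾ (b ∷ g))
                   (scale-0 g (¬#0⇒≈0 a¬#0)) (λ _ → refl) i))
      (*ᴾ-nonZero f (b ∷ g) f≠0 bg≠0))
  *ᴾ-nonZero (a ∷ f) (b ∷ g) af≠0 (here b#0)  | yes _ | no b¬#0 = ⊥-elim (b¬#0 b#0)
  *ᴾ-nonZero (a ∷ f) (b ∷ g) af≠0 (there g≠0) | yes _ | no b¬#0 =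
    NonZeroᴾ-resp (0# ∷ ((a ∷ f) *ᴾ g)) ((a ∷ f) *ᴾ (b ∷ g))
      (λ i → sym (*ᴾ-shift (a ∷ f) g (¬#0⇒≈0 b¬#0) i))
      (there (*ᴾ-nonZero (a ∷ f) g af≠0 g≠0))

  record RatFun : Set (c ⊔ ℓ₂) where
    constructor mkRatFun
    field
      num   : Poly
      den   : Poly
      den≠0 : NonZeroᴾ den

  open RatFun public

  -- The field K(x): fractions are equal when they agree after cross-multiplying.
  ratFunRing : RawRing (c ⊔ ℓ₂) ℓ₁
  ratFunRing = record
    { Carrier = RatFun
    ; _≈_     = λ f g → num f *ᴾ den g ≈ᴾ num g *ᴾ den f
    ; _+_     = λ f g → mkRatFun (num f *ᴾ den g +ᴾ num g *ᴾ den f)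
                                 (den f *ᴾ den g)
                                 (*ᴾ-nonZero (den f) (den g) (den≠0 f) (den≠0 g))
    ; _*_     = λ f g → mkRatFun (num f *ᴾ num g)
                                 (den f *ᴾ den g)
                                 (*ᴾ-nonZero (den f) (den g) (den≠0 f) (den≠0 g))
    ; -_      = λ f → mkRatFun (-ᴾ num f) (den f) (den≠0 f)
    ; 0#      = mkRatFun [] (1# ∷ []) (here 1#0)
    ; 1#      = mkRatFun (1# ∷ []) (1# ∷ []) (here 1#0)
    }

  private module R = RawRing ratFunRing

  const : Carrier → RatFun
  const a = mkRatFun (a ∷ []) (1# ∷ []) (here 1#0)

  X : RatFun
  X = mkRatFun (0# ∷ 1# ∷ []) (1# ∷ []) (here 1#0)

  -- The inverse is totalised by 0 ⁻¹ = 0.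
  infix 8 _⁻¹
  _⁻¹ : RatFun → RatFun
  f ⁻¹ with any? (λ a → a #? 0#) (num f)
  ... | yes num≠0 = mkRatFun (den f) (num f) num≠0
  ... | no  _     = R.0#

  infixl 7 _/_
  _/_ : RatFun → RatFun → RatFun
  f / g = f R.* g ⁻¹

  evalᴿ : Poly → RatFun → RatFun
  evalᴿ f u = foldr (λ a r → const a R.+ u R.* r) R.0# f

  -- Substitution f(u(x)).  For nonconstant u (the only use below being
  -- fractional linear u) the denominator of f stays nonzero under the
  -- substitution, so the convention for _⁻¹ at 0 plays no role.
  infixr 9 _∘ᴿ_
  _∘ᴿ_ : RatFun → RatFun → RatFun
  f ∘ᴿ u = evalᴿ (num f) u / evalᴿ (den f) u

module ArtinSchreierCurves {c ℓ₁ ℓ₂} (p : ℕ) (K : HeytingField c ℓ₁ ℓ₂)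
                           (isClosure : IsAlgebraicClosureOf𝔽 p K) where

  open HeytingField K public using (Carrier; _#_)
  open IsAlgebraicClosureOf𝔽 isClosure using (_#?_)
  open RationalFunctions K _#?_ public
  open RawRing ratFunRing public using (_≈_; _+_; _*_; -_)
  open RawSemiringDefinitions (RawRing.rawSemiring ratFunRing) public
    using (_^_; sum)

  private module K = HeytingField K

  infixl 6 _-_
  _-_ : RatFun → RatFun → RatFun
  f - g = f + (- g)

  -- a₁ t + ⋯ + a_d t^d; `coeff i` is the coefficient of t^(i+1).
  record PolarPart (d : ℕ) : Set (c ⊔ ℓ₁ ⊔ ℓ₂) where
    field
      coeff   : Fin d → Carrier
      reduced : ∀ i → p ∣ suc (toℕ i) → coeff i K.≈ K.0#
      leading : ∀ i → suc (toℕ i) ≡ d → coeff i # K.0#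

  infix 10 _⟨_⟩
  _⟨_⟩ : ∀ {d} → PolarPart d → RatFun → RatFun
  P ⟨ t ⟩ = sum (λ i → const (PolarPart.coeff P i) * t ^ suc (toℕ i))

  -- d₁, d₂, d₃ are the orders at ∞, 0, 1; the n = r - 2 entries of d are
  -- d₄, …, d_{r+1}.  Positivity follows from p ∤ 0 being false.
  record PoleOrders : Set where
    field
      d₁ d₂ d₃ : ℕ
      n        : ℕ
      d        : Fin n → ℕ
      p∤d₁     : p ∤ d₁
      p∤d₂     : p ∤ d₂
      p∤d₃     : p ∤ d₃
      p∤d      : ∀ j → p ∤ d j

  record StandardForm (D : PoleOrders) : Set (c ⊔ ℓ₁ ⊔ ℓ₂) where
    open PoleOrders D
    field
      F          : PolarPart d₁
      G          : PolarPart d₂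
      H          : PolarPart d₃
      J          : ∀ j → PolarPart (d j)
      θ          : Fin n → Carrier
      θ≠0        : ∀ j → θ j # K.0#
      θ≠1        : ∀ j → θ j # K.1#
      θ-distinct : ∀ i j → i ≢ j → θ i # θ j

  ⟦_⟧ : ∀ {D} → StandardForm D → RatFun
  ⟦ S ⟧ = F ⟨ X ⟩ + G ⟨ X ⁻¹ ⟩ + H ⟨ (X - const K.1#) ⁻¹ ⟩
        + sum (λ j → J j ⟨ (X - const (θ j)) ⁻¹ ⟩)
    where open StandardForm S

  record Transformation : Set (c ⊔ ℓ₁ ⊔ ℓ₂) where
    field
      α β γ δ     : Carrier
      det≠0       : α K.* δ K.- β K.* γ # K.0#
      scale       : Carrier
      scale∈𝔽ₚ    : InPrimeField p K scale
      scale≠0     : scale # K.0#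
      h           : RatFun

    M : RatFun
    M = (const α * X + const β) / (const γ * X + const δ)

  Transforms : Transformation → RatFun → RatFun → Set ℓ₁
  Transforms T f f′ = f ∘ᴿ M ≈ const scale * f′ + (h ^ p - h)
    where open Transformation T

  -- The map of planes (x , y) ↦ (base x , scale y + shift x).
  record PlaneMap : Set (c ⊔ ℓ₂) where
    constructor planeMap
    field
      base  : RatFun
      scale : Carrier
      shift : RatFun

  infix 4 _≈ᴹ_
  _≈ᴹ_ : PlaneMap → PlaneMap → Set ℓ₁
  φ ≈ᴹ ψ = base φ ≈ base ψ × scale φ K.≈ scale ψ × shift φ ≈ shift ψ
    where open PlaneMap

  infixr 9 _∘ᴹ_
  _∘ᴹ_ : PlaneMap → PlaneMap → PlaneMap
  φ ∘ᴹ ψ = planeMap (base φ ∘ᴿ base ψ)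
                    (scale φ K.* scale ψ)
                    (const (scale φ) * shift ψ + shift φ ∘ᴿ base ψ)
    where open PlaneMap

  -- If T transforms C_f into C_f′, this carries (x , y) on y^p - y = f′(x)
  -- to a point of y^p - y = f(x), because scale^p = scale.
  toPlaneMap : Transformation → PlaneMap
  toPlaneMap T = planeMap M scale h
    where open Transformation T

  y↦y+_ : Carrier → PlaneMap
  y↦y+ a = planeMap X K.1# (const a)

  y↦_*y : Carrier → PlaneMap
  y↦ a *y = planeMap X a (const K.0#)

{-# OPTIONS --safe #-}

-- Everything happens at the point 0 of K(x): a point P of the projective line is moved there by
-- substituting a coordinate centred at P, and substitution is an endomorphism of K(x).  If h has a
-- pole of order k, then h^p - h has one of order p k; so a pole order prime to p is unchanged by
-- adding h^p - h.  Comparing the orders of g ∘ M and λ g′, the map M matches the poles of g′ with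
-- those of g, preserving orders, and since d₁, d₂, d₃ are distinct and differ from the other
-- orders, M fixes ∞, 0 and 1.  Now h^p - h = g - λ g′ has only reduced polar parts, so h has no
-- pole at all and is a constant a, and these polar parts are zero.  What remains of g - λ g′
-- vanishes at ∞, so a^p = a, and the p elements of 𝔽ₚ are the only solutions of this equation.

module Submission where

-- No Laurent series are used: the order of a function at 0 is read off from any fraction n/d for
-- it. As `X` is transcendental, two fractions of one function satisfy a polynomial identity, which
-- can be compared at its constant coefficients or evaluated elsewhere. The same remark makes
-- substitution of u well defined, once a nonconstant u is known to annihilate no nonzero
-- polynomial. This needs roots of polynomials, and roots are needed again to cancel the denominator
-- of a function without finite poles. Orders alone determine M and the matching of the θ;
-- coefficients are compared only afterwards. The order of h^p - h is a multiple of p, so it never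
-- ties with a nonzero order prime to p, and nothing can cancel. Order 0 is kept as a value for
-- points without a pole, since a priori M may send a pole of g′ to such a point. Once M = x, the
-- difference of two polar parts may have lost its leading term; but its coefficients still vanish
-- at all multiples of p, so its highest surviving exponent is again prime to p.

open import Defs
open import Level using (_⊔_) renaming (suc to lsuc)
open import Algebra.Apartness.Bundles using (HeytingField; HeytingCommutativeRing)
import Algebra.Apartness.Properties.HeytingCommutativeRing as HCRProperties
open import Algebra.Bundles using (AbelianGroup; CommutativeMonoid; CommutativeRing; Semiring)
open import Algebra.Bundles.Raw using (RawRing)
import Algebra.Definitions.RawSemiring as RawSemiringDefinitions
import Algebra.Properties.AbelianGroup as AbelianGroupProperties
import Algebra.Properties.CommutativeMonoid.Sum as CommutativeMonoidSum
import Algebra.Properties.CommutativeSemigroup as CommutativeSemigroupProperties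
import Algebra.Properties.CommutativeSemiring.Binomial as CommutativeSemiringBinomial
import Algebra.Properties.Ring as RingProperties
import Algebra.Properties.Semiring.Exp as SemiringExp
import Algebra.Properties.Semiring.Mult as SemiringMult
import Algebra.Properties.Semiring.Sum as SemiringSum
import Algebra.Solver.Ring as RingSolver
import Algebra.Solver.Ring.AlmostCommutativeRing as ACR
import Algebra.Solver.Ring.NaturalCoefficients.Default as SemiringSolver
open import Data.Empty using (⊥; ⊥-elim)
open import Data.Fin.Base using (Fin; zero; suc; toℕ; fromℕ; inject₁)
open import Data.Fin.Permutation using (Permutation′; permutation; _⟨$⟩ʳ_)
open import Data.Fin.Properties using (toℕ-fromℕ; toℕ-inject₁; toℕ<n; toℕ-injective; suc-injective; any?; _≟_)
open import Data.Fin.Relation.Unary.Top using (view; ‵fromℕ; ‵inject₁)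
open import Data.List.Base using ([]; _∷_; map; foldr; length)
import Data.List.Relation.Unary.Any as Any
open import Data.List.Relation.Unary.Any using (here; there)
open import Data.Maybe.Base using (Maybe; just; nothing)
import Data.Nat.Base as ℕ
open import Data.Nat.Base using (ℕ; _!; _>_)
open import Data.Nat.Combinatorics using (_C_; nCn≡1; nCk≡n!/k![n-k]!; k![n∸k]!∣n!)
open import Data.Nat.Coprimality using (Coprime; coprime-Bézout)
open import Data.Nat.Divisibility using (_∣_; _∤_; divides; m∣m*n; _∣0; ∣1⇒≡1; >⇒∤)
open import Data.Nat.DivMod using (m/n*n≡m)
open import Data.Nat.GCD using (module Bézout)
open Bézout.Identity using (+-; -+)
open import Data.Nat.Primality using (Prime; prime⇒nonTrivial; prime⇒irreducible; euclidsLemma)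
import Data.Nat.Properties as ℕ
open import Data.Product.Base using (∃; _×_; _,_; proj₁; proj₂)
open import Data.Sum.Base using (_⊎_; inj₁; inj₂; [_,_]′)
open import Relation.Binary.Definitions using (Decidable; tri<; tri≈; tri>)
open import Relation.Binary.PropositionalEquality as ≡ using (_≡_; _≢_)
import Relation.Binary.Reasoning.Setoid as SetoidReasoning
open import Relation.Nullary using (¬_; yes; no; Dec)
open import Relation.Nullary.Decidable using (decidable-stable; ¬?)

-- A ring solver with integer coefficients.

-- Coefficients are differences of naturals in lowest form, so that equal normal forms are syntactically equal.
module IntegerSolver {c ℓ} (R : CommutativeRing c ℓ) where

  open CommutativeRing R
  open RingProperties ring using (-0#≈0#)
  open AbelianGroupProperties +-abelianGroup using (⁻¹-∙-comm; ⁻¹-involutive; ⁻¹-anti-homo‿-)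
  open SemiringMult semiring using (×-homo-+; ×1-homo-*; ×-congˡ) renaming (_×_ to _·_)
  open SemiringSolver commutativeSemiring using (_:+_; _:*_; _:=_) renaming (solve to solve⁺)

  private
    reduce : ℕ × ℕ → ℕ × ℕ
    reduce (a , b) = a ℕ.∸ b , b ℕ.∸ a

    differences : RawRing _ _
    differences = record
      { Carrier = ℕ × ℕ
      ; _≈_     = _≡_
      ; _+_     = λ (a , b) (c , d) → reduce (a ℕ.+ c , b ℕ.+ d)
      ; _*_     = λ (a , b) (c , d) → reduce (a ℕ.* c ℕ.+ b ℕ.* d , a ℕ.* d ℕ.+ b ℕ.* c)
      ; -_      = λ (a , b) → b , a
      ; 0#      = 0 , 0
      ; 1#      = 1 , 0
      }

    difference : ℕ × ℕ → Carrier
    difference (a , b) = a · 1# - b · 1#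

    -- The constants 0 and 1 must denote 0# and 1# definitionally.
    value : ℕ × ℕ → Carrier
    value (0 , 0) = 0#
    value (1 , 0) = 1#
    value n       = difference n

    value≈ : ∀ n → value n ≈ difference n
    value≈ (0 , 0)           = sym (-‿inverseʳ 0#)
    value≈ (1 , 0)           = sym (trans (+-cong (+-identityʳ 1#) -0#≈0#) (+-identityʳ 1#))
    value≈ (0 , ℕ.suc _)     = refl
    value≈ (1 , ℕ.suc _)     = refl
    value≈ (ℕ.2+ _ , _)      = refl

    diff-cong : ∀ {a b c d} → a + d ≈ c + b → a - b ≈ c - d
    diff-cong {a} {b} {c} {d} eq = begin
      a - b               ≈⟨ +-identityʳ _ ⟨
      a - b + 0#          ≈⟨ +-congˡ (-‿inverseʳ d) ⟨
      a - b + (d - d)     ≈⟨ solve⁺ 4 (λ a b d e → (a :+ b) :+ (d :+ e) := (a :+ d) :+ (b :+ e)) refl a (- b) d (- d) ⟩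
      a + d + (- b - d)   ≈⟨ +-congʳ eq ⟩
      c + b + (- b - d)   ≈⟨ solve⁺ 4 (λ c b d e → (c :+ b) :+ (d :+ e) := (c :+ e) :+ (b :+ d)) refl c b (- b) (- d) ⟩
      c - d + (b - b)     ≈⟨ +-congˡ (-‿inverseʳ b) ⟩
      c - d + 0#          ≈⟨ +-identityʳ _ ⟩
      c - d               ∎
      where open SetoidReasoning setoid

    -- Truncated subtraction does not cancel in general, but removing the common part of both
    -- components keeps the cross sum; hence `reduce` does not change the difference denoted.
    ∸+≡+∸ : ∀ a b → a ℕ.∸ b ℕ.+ b ≡ a ℕ.+ (b ℕ.∸ a)
    ∸+≡+∸ ℕ.zero    ℕ.zero    = ≡.refl
    ∸+≡+∸ ℕ.zero    (ℕ.suc b) = ≡.refl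
    ∸+≡+∸ (ℕ.suc a) ℕ.zero    = ≡.refl
    ∸+≡+∸ (ℕ.suc a) (ℕ.suc b) = ≡.trans (ℕ.+-suc (a ℕ.∸ b) b) (≡.cong ℕ.suc (∸+≡+∸ a b))

    value-reduce : ∀ n → value (reduce n) ≈ difference n
    value-reduce (a , b) = trans (value≈ (a ℕ.∸ b , b ℕ.∸ a)) (diff-cong
      (trans (sym (×-homo-+ 1# (a ℕ.∸ b) b))
      (trans (×-congˡ (∸+≡+∸ a b))
             (×-homo-+ 1# a (b ℕ.∸ a)))))

    open RingProperties ring using (-‿distribˡ-*; -‿distribʳ-*)
    open SetoidReasoning setoid

    diff-+ : ∀ a b c d → (a + c) - (b + d) ≈ (a - b) + (c - d)
    diff-+ a b c d = begin
      (a + c) - (b + d)       ≈⟨ +-congˡ (⁻¹-∙-comm b d) ⟨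
      (a + c) + (- b - d)     ≈⟨ solve⁺ 4 (λ a c b d → (a :+ c) :+ (b :+ d) := (a :+ b) :+ (c :+ d)) refl a c (- b) (- d) ⟩
      (a - b) + (c - d)       ∎

    diff-* : ∀ a b c d → (a * c + b * d) - (a * d + b * c) ≈ (a - b) * (c - d)
    diff-* a b c d = begin
      (a * c + b * d) - (a * d + b * c)             ≈⟨ +-cong (+-congˡ (sym (negneg b d))) (sym (⁻¹-∙-comm _ _)) ⟩
      (a * c + - b * - d) + (- (a * d) - b * c)     ≈⟨ +-congˡ (+-cong (-‿distribʳ-* a d) (-‿distribˡ-* b c)) ⟩
      (a * c + - b * - d) + (a * - d + - b * c)     ≈⟨ solve⁺ 4 (λ a b c d → (a :* c :+ b :* d) :+ (a :* d :+ b :* c) := (a :+ b) :* (c :+ d)) refl a (- b) c (- d) ⟩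
      (a - b) * (c - d)                             ∎
      where
      negneg : ∀ x y → - x * - y ≈ x * y
      negneg x y = trans (sym (-‿distribˡ-* x (- y)))
                  (trans (-‿cong (sym (-‿distribʳ-* x y))) (⁻¹-involutive _))

    morphism : differences ACR.-Raw-AlmostCommutative⟶ ACR.fromCommutativeRing R
    morphism = record
      { ⟦_⟧    = value
      ; +-homo = λ m@(a , b) n@(c , d) → begin
          value (reduce (a ℕ.+ c , b ℕ.+ d))         ≈⟨ value-reduce (a ℕ.+ c , b ℕ.+ d) ⟩
          (a ℕ.+ c) · 1# - (b ℕ.+ d) · 1#            ≈⟨ +-cong (×-homo-+ 1# a c) (-‿cong (×-homo-+ 1# b d)) ⟩
          (a · 1# + c · 1#) - (b · 1# + d · 1#)      ≈⟨ diff-+ _ _ _ _ ⟩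
          difference m + difference n                ≈⟨ +-cong (value≈ m) (value≈ n) ⟨
          value m + value n                          ∎
      ; *-homo = λ m@(a , b) n@(c , d) → begin
          value (reduce (a ℕ.* c ℕ.+ b ℕ.* d , a ℕ.* d ℕ.+ b ℕ.* c))
            ≈⟨ value-reduce (a ℕ.* c ℕ.+ b ℕ.* d , a ℕ.* d ℕ.+ b ℕ.* c) ⟩
          (a ℕ.* c ℕ.+ b ℕ.* d) · 1# - (a ℕ.* d ℕ.+ b ℕ.* c) · 1#
            ≈⟨ +-cong (·-homo a c b d) (-‿cong (·-homo a d b c)) ⟩
          (a · 1# * c · 1# + b · 1# * d · 1#) - (a · 1# * d · 1# + b · 1# * c · 1#)
            ≈⟨ diff-* _ _ _ _ ⟩
          difference m * difference n                ≈⟨ *-cong (value≈ m) (value≈ n) ⟨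
          value m * value n                          ∎
      ; -‿homo = λ n@(a , b) → begin
          value (b , a)               ≈⟨ value≈ (b , a) ⟩
          b · 1# - a · 1#             ≈⟨ ⁻¹-anti-homo‿- _ _ ⟨
          - difference n              ≈⟨ -‿cong (value≈ n) ⟨
          - value n                   ∎
      ; 0-homo = refl
      ; 1-homo = refl
      }
      where
      ·-homo : ∀ a c b d → (a ℕ.* c ℕ.+ b ℕ.* d) · 1# ≈ a · 1# * c · 1# + b · 1# * d · 1#
      ·-homo a c b d = trans (×-homo-+ 1# (a ℕ.* c) (b ℕ.* d)) (+-cong (×1-homo-* a c) (×1-homo-* b d))

    -- Sound but not complete: in positive characteristic different integers may have equal values,
    -- so a failed test yields only `nothing`.
    decide : ∀ m n → Maybe (value m ≈ value n)
    decide m@(a , b) n@(c , d) with a ℕ.+ d ℕ.≟ c ℕ.+ b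
    ... | no _   = nothing
    ... | yes eq = just (trans (value≈ m) (trans
      (diff-cong (trans (sym (×-homo-+ 1# a d)) (trans (×-congˡ eq) (×-homo-+ 1# c b))))
      (sym (value≈ n))))

  open RingSolver differences (ACR.fromCommutativeRing R) morphism decide public
    using (Polynomial; con; solve; _:=_; _:+_; _:*_; _:-_; :-_)

  :0 :1 : ∀ {n} → Polynomial n
  :0 = con (0 , 0)
  :1 = con (1 , 0)

-- Heyting fields with decidable apartness.

module DiscreteField {c ℓ₁ ℓ₂} (K : HeytingField c ℓ₁ ℓ₂) (_#?_ : Decidable (HeytingField._#_ K)) where

  open HeytingField K public using (heytingCommutativeRing; _#_; #-irrefl; #-sym)
  open HeytingCommutativeRing heytingCommutativeRing public using (commutativeRing; #⇒invertible)
  open CommutativeRing commutativeRing public hiding (zero)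
  open HCRProperties heytingCommutativeRing public using (1#0; x#0y#0→xy#0; #-congʳ; x-0≈x; invertibleʳ⇒#)
  open IntegerSolver commutativeRing public

  ¬#⇒≈ : ∀ {x y} → ¬ x # y → x ≈ y
  ¬#⇒≈ {x} {y} = proj₁ (HeytingField.tight K x y)

  #⇒≉ : ∀ {x y} → x # y → ¬ x ≈ y
  #⇒≉ x#y x≈y = #-irrefl x≈y x#y

  #-or-≈ : ∀ x y → x # y ⊎ x ≈ y
  #-or-≈ x y with x #? y
  ... | yes x#y  = inj₁ x#y
  ... | no  ¬x#y = inj₂ (¬#⇒≈ ¬x#y)

  -- Apartness from 0 speaks of the invertibility of x - 0, so the subtracted zero has to be
  -- removed. The last component allows the inverse to serve as a nonzero factor or residue later.
  inverse : ∀ {x} → x # 0# → ∃ λ y → x * y ≈ 1# × y # 0#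
  inverse {x} x#0 with y , _ , xy≈1 ← #⇒invertible x#0 =
    y , xy′ , invertibleʳ⇒# (x , trans (*-congʳ (x-0≈x y)) (trans (*-comm y x) xy′))
    where xy′ = trans (*-congʳ (sym (x-0≈x x))) xy≈1

  -#0 : ∀ {x y} → x # y → x - y # 0#
  -#0 {x} {y} x#y with z , _ , eq ← #⇒invertible x#y =
    invertibleʳ⇒# (z , trans (*-congʳ (x-0≈x _)) eq)

  xy≈0⇒x≈0 : ∀ {x y} → y # 0# → x * y ≈ 0# → x ≈ 0#
  xy≈0⇒x≈0 {x} y#0 xy≈0 = ¬#⇒≈ λ x#0 → #⇒≉ (x#0y#0→xy#0 x#0 y#0) xy≈0

  -≈0⇒≈ : ∀ {x y} → x - y ≈ 0# → x ≈ y
  -≈0⇒≈ {x} {y} eq = trans (solve 2 (λ x y → x := (x :- y) :+ y) refl x y) (trans (+-congʳ eq) (+-identityˡ y))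

-- The ring K[x], an integral domain.

module PolynomialRing {c ℓ₁ ℓ₂} (K : HeytingField c ℓ₁ ℓ₂) (_#?_ : Decidable (HeytingField._#_ K)) where

  open Polynomials K public
  private module K = DiscreteField K _#?_
  open K using (Carrier; 0#; 1#)

  -- Wrapping _≈ᴾ_ in a record lets Agda infer the polynomials from a proof.
  infix 4 _≋_
  record _≋_ (f g : Poly) : Set ℓ₁ where
    constructor coefficientwise
    field at : f ≈ᴾ g
  open _≋_ public

  ≋-refl : ∀ {f} → f ≋ f
  ≋-refl = coefficientwise λ _ → K.refl

  ≋-sym : ∀ {f g} → f ≋ g → g ≋ f
  ≋-sym p = coefficientwise λ i → K.sym (at p i)

  ≋-trans : ∀ {f g h} → f ≋ g → g ≋ h → f ≋ h
  ≋-trans p q = coefficientwise λ i → K.trans (at p i) (at q i)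

  ≋-cons : ∀ {a b f g} → a K.≈ b → f ≋ g → a ∷ f ≋ b ∷ g
  ≋-cons p q = coefficientwise λ { ℕ.zero → p ; (ℕ.suc i) → at q i }

  coeff-+ : ∀ f g i → coeff (f +ᴾ g) i K.≈ coeff f i K.+ coeff g i
  coeff-+ []      g       i         = K.sym (K.+-identityˡ _)
  coeff-+ (a ∷ f) []      i         = K.sym (K.+-identityʳ _)
  coeff-+ (a ∷ f) (b ∷ g) ℕ.zero    = K.refl
  coeff-+ (a ∷ f) (b ∷ g) (ℕ.suc i) = coeff-+ f g i

  coeff-map : ∀ (φ : Carrier → Carrier) → φ 0# K.≈ 0# → ∀ f i → coeff (map φ f) i K.≈ φ (coeff f i)
  coeff-map φ φ0≈0 []      i         = K.sym φ0≈0
  coeff-map φ φ0≈0 (a ∷ f) ℕ.zero    = K.refl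
  coeff-map φ φ0≈0 (a ∷ f) (ℕ.suc i) = coeff-map φ φ0≈0 f i

  coeff-scale : ∀ a f i → coeff (map (a K.*_) f) i K.≈ a K.* coeff f i
  coeff-scale a = coeff-map (a K.*_) (K.zeroʳ a)

  coeff-neg : ∀ f i → coeff (-ᴾ f) i K.≈ K.- coeff f i
  coeff-neg = coeff-map K.-_ (K.solve 0 (K.:- K.:0 K.:= K.:0) K.refl)

  coeff-*-0 : ∀ f g → coeff (f *ᴾ g) 0 K.≈ coeff f 0 K.* coeff g 0
  coeff-*-0 []      g = K.sym (K.zeroˡ _)
  coeff-*-0 (a ∷ f) g = K.trans (coeff-+ (map (a K.*_) g) _ 0)
    (K.trans (K.+-identityʳ _) (coeff-scale a g 0))

  +ᴾ-cong : ∀ {f f′ g g′} → f ≋ f′ → g ≋ g′ → f +ᴾ g ≋ f′ +ᴾ g′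
  +ᴾ-cong {f} {f′} {g} {g′} p q = coefficientwise λ i →
    K.trans (coeff-+ f g i) (K.trans (K.+-cong (at p i) (at q i)) (K.sym (coeff-+ f′ g′ i)))

  -ᴾ-cong : ∀ {f g} → f ≋ g → -ᴾ f ≋ -ᴾ g
  -ᴾ-cong {f} {g} p = coefficientwise λ i →
    K.trans (coeff-neg f i) (K.trans (K.-‿cong (at p i)) (K.sym (coeff-neg g i)))

  +ᴾ-comm : ∀ f g → f +ᴾ g ≋ g +ᴾ f
  +ᴾ-comm f g = coefficientwise λ i →
    K.trans (coeff-+ f g i) (K.trans (K.+-comm _ _) (K.sym (coeff-+ g f i)))

  +ᴾ-identityʳ : ∀ f → f +ᴾ [] ≋ f
  +ᴾ-identityʳ f = +ᴾ-comm f []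

  +ᴾ-assoc : ∀ f g h → (f +ᴾ g) +ᴾ h ≋ f +ᴾ (g +ᴾ h)
  +ᴾ-assoc []      g       h       = ≋-refl
  +ᴾ-assoc (a ∷ f) []      h       = ≋-refl
  +ᴾ-assoc (a ∷ f) (b ∷ g) []      = ≋-refl
  +ᴾ-assoc (a ∷ f) (b ∷ g) (d ∷ h) = ≋-cons (K.+-assoc a b d) (+ᴾ-assoc f g h)

  +ᴾ-inverseʳ : ∀ f → f +ᴾ (-ᴾ f) ≋ []
  +ᴾ-inverseʳ f = coefficientwise λ i → K.trans (coeff-+ f (-ᴾ f) i)
    (K.trans (K.+-congˡ (coeff-neg f i)) (K.-‿inverseʳ _))

  +ᴾ-abelianGroup : AbelianGroup c ℓ₁
  +ᴾ-abelianGroup = record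
    { Carrier = Poly ; _≈_ = _≋_ ; _∙_ = _+ᴾ_ ; ε = [] ; _⁻¹ = -ᴾ_
    ; isAbelianGroup = record
      { isGroup = record
        { isMonoid = record
          { isSemigroup = record
            { isMagma = record
              { isEquivalence = record { refl = ≋-refl ; sym = ≋-sym ; trans = ≋-trans }
              ; ∙-cong = +ᴾ-cong }
            ; assoc = +ᴾ-assoc }
          ; identity = (λ _ → ≋-refl) , +ᴾ-identityʳ }
        ; inverse = (λ f → ≋-trans (+ᴾ-comm _ f) (+ᴾ-inverseʳ f)) , +ᴾ-inverseʳ
        ; ⁻¹-cong = -ᴾ-cong }
      ; comm = +ᴾ-comm } }

  private
    open AbelianGroup +ᴾ-abelianGroup using (setoid)
    open CommutativeSemigroupProperties
      (CommutativeMonoid.commutativeSemigroup (AbelianGroup.commutativeMonoid +ᴾ-abelianGroup))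
      using (interchange; x∙yz≈y∙xz)
    open SetoidReasoning setoid

    infixr 9 _◃_
    _◃_ : Carrier → Poly → Poly
    a ◃ f = map (a K.*_) f

    infixr 9 0◂_
    0◂_ : Poly → Poly
    0◂ f = 0# ∷ f

    ◃-cong : ∀ {a b f g} → a K.≈ b → f ≋ g → a ◃ f ≋ b ◃ g
    ◃-cong {a} {b} {f} {g} p q = coefficientwise λ i → K.trans (coeff-scale a f i)
      (K.trans (K.*-cong p (at q i)) (K.sym (coeff-scale b g i)))

    ◃-distribˡ : ∀ a f g → a ◃ (f +ᴾ g) ≋ a ◃ f +ᴾ a ◃ g
    ◃-distribˡ a []      g       = ≋-refl
    ◃-distribˡ a (b ∷ f) []      = ≋-refl
    ◃-distribˡ a (b ∷ f) (d ∷ g) = ≋-cons (K.distribˡ a b d) (◃-distribˡ a f g)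

    ◃-distribʳ : ∀ a b f → (a K.+ b) ◃ f ≋ a ◃ f +ᴾ b ◃ f
    ◃-distribʳ a b []      = ≋-refl
    ◃-distribʳ a b (d ∷ f) = ≋-cons (K.distribʳ d a b) (◃-distribʳ a b f)

    ◃-assoc : ∀ a b f → (a K.* b) ◃ f ≋ a ◃ b ◃ f
    ◃-assoc a b []      = ≋-refl
    ◃-assoc a b (d ∷ f) = ≋-cons (K.*-assoc a b d) (◃-assoc a b f)

    0◃ : ∀ f → 0# ◃ f ≋ []
    0◃ f = coefficientwise λ i → K.trans (coeff-scale 0# f i) (K.zeroˡ _)

    0◂[] : 0◂ [] ≋ []
    0◂[] = coefficientwise λ { ℕ.zero → K.refl ; (ℕ.suc i) → K.refl }

    0◂-+ : ∀ f g → 0◂ (f +ᴾ g) ≋ 0◂ f +ᴾ 0◂ g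
    0◂-+ f g = ≋-cons (K.sym (K.+-identityˡ 0#)) ≋-refl

  0◂-* : ∀ f g → (0# ∷ f) *ᴾ g ≋ 0# ∷ (f *ᴾ g)
  0◂-* f g = +ᴾ-cong (0◃ g) ≋-refl

  ◃-* : ∀ a f g → map (a K.*_) f *ᴾ g ≋ map (a K.*_) (f *ᴾ g)
  ◃-* a []      g = ≋-refl
  ◃-* a (b ∷ f) g = begin
    (a K.* b) ◃ g +ᴾ 0◂ (a ◃ f *ᴾ g)     ≈⟨ +ᴾ-cong (◃-assoc a b g) (≋-cons (K.sym (K.zeroʳ a)) (◃-* a f g)) ⟩
    a ◃ b ◃ g +ᴾ a ◃ 0◂ (f *ᴾ g)         ≈⟨ ◃-distribˡ a (b ◃ g) (0◂ (f *ᴾ g)) ⟨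
    a ◃ (b ◃ g +ᴾ 0◂ (f *ᴾ g))           ∎

  *ᴾ-zeroʳ : ∀ f → f *ᴾ [] ≋ []
  *ᴾ-zeroʳ []      = ≋-refl
  *ᴾ-zeroʳ (a ∷ f) = ≋-trans (≋-cons K.refl (*ᴾ-zeroʳ f)) 0◂[]

  *ᴾ-cons : ∀ f b g → f *ᴾ (b ∷ g) ≋ map (b K.*_) f +ᴾ (0# ∷ f *ᴾ g)
  *ᴾ-cons []      b g = ≋-sym 0◂[]
  *ᴾ-cons (a ∷ f) b g = ≋-cons (K.+-congʳ (K.*-comm a b)) (begin
    a ◃ g +ᴾ f *ᴾ (b ∷ g)                ≈⟨ +ᴾ-cong ≋-refl (*ᴾ-cons f b g) ⟩
    a ◃ g +ᴾ (b ◃ f +ᴾ 0◂ (f *ᴾ g))      ≈⟨ x∙yz≈y∙xz (a ◃ g) (b ◃ f) (0◂ (f *ᴾ g)) ⟩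
    b ◃ f +ᴾ (a ◃ g +ᴾ 0◂ (f *ᴾ g))      ∎)

  *ᴾ-comm : ∀ f g → f *ᴾ g ≋ g *ᴾ f
  *ᴾ-comm []      g = ≋-sym (*ᴾ-zeroʳ g)
  *ᴾ-comm (a ∷ f) g = ≋-trans (+ᴾ-cong ≋-refl (≋-cons K.refl (*ᴾ-comm f g))) (≋-sym (*ᴾ-cons g a f))

  *ᴾ-congˡ : ∀ f {g h} → g ≋ h → f *ᴾ g ≋ f *ᴾ h
  *ᴾ-congˡ []      p = ≋-refl
  *ᴾ-congˡ (a ∷ f) p = +ᴾ-cong (◃-cong K.refl p) (≋-cons K.refl (*ᴾ-congˡ f p))

  *ᴾ-cong : ∀ {f f′ g g′} → f ≋ f′ → g ≋ g′ → f *ᴾ g ≋ f′ *ᴾ g′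
  *ᴾ-cong {f} {f′} {g} {g′} p q = begin
    f *ᴾ g     ≈⟨ *ᴾ-congˡ f q ⟩
    f *ᴾ g′    ≈⟨ *ᴾ-comm f g′ ⟩
    g′ *ᴾ f    ≈⟨ *ᴾ-congˡ g′ p ⟩
    g′ *ᴾ f′   ≈⟨ *ᴾ-comm g′ f′ ⟩
    f′ *ᴾ g′   ∎

  *ᴾ-distribʳ : ∀ h f g → (f +ᴾ g) *ᴾ h ≋ f *ᴾ h +ᴾ g *ᴾ h
  *ᴾ-distribʳ h []      g       = ≋-refl
  *ᴾ-distribʳ h (a ∷ f) []      = ≋-sym (+ᴾ-identityʳ _)
  *ᴾ-distribʳ h (a ∷ f) (b ∷ g) = begin
    (a K.+ b) ◃ h +ᴾ 0◂ ((f +ᴾ g) *ᴾ h)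
      ≈⟨ +ᴾ-cong (◃-distribʳ a b h) (≋-trans (≋-cons K.refl (*ᴾ-distribʳ h f g)) (0◂-+ (f *ᴾ h) (g *ᴾ h))) ⟩
    (a ◃ h +ᴾ b ◃ h) +ᴾ (0◂ (f *ᴾ h) +ᴾ 0◂ (g *ᴾ h))
      ≈⟨ interchange (a ◃ h) (b ◃ h) (0◂ (f *ᴾ h)) (0◂ (g *ᴾ h)) ⟩
    (a ◃ h +ᴾ 0◂ (f *ᴾ h)) +ᴾ (b ◃ h +ᴾ 0◂ (g *ᴾ h)) ∎

  *ᴾ-assoc : ∀ f g h → (f *ᴾ g) *ᴾ h ≋ f *ᴾ (g *ᴾ h)
  *ᴾ-assoc []      g h = ≋-refl
  *ᴾ-assoc (a ∷ f) g h = begin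
    (a ◃ g +ᴾ 0◂ (f *ᴾ g)) *ᴾ h           ≈⟨ *ᴾ-distribʳ h (a ◃ g) (0◂ (f *ᴾ g)) ⟩
    a ◃ g *ᴾ h +ᴾ 0◂ (f *ᴾ g) *ᴾ h        ≈⟨ +ᴾ-cong (◃-* a g h) (≋-trans (0◂-* (f *ᴾ g) h) (≋-cons K.refl (*ᴾ-assoc f g h))) ⟩
    a ◃ (g *ᴾ h) +ᴾ 0◂ (f *ᴾ (g *ᴾ h))    ∎

  *ᴾ-identityˡ : ∀ f → (1# ∷ []) *ᴾ f ≋ f
  *ᴾ-identityˡ f = coefficientwise λ i → K.trans (coeff-+ (1# ◃ f) (0◂ []) i)
    (K.trans (K.+-cong (K.trans (coeff-scale 1# f i) (K.*-identityˡ _)) (at 0◂[] i)) (K.+-identityʳ _))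

  polynomialRing : CommutativeRing c ℓ₁
  polynomialRing = record
    { Carrier = Poly ; _≈_ = _≋_ ; _+_ = _+ᴾ_ ; _*_ = _*ᴾ_ ; -_ = -ᴾ_ ; 0# = [] ; 1# = 1# ∷ []
    ; isCommutativeRing = record
      { isRing = record
        { +-isAbelianGroup = AbelianGroup.isAbelianGroup +ᴾ-abelianGroup
        ; *-cong     = *ᴾ-cong
        ; *-assoc    = *ᴾ-assoc
        ; *-identity = *ᴾ-identityˡ , λ f → ≋-trans (*ᴾ-comm f _) (*ᴾ-identityˡ f)
        ; distrib    = (λ f g h → ≋-trans (*ᴾ-comm f _) (≋-trans (*ᴾ-distribʳ f g h)
                         (+ᴾ-cong (*ᴾ-comm g f) (*ᴾ-comm h f)))) , *ᴾ-distribʳ }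
      ; *-comm = *ᴾ-comm } }

  nonZero? : ∀ f → Dec (NonZeroᴾ f)
  nonZero? = Any.any? (_#? 0#)

  ¬nonZero⇒≋[] : ∀ {f} → ¬ NonZeroᴾ f → f ≋ []
  ¬nonZero⇒≋[] {[]}    _  = ≋-refl
  ¬nonZero⇒≋[] {a ∷ f} ¬n = ≋-trans
    (≋-cons (K.¬#⇒≈ λ a#0 → ¬n (here a#0)) (¬nonZero⇒≋[] λ n → ¬n (there n))) 0◂[]

  nonZero⇒≉[] : ∀ {f} → NonZeroᴾ f → ¬ f ≋ []
  nonZero⇒≉[] (here a#0) p = K.#⇒≉ a#0 (at p 0)
  nonZero⇒≉[] (there n)  p = nonZero⇒≉[] n (coefficientwise λ i → at p (ℕ.suc i))

  -- A nonzero f - g would have a nonzero product with h; as being nonzero is decidable, f - g must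
  -- vanish.
  *ᴾ-cancelʳ : ∀ f g h → NonZeroᴾ h → f *ᴾ h ≋ g *ᴾ h → f ≋ g
  *ᴾ-cancelʳ f g h h≠0 eq with nonZero? (f +ᴾ (-ᴾ g))
  ... | yes d≠0 = ⊥-elim (nonZero⇒≉[] (RationalFunctions.*ᴾ-nonZero K _#?_ (f +ᴾ (-ᴾ g)) h d≠0 h≠0) (begin
      (f +ᴾ (-ᴾ g)) *ᴾ h           ≈⟨ solve 3 (λ f g h → (f :- g) :* h := f :* h :- g :* h) ≋-refl f g h ⟩
      f *ᴾ h +ᴾ (-ᴾ (g *ᴾ h))      ≈⟨ +ᴾ-cong eq ≋-refl ⟩
      g *ᴾ h +ᴾ (-ᴾ (g *ᴾ h))      ≈⟨ +ᴾ-inverseʳ (g *ᴾ h) ⟩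
      []                           ∎))
    where open IntegerSolver polynomialRing
  ... | no  d≈0 = begin
      f                            ≈⟨ solve 2 (λ f g → f := (f :- g) :+ g) ≋-refl f g ⟩
      (f +ᴾ (-ᴾ g)) +ᴾ g           ≈⟨ +ᴾ-cong (¬nonZero⇒≋[] d≈0) ≋-refl ⟩
      g                            ∎
    where open IntegerSolver polynomialRing

-- Interfaces for K-algebras and for the field K(x).

record AlgebraOver {c ℓ₁ ℓ₂} (K : HeytingField c ℓ₁ ℓ₂) c′ ℓ′ : Set (c ⊔ ℓ₁ ⊔ ℓ₂ ⊔ lsuc (c′ ⊔ ℓ′)) where
  private module K = HeytingField K
  field
    commutativeRing : CommutativeRing c′ ℓ′
  open CommutativeRing commutativeRing
  field
    ι      : K.Carrier → Carrier
    ι-cong : ∀ {a b} → a K.≈ b → ι a ≈ ι b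
    ι-+    : ∀ a b → ι (a K.+ b) ≈ ι a + ι b
    ι-*    : ∀ a b → ι (a K.* b) ≈ ι a * ι b
    ι-1    : ι K.1# ≈ 1#

  evalAt : Polynomials.Poly K → Carrier → Carrier
  evalAt f u = foldr (λ a r → ι a + u * r) 0# f

-- Abstracting K(x) keeps the concrete fractions from unfolding during unification.
record RationalFunctionField {c ℓ₁ ℓ₂} (K : HeytingField c ℓ₁ ℓ₂) c′ ℓ′ : Set (c ⊔ ℓ₁ ⊔ ℓ₂ ⊔ lsuc (c′ ⊔ ℓ′)) where
  private module K = HeytingField K
  open Polynomials K using (Poly; coeff; NonZeroᴾ)
  field
    algebra : AlgebraOver K c′ ℓ′
  open AlgebraOver algebra
  open CommutativeRing commutativeRing
  infix 8 _⁻¹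
  field
    _⁻¹            : Carrier → Carrier
    ⁻¹-inverse     : ∀ {x} → ¬ x ≈ 0# → x * x ⁻¹ ≈ 1#
    ⁻¹-zero        : ∀ {x} → x ≈ 0# → x ⁻¹ ≈ 0#
    ≈0?            : ∀ x → Dec (x ≈ 0#)
    X              : Carrier
    -- Neither lowest terms nor compatibility with equality is demanded: equal elements may carry
    -- different fractions, tied to them only by `fraction`.
    num den        : Carrier → Poly
    den≠0          : ∀ x → NonZeroᴾ (den x)
    fraction       : ∀ x → x * evalAt (den x) X ≈ evalAt (num x) X
    transcendental : ∀ f → evalAt f X ≈ 0# → ∀ i → coeff f i K.≈ K.0#

-- The concrete fractions form a field.

module FractionField {c ℓ₁ ℓ₂} (K : HeytingField c ℓ₁ ℓ₂) (_#?_ : Decidable (HeytingField._#_ K)) where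

  open RationalFunctions K _#?_ hiding (num; den; den≠0)
  open RatFun
  open PolynomialRing K _#?_
  open IntegerSolver polynomialRing
  private
    module K = DiscreteField K _#?_
    module R = RawRing ratFunRing
  open SetoidReasoning (CommutativeRing.setoid polynomialRing)

  infix 4 _≃_
  record _≃_ (f g : RatFun) : Set ℓ₁ where
    constructor cross
    field
      cross-multiplied : num f *ᴾ den g ≋ num g *ᴾ den f
  open _≃_ public

  private
    -- The middle denominator is a common factor of both sides of the desired identity; cancelling
    -- it is where the domain property of K[x] is needed.
    ≃-trans : ∀ {f g h} → f ≃ g → g ≃ h → f ≃ h
    ≃-trans {mkRatFun a b _} {mkRatFun a′ b′ b′≠0} {mkRatFun a″ b″ _} (cross p) (cross q) =
      cross (*ᴾ-cancelʳ (a *ᴾ b″) (a″ *ᴾ b) b′ b′≠0 (begin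
        a *ᴾ b″ *ᴾ b′     ≈⟨ solve 3 (λ x y z → x :* y :* z := x :* z :* y) ≋-refl a b″ b′ ⟩
        a *ᴾ b′ *ᴾ b″     ≈⟨ *ᴾ-cong p ≋-refl ⟩
        a′ *ᴾ b *ᴾ b″     ≈⟨ solve 3 (λ x y z → x :* y :* z := x :* z :* y) ≋-refl a′ b b″ ⟩
        a′ *ᴾ b″ *ᴾ b     ≈⟨ *ᴾ-cong q ≋-refl ⟩
        a″ *ᴾ b′ *ᴾ b     ≈⟨ solve 3 (λ x y z → x :* y :* z := x :* z :* y) ≋-refl a″ b′ b ⟩
        a″ *ᴾ b *ᴾ b′     ∎))

    +-cong : ∀ {f f′ g g′} → f ≃ f′ → g ≃ g′ → f R.+ g ≃ f′ R.+ g′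
    +-cong {mkRatFun a b _} {mkRatFun a′ b′ _} {mkRatFun m n _} {mkRatFun m′ n′ _} (cross p) (cross q) = cross (begin
      (a *ᴾ n +ᴾ m *ᴾ b) *ᴾ (b′ *ᴾ n′)
        ≈⟨ solve 6 (λ a b m n b′ n′ → (a :* n :+ m :* b) :* (b′ :* n′) := (a :* b′) :* (n :* n′) :+ (m :* n′) :* (b :* b′)) ≋-refl a b m n b′ n′ ⟩
      (a *ᴾ b′) *ᴾ (n *ᴾ n′) +ᴾ (m *ᴾ n′) *ᴾ (b *ᴾ b′)
        ≈⟨ +ᴾ-cong (*ᴾ-cong p ≋-refl) (*ᴾ-cong q ≋-refl) ⟩
      (a′ *ᴾ b) *ᴾ (n *ᴾ n′) +ᴾ (m′ *ᴾ n) *ᴾ (b *ᴾ b′)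
        ≈⟨ solve 6 (λ a′ b′ m′ n′ b n → (a′ :* b) :* (n :* n′) :+ (m′ :* n) :* (b :* b′) := (a′ :* n′ :+ m′ :* b′) :* (b :* n)) ≋-refl a′ b′ m′ n′ b n ⟩
      (a′ *ᴾ n′ +ᴾ m′ *ᴾ b′) *ᴾ (b *ᴾ n) ∎)

    *-cong : ∀ {f f′ g g′} → f ≃ f′ → g ≃ g′ → f R.* g ≃ f′ R.* g′
    *-cong {mkRatFun a b _} {mkRatFun a′ b′ _} {mkRatFun m n _} {mkRatFun m′ n′ _} (cross p) (cross q) = cross (begin
      (a *ᴾ m) *ᴾ (b′ *ᴾ n′)     ≈⟨ solve 4 (λ a m b′ n′ → (a :* m) :* (b′ :* n′) := (a :* b′) :* (m :* n′)) ≋-refl a m b′ n′ ⟩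
      (a *ᴾ b′) *ᴾ (m *ᴾ n′)     ≈⟨ *ᴾ-cong p q ⟩
      (a′ *ᴾ b) *ᴾ (m′ *ᴾ n)     ≈⟨ solve 4 (λ a m b n → (a :* b) :* (m :* n) := (a :* m) :* (b :* n)) ≋-refl a′ m′ b n ⟩
      (a′ *ᴾ m′) *ᴾ (b *ᴾ n)     ∎)

    -‿cong : ∀ {f g} → f ≃ g → R.- f ≃ R.- g
    -‿cong {mkRatFun a b _} {mkRatFun a′ b′ _} (cross p) = cross (begin
      (-ᴾ a) *ᴾ b′     ≈⟨ solve 2 (λ a b → (:- a) :* b := :- (a :* b)) ≋-refl a b′ ⟩
      -ᴾ (a *ᴾ b′)     ≈⟨ -ᴾ-cong p ⟩
      -ᴾ (a′ *ᴾ b)     ≈⟨ solve 2 (λ a b → (:- a) :* b := :- (a :* b)) ≋-refl a′ b ⟨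
      (-ᴾ a′) *ᴾ b     ∎)

  fractionRing : CommutativeRing (c ⊔ ℓ₂) ℓ₁
  fractionRing = record
    { Carrier = RatFun ; _≈_ = _≃_ ; _+_ = R._+_ ; _*_ = R._*_ ; -_ = R.-_ ; 0# = R.0# ; 1# = R.1#
    ; isCommutativeRing = record
      { isRing = record
        { +-isAbelianGroup = record
          { isGroup = record
            { isMonoid = record
              { isSemigroup = record
                { isMagma = record
                  { isEquivalence = record
                    { refl  = cross ≋-refl
                    ; sym   = λ p → cross (≋-sym (cross-multiplied p))
                    ; trans = ≃-trans }
                  ; ∙-cong = +-cong }
                ; assoc = λ { (mkRatFun a b _) (mkRatFun a′ b′ _) (mkRatFun a″ b″ _) → cross (solve 6
                    (λ a b a′ b′ a″ b″ →
                      ((a :* b′ :+ a′ :* b) :* b″ :+ a″ :* (b :* b′)) :* (b :* (b′ :* b″)) :=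
                      (a :* (b′ :* b″) :+ (a′ :* b″ :+ a″ :* b′) :* b) :* ((b :* b′) :* b″))
                    ≋-refl a b a′ b′ a″ b″) } }
              ; identity =
                  (λ { (mkRatFun a b _) → cross (solve 2 (λ a b →
                    (:0 :* b :+ a :* :1) :* b := a :* (:1 :* b)) ≋-refl a b) }) ,
                  (λ { (mkRatFun a b _) → cross (solve 2 (λ a b →
                    (a :* :1 :+ :0 :* b) :* b := a :* (b :* :1)) ≋-refl a b) }) }
            ; inverse =
                (λ { (mkRatFun a b _) → cross (solve 2 (λ a b →
                  ((:- a) :* b :+ a :* b) :* :1 := :0 :* (b :* b)) ≋-refl a b) }) ,
                (λ { (mkRatFun a b _) → cross (solve 2 (λ a b →
                  (a :* b :+ (:- a) :* b) :* :1 := :0 :* (b :* b)) ≋-refl a b) })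
            ; ⁻¹-cong = -‿cong }
          ; comm = λ { (mkRatFun a b _) (mkRatFun a′ b′ _) → cross (solve 4 (λ a b a′ b′ →
              (a :* b′ :+ a′ :* b) :* (b′ :* b) := (a′ :* b :+ a :* b′) :* (b :* b′)) ≋-refl a b a′ b′) } }
        ; *-cong = *-cong
        ; *-assoc = λ { (mkRatFun a b _) (mkRatFun a′ b′ _) (mkRatFun a″ b″ _) → cross (solve 6
            (λ a b a′ b′ a″ b″ → (a :* a′ :* a″) :* (b :* (b′ :* b″)) := (a :* (a′ :* a″)) :* (b :* b′ :* b″))
            ≋-refl a b a′ b′ a″ b″) }
        ; *-identity =
            (λ { (mkRatFun a b _) → cross (solve 2 (λ a b → (:1 :* a) :* b := a :* (:1 :* b)) ≋-refl a b) }) ,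
            (λ { (mkRatFun a b _) → cross (solve 2 (λ a b → (a :* :1) :* b := a :* (b :* :1)) ≋-refl a b) })
        ; distrib =
            (λ { (mkRatFun a b _) (mkRatFun a′ b′ _) (mkRatFun a″ b″ _) → cross (solve 6
              (λ a b a′ b′ a″ b″ →
                (a :* (a′ :* b″ :+ a″ :* b′)) :* ((b :* b′) :* (b :* b″)) :=
                ((a :* a′) :* (b :* b″) :+ (a :* a″) :* (b :* b′)) :* (b :* (b′ :* b″)))
              ≋-refl a b a′ b′ a″ b″) }) ,
            (λ { (mkRatFun a b _) (mkRatFun a′ b′ _) (mkRatFun a″ b″ _) → cross (solve 6
              (λ a b a′ b′ a″ b″ →
                ((a′ :* b″ :+ a″ :* b′) :* a) :* ((b′ :* b) :* (b″ :* b)) :=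
                ((a′ :* a) :* (b″ :* b) :+ (a″ :* a) :* (b′ :* b)) :* ((b′ :* b″) :* b))
              ≋-refl a b a′ b′ a″ b″) }) }
      ; *-comm = λ { (mkRatFun a b _) (mkRatFun a′ b′ _) → cross (solve 4 (λ a b a′ b′ →
          (a :* a′) :* (b′ :* b) := (a′ :* a) :* (b :* b′)) ≋-refl a b a′ b′) } } }

  private
    module F = CommutativeRing fractionRing

    poly/1 : Poly → RatFun
    poly/1 f = mkRatFun f (K.1# ∷ []) (here K.1#0)

    X*+ : ∀ a f → (a ∷ []) +ᴾ (K.0# ∷ K.1# ∷ []) *ᴾ f ≋ a ∷ f
    X*+ a f = ≋-trans (+ᴾ-cong (≋-refl {a ∷ []})
      (≋-trans (0◂-* (K.1# ∷ []) f) (≋-cons K.refl (*ᴾ-identityˡ f)))) (≋-cons (K.+-identityʳ a) ≋-refl)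

    -- Each Horner step is a shift of the coefficient list when the argument is `X`. Both `fraction`
    -- and `transcendental` are read off from this.
    evalᴿ-X : ∀ f → evalᴿ f X ≃ poly/1 f
    evalᴿ-X []      = F.refl {R.0#}
    evalᴿ-X (a ∷ f) = F.trans {evalᴿ (a ∷ f) X} {const a R.+ X R.* poly/1 f} {poly/1 (a ∷ f)}
      (F.+-cong {const a} {const a} {X R.* evalᴿ f X} {X R.* poly/1 f} (F.refl {const a})
        (F.*-cong {X} {X} {evalᴿ f X} {poly/1 f} (F.refl {X}) (evalᴿ-X f)))
      (cross (begin
        ((a ∷ []) *ᴾ (one *ᴾ one) +ᴾ (x *ᴾ f) *ᴾ one) *ᴾ one
          ≈⟨ solve 3 (λ a x f → (a :* (:1 :* :1) :+ (x :* f) :* :1) :* :1 := (a :+ x :* f) :* (:1 :* (:1 :* :1))) ≋-refl (a ∷ []) x f ⟩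
        ((a ∷ []) +ᴾ x *ᴾ f) *ᴾ (one *ᴾ (one *ᴾ one))
          ≈⟨ *ᴾ-cong (X*+ a f) (≋-refl {one *ᴾ (one *ᴾ one)}) ⟩
        (a ∷ f) *ᴾ (one *ᴾ (one *ᴾ one)) ∎))
      where
      one x : Poly
      one = K.1# ∷ []
      x   = K.0# ∷ K.1# ∷ []

    num-zero : ∀ {f} → num f ≋ [] → f ≃ R.0#
    num-zero {mkRatFun a b _} p = cross (*ᴾ-cong {a} {[]} p (≋-refl {K.1# ∷ []}))

    const-cong : ∀ {a b} → a K.≈ b → const a ≃ const b
    const-cong p = cross (*ᴾ-cong (≋-cons p (≋-refl {[]})) (≋-refl {K.1# ∷ []}))

    const-+ : ∀ a b → const (a K.+ b) ≃ const a R.+ const b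
    const-+ a b = cross (solve 2 (λ a b → (a :+ b) :* (:1 :* :1) := (a :* :1 :+ b :* :1) :* :1) ≋-refl (a ∷ []) (b ∷ []))

    const-* : ∀ a b → const (a K.* b) ≃ const a R.* const b
    const-* a b = cross (≋-trans
      (*ᴾ-cong {(a K.* b) ∷ []} {(a ∷ []) *ᴾ (b ∷ [])}
        (≋-cons (K.sym (K.+-identityʳ (a K.* b))) ≋-refl) (≋-refl {(K.1# ∷ []) *ᴾ (K.1# ∷ [])}))
      (solve 2 (λ a b → (a :* b) :* (:1 :* :1) := (a :* b) :* :1) ≋-refl (a ∷ []) (b ∷ [])))

    inverseʳ : ∀ f → ¬ f ≃ R.0# → f R.* f ⁻¹ ≃ R.1#
    inverseʳ f f≉0 with Any.any? (λ a → a #? K.0#) (num f)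
    ... | yes _ = cross (solve 2 (λ a b → (a :* b) :* :1 := :1 :* (b :* a)) ≋-refl (num f) (den f))
    ... | no ¬n = ⊥-elim (f≉0 (num-zero (¬nonZero⇒≋[] ¬n)))

    num-of-zero : ∀ {f} → f ≃ R.0# → num f ≋ []
    num-of-zero {mkRatFun a b _} (cross p) = ≋-trans
      (solve 1 (λ a → a := a :* :1) ≋-refl a) p

    zero⁻¹ : ∀ f → f ≃ R.0# → f ⁻¹ ≃ R.0#
    zero⁻¹ f f≃0 with Any.any? (λ a → a #? K.0#) (num f)
    ... | yes n = ⊥-elim (nonZero⇒≉[] n (num-of-zero f≃0))
    ... | no _  = F.refl {R.0#}

    zero? : ∀ f → Dec (f ≃ R.0#)
    zero? f with nonZero? (num f)
    ... | yes n = no λ p → nonZero⇒≉[] n (num-of-zero p)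
    ... | no ¬n = yes (num-zero (¬nonZero⇒≋[] ¬n))

  rationalFunctionField : RationalFunctionField K (c ⊔ ℓ₂) ℓ₁
  rationalFunctionField = record
    { algebra = record { commutativeRing = fractionRing ; ι = const ; ι-cong = const-cong
                       ; ι-+ = const-+ ; ι-* = const-* ; ι-1 = F.refl {R.1#} }
    ; _⁻¹ = _⁻¹ ; ⁻¹-inverse = λ {f} → inverseʳ f ; ⁻¹-zero = λ {f} → zero⁻¹ f ; ≈0? = zero?
    ; X = X
    ; num = num ; den = den ; den≠0 = den≠0
    ; fraction = λ f → F.trans {f R.* evalᴿ (den f) X} {f R.* poly/1 (den f)} {evalᴿ (num f) X}
        (F.*-cong {f} {f} {evalᴿ (den f) X} {poly/1 (den f)} (F.refl {f}) (evalᴿ-X (den f)))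
        (F.trans {f R.* poly/1 (den f)} {poly/1 (num f)} {evalᴿ (num f) X}
          (cross (solve 2 (λ a b → (a :* b) :* :1 := a :* (b :* :1)) ≋-refl (num f) (den f)))
          (F.sym {evalᴿ (num f) X} {poly/1 (num f)} (evalᴿ-X (num f))))
    ; transcendental = λ f p → at (num-of-zero (F.trans {poly/1 f} {evalᴿ f X} {R.0#}
        (F.sym {evalᴿ f X} {poly/1 f} (evalᴿ-X f)) p))
    }

-- Evaluation of polynomials in K-algebras and division by linear factors.

module Evaluation {c ℓ₁ ℓ₂ c′ ℓ′} (K : HeytingField c ℓ₁ ℓ₂) (_#?_ : Decidable (HeytingField._#_ K))
                  (A : AlgebraOver K c′ ℓ′) where

  open AlgebraOver A public using (ι; ι-cong; ι-+; ι-*; ι-1; evalAt)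
  open AlgebraOver A using (commutativeRing)
  open CommutativeRing commutativeRing public hiding (zero)
  open IntegerSolver commutativeRing public
  open PolynomialRing K _#?_
  private module K = DiscreteField K _#?_
  open SetoidReasoning setoid
  open AbelianGroupProperties +-abelianGroup using (inverseˡ-unique)

  ι-0 : ι K.0# ≈ 0#
  ι-0 = begin
    ι K.0#                              ≈⟨ solve 1 (λ x → x := x :+ x :- x) refl (ι K.0#) ⟩
    ι K.0# + ι K.0# - ι K.0#            ≈⟨ +-congʳ (ι-+ K.0# K.0#) ⟨
    ι (K.0# K.+ K.0#) - ι K.0#          ≈⟨ +-congʳ (ι-cong (K.+-identityʳ K.0#)) ⟩
    ι K.0# - ι K.0#                     ≈⟨ -‿inverseʳ _ ⟩
    0#                                  ∎

  ι-neg : ∀ a → ι (K.- a) ≈ - ι a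
  ι-neg a = inverseˡ-unique _ _ (trans (sym (ι-+ _ _)) (trans (ι-cong (K.-‿inverseˡ a)) ι-0))

  ι-- : ∀ a b → ι (a K.- b) ≈ ι a - ι b
  ι-- a b = trans (ι-+ a (K.- b)) (+-congˡ (ι-neg b))

  eval-+ : ∀ f g u → evalAt (f +ᴾ g) u ≈ evalAt f u + evalAt g u
  eval-+ []      g       u = sym (+-identityˡ _)
  eval-+ (a ∷ f) []      u = sym (+-identityʳ _)
  eval-+ (a ∷ f) (b ∷ g) u = begin
    ι (a K.+ b) + u * evalAt (f +ᴾ g) u                ≈⟨ +-cong (ι-+ a b) (*-congˡ (eval-+ f g u)) ⟩
    ι a + ι b + u * (evalAt f u + evalAt g u)          ≈⟨ solve 5 (λ a b u f g → a :+ b :+ u :* (f :+ g) := a :+ u :* f :+ (b :+ u :* g)) refl (ι a) (ι b) u (evalAt f u) (evalAt g u) ⟩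
    ι a + u * evalAt f u + (ι b + u * evalAt g u)      ∎

  eval-scale : ∀ a f u → evalAt (map (a K.*_) f) u ≈ ι a * evalAt f u
  eval-scale a []      u = sym (zeroʳ _)
  eval-scale a (b ∷ f) u = begin
    ι (a K.* b) + u * evalAt (map (a K.*_) f) u    ≈⟨ +-cong (ι-* a b) (*-congˡ (eval-scale a f u)) ⟩
    ι a * ι b + u * (ι a * evalAt f u)             ≈⟨ solve 4 (λ a b u f → a :* b :+ u :* (a :* f) := a :* (b :+ u :* f)) refl (ι a) (ι b) u (evalAt f u) ⟩
    ι a * (ι b + u * evalAt f u)                   ∎

  eval-* : ∀ f g u → evalAt (f *ᴾ g) u ≈ evalAt f u * evalAt g u
  eval-* []      g u = sym (zeroˡ _)
  eval-* (a ∷ f) g u = begin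
    evalAt (map (a K.*_) g +ᴾ (K.0# ∷ f *ᴾ g)) u
      ≈⟨ eval-+ (map (a K.*_) g) (K.0# ∷ f *ᴾ g) u ⟩
    evalAt (map (a K.*_) g) u + (ι K.0# + u * evalAt (f *ᴾ g) u)
      ≈⟨ +-cong (eval-scale a g u) (+-cong ι-0 (*-congˡ (eval-* f g u))) ⟩
    ι a * evalAt g u + (0# + u * (evalAt f u * evalAt g u))
      ≈⟨ solve 4 (λ a u f g → a :* g :+ (:0 :+ u :* (f :* g)) := (a :+ u :* f) :* g) refl (ι a) u (evalAt f u) (evalAt g u) ⟩
    (ι a + u * evalAt f u) * evalAt g u ∎

  eval-zero : ∀ f u → f ≋ [] → evalAt f u ≈ 0#
  eval-zero []      u p = refl
  eval-zero (a ∷ f) u p = begin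
    ι a + u * evalAt f u
      ≈⟨ +-cong (trans (ι-cong (at p 0)) ι-0) (*-congˡ (eval-zero f u (coefficientwise λ i → at p (ℕ.suc i)))) ⟩
    0# + u * 0#            ≈⟨ solve 1 (λ u → :0 :+ u :* :0 := :0) refl u ⟩
    0#                     ∎

  eval-neg : ∀ f u → evalAt (-ᴾ f) u ≈ - evalAt f u
  eval-neg f u = inverseˡ-unique _ _
    (trans (sym (eval-+ (-ᴾ f) f u)) (eval-zero (-ᴾ f +ᴾ f) u (AbelianGroup.inverseˡ +ᴾ-abelianGroup f)))

  eval-cong : ∀ {u v} f → u ≈ v → evalAt f u ≈ evalAt f v
  eval-cong []      p = refl
  eval-cong (a ∷ f) p = +-congˡ (*-cong p (eval-cong f p))

  -- Synthetic division: dividing `a ∷ f` by x - r leaves a quotient whose coefficients are the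
  -- values at r of the successive tails, so a itself does not occur in it.
  quotient : Poly → K.Carrier → Poly
  quotient []      r = []
  quotient (b ∷ g) r = eval (b ∷ g) r ∷ quotient g r

  length-quotient : ∀ f r → length (quotient f r) ≡ length f
  length-quotient []      r = ≡.refl
  length-quotient (b ∷ g) r = ≡.cong ℕ.suc (length-quotient g r)

  division : ∀ a f r u → evalAt (a ∷ f) u ≈ ι (eval (a ∷ f) r) + (u - ι r) * evalAt (quotient f r) u
  division a []      r u = begin
    ι a + u * 0#                                  ≈⟨ +-congʳ (ι-cong (K.solve 2 (λ a r → a K.:= a K.:+ r K.:* K.:0) K.refl a r)) ⟩
    ι (a K.+ r K.* K.0#) + u * 0#                 ≈⟨ solve 3 (λ e u r → e :+ u :* :0 := e :+ (u :- r) :* :0) refl _ u (ι r) ⟩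
    ι (a K.+ r K.* K.0#) + (u - ι r) * 0#         ∎
  division a (b ∷ g) r u = begin
    ι a + u * evalAt (b ∷ g) u                    ≈⟨ +-congˡ (*-congˡ (division b g r u)) ⟩
    ι a + u * (ι e + (u - ι r) * q)               ≈⟨ solve 5 (λ a u e r q → a :+ u :* (e :+ (u :- r) :* q) := a :+ r :* e :+ (u :- r) :* (e :+ u :* q)) refl (ι a) u (ι e) (ι r) q ⟩
    ι a + ι r * ι e + (u - ι r) * (ι e + u * q)   ≈⟨ +-congʳ (trans (ι-+ a (r K.* e)) (+-congˡ (ι-* r e))) ⟨
    ι (a K.+ r K.* e) + (u - ι r) * (ι e + u * q) ∎
    where
    e = eval (b ∷ g) r
    q = evalAt (quotient g r) u

  -- Division by x - r keeps the leading coefficient: a tail whose remaining entries are zero has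
  -- its head as value at r.
  quotient-nonZero : ∀ {f} r → NonZeroᴾ f → NonZeroᴾ (quotient f r)
  quotient-nonZero r (there n) = there (quotient-nonZero r n)
  quotient-nonZero {b ∷ g} r (here b#0) with nonZero? g
  ... | yes n = there (quotient-nonZero r n)
  ... | no ¬n = here (K.#-congʳ (K.sym eq) b#0)
    where
    eval-[] : ∀ g → g ≋ [] → eval g r K.≈ K.0#
    eval-[] []      p = K.refl
    eval-[] (a ∷ g) p = K.trans (K.+-cong (at p 0) (K.*-congˡ (eval-[] g (coefficientwise λ i → at p (ℕ.suc i)))))
      (K.solve 1 (λ r → K.:0 K.:+ r K.:* K.:0 K.:= K.:0) K.refl r)

    eq : b K.+ r K.* eval g r K.≈ b
    eq = K.trans (K.+-congˡ (K.*-congˡ (eval-[] g (¬nonZero⇒≋[] ¬n))))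
      (K.solve 2 (λ b r → b K.:+ r K.:* K.:0 K.:= b) K.refl b r)

-- Field arithmetic in K(x).

module FunctionField {c ℓ₁ ℓ₂ c′ ℓ′} (K : HeytingField c ℓ₁ ℓ₂) (_#?_ : Decidable (HeytingField._#_ K))
                     (L : RationalFunctionField K c′ ℓ′) where

  open RationalFunctionField L public hiding (algebra)
  open Evaluation K _#?_ (RationalFunctionField.algebra L) public
  open PolynomialRing K _#?_ public
  open SemiringExp semiring public using (_^_; ^-homo-*; ^-congˡ)
  private module K = DiscreteField K _#?_
  open SetoidReasoning setoid

  1≉0 : ¬ 1# ≈ 0#
  1≉0 1≈0 = K.#⇒≉ K.1#0 (transcendental (K.1# ∷ []) (begin
    ι K.1# + X * 0#     ≈⟨ +-cong ι-1 (zeroʳ X) ⟩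
    1# + 0#             ≈⟨ +-identityʳ 1# ⟩
    1#                  ≈⟨ 1≈0 ⟩
    0#                  ∎) 0)

  *-≉0ˡ : ∀ {x y} → ¬ x ≈ 0# → x * y ≈ 0# → y ≈ 0#
  *-≉0ˡ {x} {y} x≉0 xy≈0 = begin
    y                   ≈⟨ *-identityˡ y ⟨
    1# * y              ≈⟨ *-congʳ (⁻¹-inverse x≉0) ⟨
    x * x ⁻¹ * y        ≈⟨ solve 3 (λ x i y → x :* i :* y := i :* (x :* y)) refl x (x ⁻¹) y ⟩
    x ⁻¹ * (x * y)      ≈⟨ *-congˡ xy≈0 ⟩
    x ⁻¹ * 0#           ≈⟨ zeroʳ _ ⟩
    0#                  ∎

  *-≉0 : ∀ {x y} → ¬ x ≈ 0# → ¬ y ≈ 0# → ¬ x * y ≈ 0#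
  *-≉0 x≉0 y≉0 xy≈0 = y≉0 (*-≉0ˡ x≉0 xy≈0)

  invertible⇒≉0 : ∀ {x y} → x * y ≈ 1# → ¬ x ≈ 0#
  invertible⇒≉0 {x} {y} xy≈1 x≈0 = 1≉0 (trans (sym xy≈1) (trans (*-congʳ x≈0) (zeroˡ y)))

  *-cancelˡ : ∀ {x y z} → ¬ x ≈ 0# → x * y ≈ x * z → y ≈ z
  *-cancelˡ {x} {y} {z} x≉0 eq = begin
    y               ≈⟨ solve 2 (λ y z → y := y :- z :+ z) refl y z ⟩
    y - z + z       ≈⟨ +-congʳ (*-≉0ˡ x≉0 zero-diff) ⟩
    0# + z          ≈⟨ +-identityˡ z ⟩
    z               ∎
    where
    zero-diff = begin
      x * (y - z)       ≈⟨ solve 3 (λ x y z → x :* (y :- z) := x :* y :- x :* z) refl x y z ⟩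
      x * y - x * z     ≈⟨ +-congʳ eq ⟩
      x * z - x * z     ≈⟨ -‿inverseʳ _ ⟩
      0#                ∎

  ⁻¹-unique : ∀ {x y} → x * y ≈ 1# → x ⁻¹ ≈ y
  ⁻¹-unique {x} {y} xy≈1 = *-cancelˡ x≉0 (trans (⁻¹-inverse x≉0) (sym xy≈1))
    where x≉0 = invertible⇒≉0 xy≈1

  ⁻¹-cong : ∀ {x y} → x ≈ y → x ⁻¹ ≈ y ⁻¹
  ⁻¹-cong {x} {y} x≈y with ≈0? y
  ... | yes y≈0 = trans (⁻¹-zero (trans x≈y y≈0)) (sym (⁻¹-zero y≈0))
  ... | no  y≉0 = ⁻¹-unique (trans (*-congʳ x≈y) (⁻¹-inverse y≉0))

  ι-≉0 : ∀ {a} → a K.# K.0# → ¬ ι a ≈ 0#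
  ι-≉0 {a} a#0 with b , ab≈1 , _ ← K.inverse a#0 =
    invertible⇒≉0 (trans (sym (ι-* a b)) (trans (ι-cong ab≈1) ι-1))

  ^-≉0 : ∀ {x} n → ¬ x ≈ 0# → ¬ x ^ n ≈ 0#
  ^-≉0 ℕ.zero    x≉0 = 1≉0
  ^-≉0 (ℕ.suc n) x≉0 = *-≉0 x≉0 (^-≉0 n x≉0)

-- Substitution as an endomorphism of K(x).

module Substitution {c ℓ₁ ℓ₂ c′ ℓ′} (K : HeytingField c ℓ₁ ℓ₂) (_#?_ : Decidable (HeytingField._#_ K))
                    (L : RationalFunctionField K c′ ℓ′) where

  open FunctionField K _#?_ L public
  private module K = DiscreteField K _#?_
  open SetoidReasoning setoid
  open AbelianGroupProperties +-abelianGroup using (inverseˡ-unique)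
  open RawSemiringDefinitions (Semiring.rawSemiring semiring) public using (sum)

  -- Both cross products equal x d d′ at `X`, and `X` is transcendental. An identity in K(x) thereby
  -- becomes one between polynomials, which holds at every argument; this makes constructions on
  -- fractions independent of the fraction chosen.
  proportional⇒≋ : ∀ {x} n d n′ d′ → x * evalAt d X ≈ evalAt n X → x * evalAt d′ X ≈ evalAt n′ X →
                   n *ᴾ d′ ≋ n′ *ᴾ d
  proportional⇒≋ {x} n d n′ d′ xd≈n xd′≈n′ = -≈[]⇒≋ (n *ᴾ d′) (n′ *ᴾ d) (coefficientwise (transcendental (n *ᴾ d′ +ᴾ (-ᴾ (n′ *ᴾ d))) (begin
    evalAt (n *ᴾ d′ +ᴾ (-ᴾ (n′ *ᴾ d))) X
      ≈⟨ eval-+ (n *ᴾ d′) (-ᴾ (n′ *ᴾ d)) X ⟩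
    evalAt (n *ᴾ d′) X + evalAt (-ᴾ (n′ *ᴾ d)) X
      ≈⟨ +-cong (eval-* n d′ X) (trans (eval-neg (n′ *ᴾ d) X) (-‿cong (eval-* n′ d X))) ⟩
    evalAt n X * evalAt d′ X - evalAt n′ X * evalAt d X
      ≈⟨ +-cong (*-congʳ xd≈n) (-‿cong (*-congʳ xd′≈n′)) ⟨
    x * evalAt d X * evalAt d′ X - x * evalAt d′ X * evalAt d X
      ≈⟨ solve 3 (λ x d d′ → x :* d :* d′ :- x :* d′ :* d := :0) refl x (evalAt d X) (evalAt d′ X) ⟩
    0# ∎)))
    where
    open AbelianGroupProperties +ᴾ-abelianGroup using () renaming (x∙y⁻¹≈ε⇒x≈y to -≈[]⇒≋)

  record Endomorphism : Set (c ⊔ c′ ⊔ ℓ′) where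
    field
      φ      : Carrier → Carrier
      φ-cong : ∀ {x y} → x ≈ y → φ x ≈ φ y
      φ-+    : ∀ x y → φ (x + y) ≈ φ x + φ y
      φ-*    : ∀ x y → φ (x * y) ≈ φ x * φ y
      φ-ι    : ∀ a → φ (ι a) ≈ ι a

    φ-0 : φ 0# ≈ 0#
    φ-0 = trans (φ-cong (sym ι-0)) (trans (φ-ι K.0#) ι-0)

    φ-1 : φ 1# ≈ 1#
    φ-1 = trans (φ-cong (sym ι-1)) (trans (φ-ι K.1#) ι-1)

    φ-neg : ∀ x → φ (- x) ≈ - φ x
    φ-neg x = inverseˡ-unique _ _ (trans (sym (φ-+ (- x) x)) (trans (φ-cong (-‿inverseˡ x)) φ-0))

    -- Zero is no exception thanks to the convention that its inverse is 0; elsewhere the image of x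
    -- is invertible because a product equal to 1 is preserved.
    φ-⁻¹ : ∀ x → φ (x ⁻¹) ≈ φ x ⁻¹
    φ-⁻¹ x with ≈0? x
    ... | yes x≈0 = trans (trans (φ-cong (⁻¹-zero x≈0)) φ-0) (sym (⁻¹-zero (trans (φ-cong x≈0) φ-0)))
    ... | no  x≉0 = sym (⁻¹-unique (trans (sym (φ-* x (x ⁻¹))) (trans (φ-cong (⁻¹-inverse x≉0)) φ-1)))

    φ-^ : ∀ x n → φ (x ^ n) ≈ φ x ^ n
    φ-^ x ℕ.zero    = φ-1
    φ-^ x (ℕ.suc n) = trans (φ-* x (x ^ n)) (*-congˡ (φ-^ x n))

    φ-sum : ∀ {n} (f : Fin n → Carrier) → φ (sum f) ≈ sum (λ i → φ (f i))
    φ-sum {ℕ.zero}  f = φ-0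
    φ-sum {ℕ.suc n} f = trans (φ-+ (f zero) (sum (λ i → f (suc i)))) (+-congˡ (φ-sum (λ i → f (suc i))))

  NonConstant : Carrier → Set (c ⊔ ℓ′)
  NonConstant u = ∀ r → ¬ u ≈ ι r

  -- For the concrete K(x) this unfolds to `_∘ᴿ_`, so that the hypothesis of the theorem can be used
  -- as it stands.
  compose : Carrier → Carrier → Carrier
  compose u x = evalAt (num x) u * evalAt (den x) u ⁻¹

  module _ (closed : ∀ a f → NonZeroᴾ f → ∃ λ x → eval (a ∷ f) x K.≈ K.0#)
           (u : Carrier) (nonConstant : NonConstant u) where

    -- Over an algebraically closed field f(u) is a product of factors u - r.
    eval-≉0 : ∀ f → NonZeroᴾ f → ¬ evalAt f u ≈ 0#
    eval-≉0 f = go (length f) f ≡.refl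
      where
      go : ∀ n f → length f ≡ n → NonZeroᴾ f → ¬ evalAt f u ≈ 0#
      go (ℕ.suc n) (a ∷ f) eq nz fu≈0 with nonZero? f | nz
      ... | no ¬f≠0 | there f≠0 = ¬f≠0 f≠0
      ... | no ¬f≠0 | here a#0  = ι-≉0 a#0 (begin
        ι a                       ≈⟨ solve 2 (λ a u → a := a :+ u :* :0) refl (ι a) u ⟩
        ι a + u * 0#              ≈⟨ +-congˡ (*-congˡ (eval-zero f u (¬nonZero⇒≋[] ¬f≠0))) ⟨
        ι a + u * evalAt f u      ≈⟨ fu≈0 ⟩
        0#                        ∎)
      ... | yes f≠0 | _ with r , root ← closed a f f≠0 =
        *-≉0 u-r≉0 (go n (quotient f r) (≡.trans (length-quotient f r) (ℕ.suc-injective eq)) (quotient-nonZero r f≠0)) (begin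
          (u - ι r) * q                         ≈⟨ +-identityˡ _ ⟨
          0# + (u - ι r) * q                    ≈⟨ +-congʳ (trans (ι-cong root) ι-0) ⟨
          ι (eval (a ∷ f) r) + (u - ι r) * q    ≈⟨ division a f r u ⟨
          evalAt (a ∷ f) u                      ≈⟨ fu≈0 ⟩
          0#                                    ∎)
        where
        q = evalAt (quotient f r) u
        u-r≉0 : ¬ u - ι r ≈ 0#
        u-r≉0 eq = nonConstant r (trans (solve 2 (λ u r → u := u :- r :+ r) refl u (ι r)) (trans (+-congʳ eq) (+-identityˡ _)))

    -- `compose` works with one chosen fraction N/D of x. For another fraction n/d the identity N d
    -- = n D holds between polynomials, hence also at u, where D does not vanish.
    compose-fraction : ∀ x n d → x * evalAt d X ≈ evalAt n X → compose u x * evalAt d u ≈ evalAt n u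
    compose-fraction x n d xd≈n = begin
      evalAt N u * evalAt D u ⁻¹ * evalAt d u      ≈⟨ solve 3 (λ N i d → N :* i :* d := N :* d :* i) refl (evalAt N u) _ (evalAt d u) ⟩
      evalAt N u * evalAt d u * evalAt D u ⁻¹      ≈⟨ *-congʳ (trans (sym (eval-* N d u)) (trans (eval-≋ (proportional⇒≋ N D n d (fraction x) xd≈n)) (eval-* n D u))) ⟩
      evalAt n u * evalAt D u * evalAt D u ⁻¹      ≈⟨ *-assoc _ _ _ ⟩
      evalAt n u * (evalAt D u * evalAt D u ⁻¹)    ≈⟨ *-congˡ (⁻¹-inverse (eval-≉0 D (den≠0 x))) ⟩
      evalAt n u * 1#                              ≈⟨ *-identityʳ _ ⟩
      evalAt n u                                   ∎
      where
      N = num x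
      D = den x
      eval-≋ : ∀ {f g} → f ≋ g → evalAt f u ≈ evalAt g u
      eval-≋ {f} {g} p = begin
        evalAt f u                                   ≈⟨ solve 2 (λ f g → f := f :- g :+ g) refl (evalAt f u) (evalAt g u) ⟩
        evalAt f u - evalAt g u + evalAt g u         ≈⟨ +-congʳ (trans (eval-+ f (-ᴾ g) u) (+-congˡ (eval-neg g u))) ⟨
        evalAt (f +ᴾ (-ᴾ g)) u + evalAt g u          ≈⟨ +-congʳ (eval-zero (f +ᴾ (-ᴾ g)) u (≋-trans (+ᴾ-cong p (≋-refl { -ᴾ g})) (+ᴾ-inverseʳ g))) ⟩
        0# + evalAt g u                              ≈⟨ +-identityˡ _ ⟩
        evalAt g u                                   ∎

    -- The laws of `substitution` all reduce to this: exhibit one fraction of x and check that y is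
    -- the same fraction with u in place of `X`.
    compose-unique : ∀ x y n d → NonZeroᴾ d → x * evalAt d X ≈ evalAt n X → y * evalAt d u ≈ evalAt n u →
                     compose u x ≈ y
    compose-unique x y n d d≠0 xd≈n yd≈n = *-cancelˡ (eval-≉0 d d≠0)
      (trans (*-comm _ _) (trans (compose-fraction x n d xd≈n) (trans (sym yd≈n) (*-comm _ _))))

    private
      one : Poly
      one = K.1# ∷ []

      eval-one : ∀ v → evalAt one v ≈ 1#
      eval-one v = trans (+-cong ι-1 (zeroʳ v)) (+-identityʳ 1#)

      eval-const : ∀ a v → evalAt (a ∷ []) v ≈ ι a
      eval-const a v = trans (+-congˡ (zeroʳ v)) (+-identityʳ (ι a))

      eval-id : ∀ v → evalAt (K.0# ∷ one) v ≈ v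
      eval-id v = trans (+-cong ι-0 (*-congˡ (eval-one v))) (solve 1 (λ v → :0 :+ v :* :1 := v) refl v)

    compose-X : compose u X ≈ u
    compose-X = compose-unique X u (K.0# ∷ one) one (here K.1#0)
      (trans (*-congˡ (eval-one X)) (trans (*-identityʳ X) (sym (eval-id X))))
      (trans (*-congˡ (eval-one u)) (trans (*-identityʳ u) (sym (eval-id u))))

    substitution : Endomorphism
    substitution = record
      { φ      = compose u
      ; φ-cong = λ {x} {y} x≈y → compose-unique x (compose u y) (num y) (den y) (den≠0 y)
          (trans (*-congʳ x≈y) (fraction y)) (compose-fraction y (num y) (den y) (fraction y))
      ; φ-+    = λ x y → compose-unique (x + y) (compose u x + compose u y)
          (num x *ᴾ den y +ᴾ num y *ᴾ den x) (den x *ᴾ den y) (den*den≠0 x y)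
          (sum-fraction X x y x y (fraction x) (fraction y))
          (sum-fraction u x y (compose u x) (compose u y)
            (compose-fraction x (num x) (den x) (fraction x)) (compose-fraction y (num y) (den y) (fraction y)))
      ; φ-*    = λ x y → compose-unique (x * y) (compose u x * compose u y)
          (num x *ᴾ num y) (den x *ᴾ den y) (den*den≠0 x y)
          (product-fraction X x y x y (fraction x) (fraction y))
          (product-fraction u x y (compose u x) (compose u y)
            (compose-fraction x (num x) (den x) (fraction x)) (compose-fraction y (num y) (den y) (fraction y)))
      ; φ-ι    = λ a → compose-unique (ι a) (ι a) (a ∷ []) one (here K.1#0) (const-fraction a X) (const-fraction a u)
      }
      where
      den*den≠0 : ∀ x y → NonZeroᴾ (den x *ᴾ den y)
      den*den≠0 x y = RationalFunctions.*ᴾ-nonZero K _#?_ (den x) (den y) (den≠0 x) (den≠0 y)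

      const-fraction : ∀ a v → ι a * evalAt one v ≈ evalAt (a ∷ []) v
      const-fraction a v = trans (*-congˡ (eval-one v)) (trans (*-identityʳ (ι a)) (sym (eval-const a v)))

      -- Taking v = `X` concerns x and y themselves, taking v = u concerns their composites;
      -- `compose-unique` asks for both.
      sum-fraction : ∀ v x y x′ y′ → x′ * evalAt (den x) v ≈ evalAt (num x) v → y′ * evalAt (den y) v ≈ evalAt (num y) v →
                     (x′ + y′) * evalAt (den x *ᴾ den y) v ≈ evalAt (num x *ᴾ den y +ᴾ num y *ᴾ den x) v
      sum-fraction v x y x′ y′ p q = begin
        (x′ + y′) * evalAt (den x *ᴾ den y) v             ≈⟨ *-congˡ (eval-* (den x) (den y) v) ⟩
        (x′ + y′) * (dx * dy)                             ≈⟨ solve 4 (λ x y dx dy → (x :+ y) :* (dx :* dy) := x :* dx :* dy :+ y :* dy :* dx) refl x′ y′ dx dy ⟩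
        x′ * dx * dy + y′ * dy * dx                       ≈⟨ +-cong (*-congʳ p) (*-congʳ q) ⟩
        nx * dy + ny * dx                                 ≈⟨ trans (eval-+ (num x *ᴾ den y) (num y *ᴾ den x) v) (+-cong (eval-* (num x) (den y) v) (eval-* (num y) (den x) v)) ⟨
        evalAt (num x *ᴾ den y +ᴾ num y *ᴾ den x) v       ∎
        where
        dx = evalAt (den x) v
        dy = evalAt (den y) v
        nx = evalAt (num x) v
        ny = evalAt (num y) v

      product-fraction : ∀ v x y x′ y′ → x′ * evalAt (den x) v ≈ evalAt (num x) v → y′ * evalAt (den y) v ≈ evalAt (num y) v →
                         (x′ * y′) * evalAt (den x *ᴾ den y) v ≈ evalAt (num x *ᴾ num y) v
      product-fraction v x y x′ y′ p q = begin
        (x′ * y′) * evalAt (den x *ᴾ den y) v                  ≈⟨ *-congˡ (eval-* (den x) (den y) v) ⟩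
        (x′ * y′) * (evalAt (den x) v * evalAt (den y) v)      ≈⟨ solve 4 (λ x y dx dy → (x :* y) :* (dx :* dy) := (x :* dx) :* (y :* dy)) refl x′ y′ (evalAt (den x) v) (evalAt (den y) v) ⟩
        (x′ * evalAt (den x) v) * (y′ * evalAt (den y) v)      ≈⟨ *-cong p q ⟩
        evalAt (num x) v * evalAt (num y) v                    ≈⟨ eval-* (num x) (num y) v ⟨
        evalAt (num x *ᴾ num y) v                              ∎

-- Values and pole orders at the point 0.

module PoleOrder {c ℓ₁ ℓ₂ c′ ℓ′} (K : HeytingField c ℓ₁ ℓ₂) (_#?_ : Decidable (HeytingField._#_ K))
                 (L : RationalFunctionField K c′ ℓ′) where

  open Substitution K _#?_ L public
  private module K = DiscreteField K _#?_
  module K^ = SemiringExp K.semiring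
  open SetoidReasoning setoid
  open RingProperties ring using (-1*x≈-x)

  -- x is regular at the point 0, with value a there.
  record Value (x : Carrier) (a : K.Carrier) : Set (c ⊔ ℓ₁ ⊔ ℓ₂ ⊔ ℓ′) where
    field
      numer denom : Poly
      denom#0     : coeff denom 0 K.# K.0#
      numer≈      : coeff numer 0 K.≈ a K.* coeff denom 0
      represents  : x * evalAt denom X ≈ evalAt numer X
  open Value

  value-cong : ∀ {x y a b} → x ≈ y → a K.≈ b → Value x a → Value y b
  value-cong x≈y a≈b v = record
    { numer = numer v ; denom = denom v ; denom#0 = denom#0 v
    ; numer≈ = K.trans (numer≈ v) (K.*-congʳ a≈b)
    ; represents = trans (*-congʳ (sym x≈y)) (represents v) }

  value-+ : ∀ {x y a b} → Value x a → Value y b → Value (x + y) (a K.+ b)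
  value-+ {x} {y} {a} {b} v w = record
    { numer = numer v *ᴾ denom w +ᴾ numer w *ᴾ denom v ; denom = denom v *ᴾ denom w
    ; denom#0 = K.#-congʳ (K.sym (coeff-*-0 (denom v) (denom w))) (K.x#0y#0→xy#0 (denom#0 v) (denom#0 w))
    ; numer≈ = K.trans (coeff-+ (numer v *ᴾ denom w) (numer w *ᴾ denom v) 0)
        (K.trans (K.+-cong (K.trans (coeff-*-0 (numer v) (denom w)) (K.*-congʳ (numer≈ v)))
                           (K.trans (coeff-*-0 (numer w) (denom v)) (K.*-congʳ (numer≈ w))))
        (K.trans (K.solve 4 (λ a b d e → a K.:* d K.:* e K.:+ b K.:* e K.:* d K.:= (a K.:+ b) K.:* (d K.:* e)) K.refl
                   a b (coeff (denom v) 0) (coeff (denom w) 0))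
                 (K.*-congˡ (K.sym (coeff-*-0 (denom v) (denom w))))))
    ; represents = begin
        (x + y) * evalAt (denom v *ᴾ denom w) X   ≈⟨ *-congˡ (eval-* (denom v) (denom w) X) ⟩
        (x + y) * (d * e)                         ≈⟨ solve 4 (λ x y d e → (x :+ y) :* (d :* e) := x :* d :* e :+ y :* e :* d) refl x y d e ⟩
        x * d * e + y * e * d                     ≈⟨ +-cong (*-congʳ (represents v)) (*-congʳ (represents w)) ⟩
        evalAt (numer v) X * e + evalAt (numer w) X * d
          ≈⟨ trans (eval-+ (numer v *ᴾ denom w) (numer w *ᴾ denom v) X) (+-cong (eval-* (numer v) (denom w) X) (eval-* (numer w) (denom v) X)) ⟨
        evalAt (numer v *ᴾ denom w +ᴾ numer w *ᴾ denom v) X ∎ }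
    where
    d = evalAt (denom v) X
    e = evalAt (denom w) X

  value-* : ∀ {x y a b} → Value x a → Value y b → Value (x * y) (a K.* b)
  value-* {x} {y} {a} {b} v w = record
    { numer = numer v *ᴾ numer w ; denom = denom v *ᴾ denom w
    ; denom#0 = K.#-congʳ (K.sym (coeff-*-0 (denom v) (denom w))) (K.x#0y#0→xy#0 (denom#0 v) (denom#0 w))
    ; numer≈ = K.trans (coeff-*-0 (numer v) (numer w)) (K.trans (K.*-cong (numer≈ v) (numer≈ w))
        (K.trans (K.solve 4 (λ a b d e → (a K.:* d) K.:* (b K.:* e) K.:= (a K.:* b) K.:* (d K.:* e)) K.refl
                   a b (coeff (denom v) 0) (coeff (denom w) 0))
                 (K.*-congˡ (K.sym (coeff-*-0 (denom v) (denom w))))))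
    ; represents = begin
        (x * y) * evalAt (denom v *ᴾ denom w) X   ≈⟨ *-congˡ (eval-* (denom v) (denom w) X) ⟩
        (x * y) * (d * e)                         ≈⟨ solve 4 (λ x y d e → (x :* y) :* (d :* e) := (x :* d) :* (y :* e)) refl x y d e ⟩
        (x * d) * (y * e)                         ≈⟨ *-cong (represents v) (represents w) ⟩
        evalAt (numer v) X * evalAt (numer w) X   ≈⟨ eval-* (numer v) (numer w) X ⟨
        evalAt (numer v *ᴾ numer w) X             ∎ }
    where
    d = evalAt (denom v) X
    e = evalAt (denom w) X

  value-eval : ∀ f → Value (evalAt f X) (coeff f 0)
  value-eval f = record
    { numer = f ; denom = K.1# ∷ [] ; denom#0 = K.1#0
    ; numer≈ = K.sym (K.*-identityʳ _)
    ; represents = trans (*-congˡ (trans (+-cong ι-1 (zeroʳ X)) (+-identityʳ 1#))) (*-identityʳ _) }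

  value-ι : ∀ a → Value (ι a) a
  value-ι a = value-cong (trans (+-congˡ (zeroʳ X)) (+-identityʳ _)) K.refl (value-eval (a ∷ []))

  value-0 : Value 0# K.0#
  value-0 = value-cong ι-0 K.refl (value-ι K.0#)

  value-1 : Value 1# K.1#
  value-1 = value-cong ι-1 K.refl (value-ι K.1#)

  value-X : Value X K.0#
  value-X = value-cong (begin
      ι K.0# + X * (ι K.1# + X * 0#)   ≈⟨ +-cong ι-0 (*-congˡ (+-congʳ ι-1)) ⟩
      0# + X * (1# + X * 0#)           ≈⟨ solve 1 (λ x → :0 :+ x :* (:1 :+ x :* :0) := x) refl X ⟩
      X                                ∎) K.refl (value-eval (K.0# ∷ K.1# ∷ []))

  value-scale : ∀ {x a} b → Value x a → Value (ι b * x) (b K.* a)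
  value-scale b v = value-* (value-ι b) v

  value-neg : ∀ {x a} → Value x a → Value (- x) (K.- a)
  value-neg {x} {a} v = value-cong
    (trans (*-congʳ (trans (ι-neg K.1#) (-‿cong ι-1))) (-1*x≈-x x))
    (K.solve 1 (λ a → (K.:- K.:1) K.:* a K.:= K.:- a) K.refl a)
    (value-scale (K.- K.1#) v)

  value-- : ∀ {x y a b} → Value x a → Value y b → Value (x - y) (a K.- b)
  value-- v w = value-+ v (value-neg w)

  value-^ : ∀ {x a} n → Value x a → Value (x ^ n) (a K^.^ n)
  value-^ ℕ.zero    v = value-1
  value-^ (ℕ.suc n) v = value-* v (value-^ n v)

  -- The two fractions of x are proportional as polynomials; comparing constant coefficients and
  -- cancelling the nonzero ones of the denominators leaves a = b.
  value-unique : ∀ {x a b} → Value x a → Value x b → a K.≈ b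
  value-unique {x} {a} {b} v w = K.-≈0⇒≈ (K.xy≈0⇒x≈0 (K.x#0y#0→xy#0 (denom#0 v) (denom#0 w))
    (K.trans (K.solve 4 (λ a b d e → (a K.:- b) K.:* (d K.:* e) K.:= a K.:* d K.:* e K.:- b K.:* e K.:* d) K.refl
               a b (coeff (denom v) 0) (coeff (denom w) 0))
    (K.trans (K.+-cong (K.trans (K.*-congʳ (K.sym (numer≈ v))) (K.sym (coeff-*-0 (numer v) (denom w))))
                       (K.-‿cong (K.trans (K.*-congʳ (K.sym (numer≈ w))) (K.sym (coeff-*-0 (numer w) (denom v))))))
    (K.trans (K.+-congʳ (at (proportional⇒≋ (numer v) (denom v) (numer w) (denom w) (represents v) (represents w)) 0))
             (K.-‿inverseʳ _)))))

  value-#0⇒≉0 : ∀ {x a} → Value x a → a K.# K.0# → ¬ x ≈ 0#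
  value-#0⇒≉0 v a#0 x≈0 = K.#⇒≉ a#0 (value-unique (value-cong x≈0 K.refl v) value-0)

  value-⁻¹ : ∀ {x a} → Value x a → a K.# K.0# → ∃ λ b → b K.# K.0# × Value (x ⁻¹) b
  value-⁻¹ {x} {a} v a#0 with b , ab≈1 , b#0 ← K.inverse a#0 = b , b#0 , record
    { numer = denom v ; denom = numer v
    ; denom#0 = K.#-congʳ (K.sym (numer≈ v)) (K.x#0y#0→xy#0 a#0 (denom#0 v))
    ; numer≈ = K.sym (K.trans (K.*-congˡ (numer≈ v))
        (K.trans (K.solve 3 (λ a b d → b K.:* (a K.:* d) K.:= a K.:* b K.:* d) K.refl a b (coeff (denom v) 0))
        (K.trans (K.*-congʳ ab≈1) (K.*-identityˡ _))))
    ; represents = begin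
        x ⁻¹ * evalAt (numer v) X            ≈⟨ *-congˡ (represents v) ⟨
        x ⁻¹ * (x * evalAt (denom v) X)      ≈⟨ solve 3 (λ i x d → i :* (x :* d) := x :* i :* d) refl (x ⁻¹) x _ ⟩
        x * x ⁻¹ * evalAt (denom v) X        ≈⟨ *-congʳ (⁻¹-inverse (value-#0⇒≉0 v a#0)) ⟩
        1# * evalAt (denom v) X              ≈⟨ *-identityˡ _ ⟩
        evalAt (denom v) X                   ∎ }

  X≉0 : ¬ X ≈ 0#
  X≉0 X≈0 = K.#⇒≉ K.1#0 (transcendental (K.0# ∷ K.1# ∷ []) (begin
      ι K.0# + X * (ι K.1# + X * 0#)   ≈⟨ +-cong ι-0 (*-congʳ X≈0) ⟩
      0# + 0# * (ι K.1# + X * 0#)      ≈⟨ solve 1 (λ x → :0 :+ :0 :* x := :0) refl _ ⟩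
      0#                               ∎) 1)

  -- x has a pole of order at most n at the point 0, and a is the coefficient of X⁻ⁿ in its expansion.
  record Pole (x : Carrier) (n : ℕ) (a : K.Carrier) : Set (c ⊔ ℓ₁ ⊔ ℓ₂ ⊔ ℓ′) where
    constructor pole
    field shifted : Value (x * X ^ n) a
  open Pole

  pole-cong : ∀ {x y n a b} → x ≈ y → a K.≈ b → Pole x n a → Pole y n b
  pole-cong x≈y a≈b v = pole (value-cong (*-congʳ x≈y) a≈b (shifted v))

  value⇒pole : ∀ {x a} → Value x a → Pole x 0 a
  value⇒pole v = pole (value-cong (sym (*-identityʳ _)) K.refl v)

  pole⇒value : ∀ {x a} → Pole x 0 a → Value x a
  pole⇒value v = value-cong (*-identityʳ _) K.refl (shifted v)

  pole-+ : ∀ {x y n a b} → Pole x n a → Pole y n b → Pole (x + y) n (a K.+ b)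
  pole-+ v w = pole (value-cong (sym (distribʳ _ _ _)) K.refl (value-+ (shifted v) (shifted w)))

  pole-* : ∀ {x y m n a b} → Pole x m a → Pole y n b → Pole (x * y) (m ℕ.+ n) (a K.* b)
  pole-* {x} {y} {m} {n} v w = pole (value-cong
    (trans (solve 4 (λ x y s t → (x :* s) :* (y :* t) := (x :* y) :* (s :* t)) refl x y (X ^ m) (X ^ n))
           (*-congˡ (sym (^-homo-* X m n)))) K.refl (value-* (shifted v) (shifted w)))

  pole-scale : ∀ {x n a} b → Pole x n a → Pole (ι b * x) n (b K.* a)
  pole-scale b v = pole (value-cong (sym (*-assoc _ _ _)) K.refl (value-scale b (shifted v)))

  pole-^ : ∀ {x n a} k → Pole x n a → Pole (x ^ k) (k ℕ.* n) (a K^.^ k)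
  pole-^ ℕ.zero    v = value⇒pole value-1
  pole-^ (ℕ.suc k) v = pole-* v (pole-^ k v)

  -- The surplus factor X^(n - m) has a positive exponent and so vanishes at 0. Uniqueness of orders
  -- and the dominance of the larger order in a sum rest on this.
  pole-< : ∀ {x m n a} → m ℕ.< n → Pole x m a → Pole x n K.0#
  pole-< {x} {m} {a = a} m<n v with k , ≡.refl ← ℕ.m≤n⇒∃[o]m+o≡n m<n = pole (value-cong
    (trans (solve 4 (λ x t s r → (x :* s) :* (t :* r) := x :* (t :* s :* r)) refl x X (X ^ m) (X ^ k))
           (*-congˡ (sym (^-homo-* X (ℕ.suc m) k))))
    (K.solve 2 (λ a b → a K.:* (K.:0 K.:* b) K.:= K.:0) K.refl a (K.0# K^.^ k))
    (value-* (shifted v) (value-* value-X (value-^ k value-X))))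

  pole-coefficient-unique : ∀ {x n a b} → Pole x n a → Pole x n b → a K.≈ b
  pole-coefficient-unique v w = value-unique (shifted v) (shifted w)

  pole-unique : ∀ {x m n a b} → Pole x m a → a K.# K.0# → Pole x n b → b K.# K.0# → m ≡ n
  pole-unique {m = m} {n} v a#0 w b#0 with ℕ.<-cmp m n
  ... | tri< m<n _ _ = ⊥-elim (K.#⇒≉ b#0 (pole-coefficient-unique w (pole-< m<n v)))
  ... | tri≈ _ m≡n _ = m≡n
  ... | tri> _ _ n<m = ⊥-elim (K.#⇒≉ a#0 (pole-coefficient-unique v (pole-< n<m w)))

  pole-0# : ∀ {n} → Pole 0# n K.0#
  pole-0# = pole (value-cong (sym (zeroˡ _)) K.refl value-0)

  pole-sum : ∀ {d n} (f : Fin d → Carrier) → (∀ i → Pole (f i) n K.0#) → Pole (sum f) n K.0#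
  pole-sum {ℕ.zero}  f v = pole-0#
  pole-sum {ℕ.suc d} f v = pole-cong refl (K.+-identityʳ K.0#) (pole-+ (v zero) (pole-sum (λ i → f (suc i)) (λ i → v (suc i))))

  -- Write the inverse as X (x X)⁻¹: the product x X has the nonzero value a, so the second factor
  -- is regular while the first vanishes.
  simple-pole⁻¹ : ∀ {x a} → Pole x 1 a → a K.# K.0# → Value (x ⁻¹) K.0#
  simple-pole⁻¹ {x} {a} (pole v) a#0 = let b , _ , w = value-⁻¹ v a#0 in value-cong
    (sym (⁻¹-unique (trans (sym (*-assoc x X y)) (trans (*-congʳ (*-congˡ (sym (*-identityʳ X))))
      (⁻¹-inverse (value-#0⇒≉0 v a#0))))))
    (K.zeroˡ b) (value-* value-X w)
    where
    y : Carrier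
    y = (x * X ^ 1) ⁻¹

  -- The exact pole order, with zeros ignored: at order 0 the coefficient may vanish, so that every
  -- regular function, including 0, has order 0.
  Order : Carrier → ℕ → Set _
  Order x n = ∃ λ a → Pole x n a × (n ≡ 0 ⊎ a K.# K.0#)

  order-cong : ∀ {x y n} → x ≈ y → Order x n → Order y n
  order-cong x≈y (a , v , z) = a , pole-cong x≈y K.refl v , z

  regular⇒order : ∀ {x a} → Value x a → Order x 0
  regular⇒order v = _ , value⇒pole v , inj₁ ≡.refl

  order-unique : ∀ {x m n} → Order x m → Order x n → m ≡ n
  order-unique (a , v , inj₁ ≡.refl) (b , w , inj₁ ≡.refl) = ≡.refl
  order-unique (a , v , inj₂ a#0)    (b , w , inj₂ b#0)    = pole-unique v a#0 w b#0
  order-unique {n = ℕ.zero}  (a , v , inj₁ ≡.refl) (b , w , inj₂ b#0) = ≡.refl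
  order-unique {n = ℕ.suc n} (a , v , inj₁ ≡.refl) (b , w , inj₂ b#0) =
    ⊥-elim (K.#⇒≉ b#0 (pole-coefficient-unique w (pole-< ℕ.z<s v)))
  order-unique {m = ℕ.zero}  (a , v , inj₂ a#0) (b , w , inj₁ ≡.refl) = ≡.refl
  order-unique {m = ℕ.suc m} (a , v , inj₂ a#0) (b , w , inj₁ ≡.refl) =
    ⊥-elim (K.#⇒≉ a#0 (pole-coefficient-unique v (pole-< ℕ.z<s w)))

  order-+-< : ∀ {x y m n} → m ℕ.< n → Order x m → Order y n → Order (x + y) n
  order-+-< {n = ℕ.suc n} m<n (a , v , _) (b , w , inj₂ b#0) =
    _ , pole-+ (pole-< m<n v) w , inj₂ (K.#-congʳ (K.sym (K.+-identityˡ b)) b#0)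

  order-+-> : ∀ {x y m n} → m ℕ.> n → Order x m → Order y n → Order (x + y) m
  order-+-> m>n v w = order-cong (+-comm _ _) (order-+-< m>n w v)

  order-+-0 : ∀ {x y} → Order x 0 → Order y 0 → Order (x + y) 0
  order-+-0 (a , v , _) (b , w , _) = _ , pole-+ v w , inj₁ ≡.refl

  order-scale : ∀ {x n a} → a K.# K.0# → Order x n → Order (ι a * x) n
  order-scale a#0 (b , v , inj₁ eq)  = _ , pole-scale _ v , inj₁ eq
  order-scale a#0 (b , v , inj₂ b#0) = _ , pole-scale _ v , inj₂ (K.x#0y#0→xy#0 a#0 b#0)

  private
    split-X : ∀ f → NonZeroᴾ f → ∃ λ k → ∃ λ g → coeff g 0 K.# K.0# × evalAt f X ≈ X ^ k * evalAt g X
    split-X (a ∷ f) nz with K.#-or-≈ a K.0# | nz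
    ... | inj₁ a#0 | _ = 0 , a ∷ f , a#0 , sym (*-identityˡ _)
    ... | inj₂ a≈0 | here a#0 = ⊥-elim (K.#⇒≉ a#0 a≈0)
    ... | inj₂ a≈0 | there f≠0 with k , g , g#0 , eq ← split-X f f≠0 =
      ℕ.suc k , g , g#0 , (begin
        ι a + X * evalAt f X                ≈⟨ +-cong (trans (ι-cong a≈0) ι-0) (*-congˡ eq) ⟩
        0# + X * (X ^ k * evalAt g X)       ≈⟨ solve 3 (λ t s g → :0 :+ t :* (s :* g) := t :* s :* g) refl X (X ^ k) (evalAt g X) ⟩
        X * X ^ k * evalAt g X              ∎)

  -- Here x = X^(j - i) N/D, where N/D has a nonzero value at 0. So x is regular if i ≤ j, and
  -- otherwise has a pole of order i - j, which is `ℕ.suc k` below.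
  order-of-quotient : ∀ {x} i j d n → coeff d 0 K.# K.0# → coeff n 0 K.# K.0# →
                      x * (X ^ i * evalAt d X) ≈ X ^ j * evalAt n X → ∃ λ k → Order x k
  order-of-quotient {x} i j d n d#0 n#0 xd≈n =
    helper (ℕ.≤-<-connex i j)
    where
    inverse = value-⁻¹ (value-eval d) d#0
    b#0 = proj₁ (proj₂ inverse)
    w = proj₂ (proj₂ inverse)
    D = evalAt d X
    N = evalAt n X

    eq : x * X ^ i ≈ X ^ j * (N * D ⁻¹)
    eq = begin
      x * X ^ i                      ≈⟨ *-identityʳ _ ⟨
      x * X ^ i * 1#                 ≈⟨ *-congˡ (⁻¹-inverse (value-#0⇒≉0 (value-eval d) d#0)) ⟨
      x * X ^ i * (D * D ⁻¹)         ≈⟨ solve 4 (λ x t d i → x :* t :* (d :* i) := x :* (t :* d) :* i) refl x (X ^ i) D (D ⁻¹) ⟩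
      x * (X ^ i * D) * D ⁻¹         ≈⟨ *-congʳ xd≈n ⟩
      X ^ j * N * D ⁻¹               ≈⟨ *-assoc _ _ _ ⟩
      X ^ j * (N * D ⁻¹)             ∎

    helper : i ℕ.≤ j ⊎ j ℕ.< i → ∃ λ k → Order x k
    helper (inj₁ i≤j) with k , ≡.refl ← ℕ.m≤n⇒∃[o]m+o≡n i≤j =
      0 , order-cong (sym (*-cancelˡ (^-≉0 i X≉0) (begin
        X ^ i * x                        ≈⟨ *-comm _ _ ⟩
        x * X ^ i                        ≈⟨ eq ⟩
        X ^ (i ℕ.+ k) * (N * D ⁻¹)       ≈⟨ *-congʳ (^-homo-* X i k) ⟩
        X ^ i * X ^ k * (N * D ⁻¹)       ≈⟨ *-assoc _ _ _ ⟩
        X ^ i * (X ^ k * (N * D ⁻¹))     ∎)))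
      (regular⇒order (value-* (value-^ k value-X) (value-* (value-eval n) w)))
    helper (inj₂ j<i) with k , ≡.refl ← ℕ.m≤n⇒∃[o]m+o≡n j<i =
      ℕ.suc k , _ , pole (value-cong (sym (*-cancelˡ (^-≉0 j X≉0) (begin
        X ^ j * (x * (X * X ^ k))        ≈⟨ solve 4 (λ s x t r → s :* (x :* (t :* r)) := x :* (t :* s :* r)) refl (X ^ j) x X (X ^ k) ⟩
        x * (X ^ (ℕ.suc j) * X ^ k)      ≈⟨ *-congˡ (^-homo-* X (ℕ.suc j) k) ⟨
        x * X ^ (ℕ.suc j ℕ.+ k)          ≈⟨ eq ⟩
        X ^ j * (N * D ⁻¹)               ∎)))
        K.refl (value-* (value-eval n) w)) , inj₂ (K.x#0y#0→xy#0 n#0 b#0)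

  -- Nothing is assumed about h, so an order must be produced for an arbitrary function: powers of X
  -- are split off from its numerator and denominator, and a zero numerator is treated apart.
  order : ∀ x → ∃ λ n → Order x n
  order x with nonZero? (num x)
  ... | yes n≠0 with i , d , d#0 , den≈ ← split-X (den x) (den≠0 x)
                   | j , n , n#0 , num≈ ← split-X (num x) n≠0 =
    order-of-quotient i j d n d#0 n#0 (trans (*-congˡ (sym den≈)) (trans (fraction x) num≈))
  order x | no ¬n≠0 = 0 , order-cong (sym x≈0) (regular⇒order value-0)
    where
    x≈0 : x ≈ 0#
    x≈0 with ≈0? x
    ... | yes x≈0 = x≈0
    ... | no  x≉0 = ⊥-elim (nonZero⇒≉[] (den≠0 x) (coefficientwise (transcendental (den x)
      (*-≉0ˡ x≉0 (trans (fraction x) (eval-zero (num x) X (¬nonZero⇒≋[] ¬n≠0)))))))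

  K^-#0 : ∀ {a} n → a K.# K.0# → a K^.^ n K.# K.0#
  K^-#0 ℕ.zero    a#0 = K.1#0
  K^-#0 (ℕ.suc n) a#0 = K.x#0y#0→xy#0 a#0 (K^-#0 n a#0)

  order-neg : ∀ {x n} → Order x n → Order (- x) n
  order-neg {x} v = order-cong (trans (*-congʳ (trans (ι-neg K.1#) (-‿cong ι-1))) (-1*x≈-x x))
    (order-scale (K.#-congʳ (K.+-identityˡ _) (K.-#0 (K.#-sym K.1#0))) v)

  -- For a pole of order k ≥ 1 the estimate k < 2 k ≤ p k lets the power dominate, so subtracting h
  -- cannot cancel its leading term. For k = 0 both terms are regular.
  order-^p-id : ∀ {h k} p → 2 ℕ.≤ p → Order h k → Order (h ^ p - h) (p ℕ.* k)
  order-^p-id {k = ℕ.zero} p 2≤p v@(a , w , _) =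
    ≡.subst (Order _) (≡.sym (ℕ.*-zeroʳ p))
      (order-+-0 (regular⇒order (value-^ p (pole⇒value w))) (order-neg v))
  order-^p-id {k = ℕ.suc k} p 2≤p v@(a , w , inj₂ a#0) = order-+->
    (ℕ.<-≤-trans (ℕ.m<m+n (ℕ.suc k) ℕ.z<s)
      (ℕ.≤-trans (ℕ.≤-reflexive (≡.cong (ℕ.suc k ℕ.+_) (≡.sym (ℕ.+-identityʳ (ℕ.suc k)))))
                 (ℕ.*-monoˡ-≤ (ℕ.suc k) 2≤p)))
    (_ , pole-^ p w , inj₂ (K^-#0 p a#0)) (order-neg v)

  PrimeTo : ℕ → ℕ → Set
  PrimeTo p n = n ≡ 0 ⊎ p ∤ n

  primeTo-multiple : ∀ {p n} → PrimeTo p n → p ∣ n → n ≡ 0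
  primeTo-multiple (inj₁ n≡0) p∣n = n≡0
  primeTo-multiple (inj₂ p∤n) p∣n = ⊥-elim (p∤n p∣n)

  -- Compare m with the order p k of h^p - h. If m < p k, then n = p k, so p divides n and n = 0,
  -- contradicting m < n. If m = p k, then m = 0, everything is regular and n = 0. If m > p k, the
  -- term in f′ dominates.
  order-invariant : ∀ {p f f′ h a m n} → 2 ℕ.≤ p → a K.# K.0# → f ≈ ι a * f′ + (h ^ p - h) →
                    Order f n → Order f′ m → PrimeTo p n → PrimeTo p m → n ≡ m
  order-invariant {p} {f} {f′} {h} {a} {m} {n} 2≤p a#0 eq v w n-prime m-prime with k , u ← order h
    with ℕ.<-cmp m (p ℕ.* k)
  ... | tri< m<q _ _ = ⊥-elim (ℕ.n≮0 (≡.subst (m ℕ.<_) (≡.trans (≡.sym n≡q) n≡0) m<q))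
    where
    n≡q = order-unique v (order-cong (sym eq) (order-+-< m<q (order-scale a#0 w) (order-^p-id p 2≤p u)))
    n≡0 = primeTo-multiple n-prime (≡.subst (p ∣_) (≡.sym n≡q) (m∣m*n k))
  ... | tri≈ _ m≡q _ = ≡.trans (order-unique v (order-cong (sym eq) (order-+-0
      (order-scale a#0 (≡.subst (Order f′) m≡0 w))
      (≡.subst (Order _) (≡.trans (≡.sym m≡q) m≡0) (order-^p-id p 2≤p u))))) (≡.sym m≡0)
    where
    m≡0 = primeTo-multiple m-prime (≡.subst (p ∣_) (≡.sym m≡q) (m∣m*n k))
  ... | tri> _ _ q<m = order-unique v
    (order-cong (sym eq) (order-+-> q<m (order-scale a#0 w) (order-^p-id p 2≤p u)))

-- Polar parts and the local shape of the standard form.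

module LocalParts {c ℓ₁ ℓ₂ c′ ℓ′} (p : ℕ) (K : HeytingField c ℓ₁ ℓ₂) (isClosure : IsAlgebraicClosureOf𝔽 p K)
                  (L : RationalFunctionField K c′ ℓ′) where

  open IsAlgebraicClosureOf𝔽 isClosure using (_#?_)
  private module K = DiscreteField K _#?_
  open PoleOrder K _#?_ L public
  open ArtinSchreierCurves p K isClosure public using (PolarPart; PoleOrders; StandardForm)
  open PolarPart renaming (coeff to coefficient)
  open PoleOrders
  open StandardForm
  open CommutativeMonoidSum +-commutativeMonoid using (sum-init-last; ∑-distrib-+; sum-replicate-zero)
  open SemiringSum semiring using (*-distribˡ-sum)
  open SetoidReasoning setoid

  sum-cong : ∀ {n} (f g : Fin n → Carrier) → (∀ i → f i ≈ g i) → sum f ≈ sum g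
  sum-cong {ℕ.zero}  f g f≈g = refl
  sum-cong {ℕ.suc n} f g f≈g = +-cong (f≈g zero) (sum-cong (λ i → f (suc i)) (λ i → g (suc i)) (λ i → f≈g (suc i)))

  monomial : ∀ {d} → (Fin d → K.Carrier) → Carrier → Fin d → Carrier
  monomial a t i = ι (a i) * t ^ ℕ.suc (toℕ i)

  opaque
    -- Takes bare coefficients and not a `PolarPart`, since the difference of two polar parts may
    -- lose its leading term.
    polar : ∀ {d} → (Fin d → K.Carrier) → Carrier → Carrier
    polar a t = sum (λ i → ι (a i) * t ^ ℕ.suc (toℕ i))

    polar-cong : ∀ {d s t} (a : Fin d → K.Carrier) → s ≈ t → polar a s ≈ polar a t
    polar-cong {s = s} {t} a s≈t =
      sum-cong (monomial a s) (monomial a t) (λ i → *-congˡ (^-congˡ (ℕ.suc (toℕ i)) s≈t))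

    polar-≈0 : ∀ {d} (a : Fin d → K.Carrier) t → (∀ i → a i K.≈ K.0#) → polar a t ≈ 0#
    polar-≈0 {d} a t a≈0 = trans
      (sum-cong (monomial a t) (λ _ → 0#) (λ i → trans (*-congʳ (trans (ι-cong (a≈0 i)) ι-0)) (zeroˡ (t ^ ℕ.suc (toℕ i)))))
      (sum-replicate-zero d)

    polar-- : ∀ {d} (a b : Fin d → K.Carrier) l t →
              polar a t - ι l * polar b t ≈ polar (λ i → a i K.- l K.* b i) t
    polar-- a b l t = begin
      polar a t - ι l * polar b t
        ≈⟨ +-congˡ (trans (solve 2 (λ l x → :- (l :* x) := (:- l) :* x) refl (ι l) (polar b t))
             (trans (*-congʳ (sym (ι-neg l))) (*-distribˡ-sum (ι (K.- l)) (monomial b t)))) ⟩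
      polar a t + sum (λ i → ι (K.- l) * monomial b t i)
        ≈⟨ ∑-distrib-+ (monomial a t) (λ i → ι (K.- l) * monomial b t i) ⟨
      sum (λ i → monomial a t i + ι (K.- l) * monomial b t i)
        ≈⟨ sum-cong (λ i → monomial a t i + ι (K.- l) * monomial b t i) (monomial (λ i → a i K.- l K.* b i) t)
             (λ i → term (a i) (b i) (t ^ ℕ.suc (toℕ i))) ⟩
      polar (λ i → a i K.- l K.* b i) t ∎
      where
      term : ∀ x y s → ι x * s + ι (K.- l) * (ι y * s) ≈ ι (x K.- l K.* y) * s
      term x y s = begin
        ι x * s + ι (K.- l) * (ι y * s)   ≈⟨ +-congˡ (*-congʳ (ι-neg l)) ⟩
        ι x * s + - ι l * (ι y * s)       ≈⟨ solve 4 (λ x l y s → x :* s :+ (:- l) :* (y :* s) := (x :- l :* y) :* s) refl (ι x) (ι l) (ι y) s ⟩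
        (ι x - ι l * ι y) * s             ≈⟨ *-congʳ (trans (ι-- x (l K.* y)) (+-congˡ (-‿cong (ι-* l y)))) ⟨
        ι (x K.- l K.* y) * s             ∎

  Regular : Carrier → Set _
  Regular x = ∃ λ a → Value x a

  regular-+ : ∀ {x y} → Regular x → Regular y → Regular (x + y)
  regular-+ (_ , v) (_ , w) = _ , value-+ v w

  regular-sum : ∀ {n} (f : Fin n → Carrier) → (∀ i → Regular (f i)) → Regular (sum f)
  regular-sum {ℕ.zero}  f v = _ , value-0
  regular-sum {ℕ.suc n} f v = regular-+ (v zero) (regular-sum (λ i → f (suc i)) (λ i → v (suc i)))

  vanish-sum : ∀ {n} (f : Fin n → Carrier) → (∀ i → Value (f i) K.0#) → Value (sum f) K.0#
  vanish-sum {ℕ.zero}  f v = value-0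
  vanish-sum {ℕ.suc n} f v =
    value-cong refl (K.+-identityʳ K.0#) (value-+ (v zero) (vanish-sum (λ i → f (suc i)) (λ i → v (suc i))))

  opaque
    unfolding polar

    polar-regular : ∀ {d t} (a : Fin d → K.Carrier) → Regular t → Regular (polar a t)
    polar-regular {t = t} a (_ , v) = regular-sum (monomial a t) (λ i → _ , value-scale (a i) (value-^ (ℕ.suc (toℕ i)) v))

    polar-vanish : ∀ {d t} (a : Fin d → K.Carrier) → Value t K.0# → Value (polar a t) K.0#
    polar-vanish {t = t} a v = vanish-sum (monomial a t) (λ i → value-cong refl
      (K.solve 2 (λ a b → a K.:* (K.:0 K.:* b) K.:= K.:0) K.refl (a i) (K.0# K^.^ toℕ i))
      (value-scale (a i) (value-^ (ℕ.suc (toℕ i)) v)))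

  -- Isolates the one summand among the J that may have a pole at the point considered.
  sum-extract : ∀ {n} (j : Fin n) (f : Fin n → Carrier) → (∀ k → k ≢ j → Regular (f k)) →
                ∃ λ r → Regular r × sum f ≈ f j + r
  sum-extract zero    f v = _ , regular-sum (λ i → f (suc i)) (λ i → v (suc i) λ ()) , refl
  sum-extract (suc j) f v =
    let r , reg , eq = sum-extract j (λ i → f (suc i)) (λ k k≢j → v (suc k) λ { ≡.refl → k≢j ≡.refl })
    in f zero + r , regular-+ (v zero λ ()) reg ,
       trans (+-congˡ eq) (solve 3 (λ x y z → x :+ (y :+ z) := y :+ (x :+ z)) refl (f zero) (f (suc j)) r)

  module _ {t e} (t-pole : Pole t 1 e) (e#0 : e K.# K.0#) where

    private
      term-pole : ∀ a i → Pole (ι a * t ^ ℕ.suc i) (ℕ.suc i) (a K.* e K^.^ ℕ.suc i)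
      term-pole a i = ≡.subst (λ n → Pole (ι a * t ^ ℕ.suc i) n (a K.* e K^.^ ℕ.suc i))
        (ℕ.*-identityʳ (ℕ.suc i)) (pole-scale a (pole-^ (ℕ.suc i) t-pole))

    opaque
      unfolding polar

      -- The power t^i has order i, so the lower terms contribute 0 at the top order and only the
      -- last term counts.
      polar-pole : ∀ {d} (a : Fin (ℕ.suc d) → K.Carrier) →
                   Pole (polar a t) (ℕ.suc d) (a (fromℕ d) K.* e K^.^ ℕ.suc d)
      polar-pole {d} a = pole-cong (sym (sum-init-last (monomial a t))) (K.+-identityˡ _)
        (pole-+ (pole-sum (λ i → monomial a t (inject₁ i))
                  (λ i → pole-< (ℕ.s<s (≡.subst (ℕ._< d) (≡.sym (toℕ-inject₁ i)) (toℕ<n i)))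
                                (term-pole (a (inject₁ i)) (toℕ (inject₁ i)))))
                (≡.subst (λ k → Pole (monomial a t (fromℕ d)) (ℕ.suc k) (a (fromℕ d) K.* e K^.^ ℕ.suc k))
                         (toℕ-fromℕ d) (term-pole (a (fromℕ d)) (toℕ (fromℕ d)))))

      polar-init : ∀ {d} (a : Fin (ℕ.suc d) → K.Carrier) → a (fromℕ d) K.≈ K.0# →
                   polar a t ≈ polar (λ i → a (inject₁ i)) t
      polar-init {d} a a≈0 = begin
        polar a t
          ≈⟨ sum-init-last (monomial a t) ⟩
        sum (λ i → monomial a t (inject₁ i)) + monomial a t (fromℕ d)
          ≈⟨ +-cong (sum-cong (λ i → monomial a t (inject₁ i)) (monomial (λ i → a (inject₁ i)) t)
                       (λ i → *-congˡ (reflexive (≡.cong (λ k → t ^ ℕ.suc k) (toℕ-inject₁ i)))))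
                    (*-congʳ (trans (ι-cong a≈0) ι-0)) ⟩
        polar (λ i → a (inject₁ i)) t + 0# * t ^ ℕ.suc (toℕ (fromℕ d))
          ≈⟨ solve 2 (λ x y → x :+ :0 :* y := x) refl (polar (λ i → a (inject₁ i)) t) (t ^ ℕ.suc (toℕ (fromℕ d))) ⟩
        polar (λ i → a (inject₁ i)) t ∎

    -- Degree 0 gives the empty sum, of order 0; this is how points without a pole fit in. In
    -- positive degree the leading coefficient and the residue are nonzero.
    polar-order : ∀ {d} (a : Fin d → K.Carrier) → (∀ i → ℕ.suc (toℕ i) ≡ d → a i K.# K.0#) → Order (polar a t) d
    polar-order {ℕ.zero}  a leading = order-cong (sym (polar-≈0 a t λ ())) (regular⇒order value-0)
    polar-order {ℕ.suc d} a leading = _ , polar-pole a ,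
      inj₂ (K.x#0y#0→xy#0 (leading (fromℕ d) (≡.cong ℕ.suc (toℕ-fromℕ d))) (K^-#0 (ℕ.suc d) e#0))

    -- Strip vanishing coefficients from the top. If one survives, its index is the order, and p
    -- does not divide that index because the coefficients at multiples of p are zero.
    polar-reduced : ∀ {d} (a : Fin d → K.Carrier) → (∀ i → p ∣ ℕ.suc (toℕ i) → a i K.≈ K.0#) →
                    (∃ λ n → Order (polar a t) n × p ∤ n) ⊎ (∀ i → a i K.≈ K.0#)
    polar-reduced {ℕ.zero}  a reduced = inj₂ λ ()
    polar-reduced {ℕ.suc d} a reduced with K.#-or-≈ (a (fromℕ d)) K.0#
    ... | inj₁ a#0 = inj₁ (ℕ.suc d , (_ , polar-pole a , inj₂ (K.x#0y#0→xy#0 a#0 (K^-#0 (ℕ.suc d) e#0))) ,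
      λ p∣d → K.#⇒≉ a#0 (reduced (fromℕ d) (≡.subst (λ k → p ∣ ℕ.suc k) (≡.sym (toℕ-fromℕ d)) p∣d)))
    ... | inj₂ a≈0 with polar-reduced (λ i → a (inject₁ i))
                          (λ i p∣i → reduced (inject₁ i) (≡.subst (λ k → p ∣ ℕ.suc k) (≡.sym (toℕ-inject₁ i)) p∣i))
    ...   | inj₁ (n , v , p∤n) = inj₁ (n , order-cong (sym (polar-init a a≈0)) v , p∤n)
    ...   | inj₂ init≈0 = inj₂ all≈0
      where
      all≈0 : ∀ i → a i K.≈ K.0#
      all≈0 i with view i
      ... | ‵fromℕ     = a≈0
      ... | ‵inject₁ j = init≈0 j

  -- Written in an arbitrary coordinate u, so that a substitution merely replaces u (`φ-form`).
  form : ∀ {D} → StandardForm D → Carrier → Carrier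
  form S u = polar (coefficient (F S)) u + polar (coefficient (G S)) (u ⁻¹) + polar (coefficient (H S)) ((u - ι K.1#) ⁻¹)
           + sum (λ j → polar (coefficient (J S j)) ((u - ι (θ S j)) ⁻¹))

  module _ (φ : Endomorphism) where
    open Endomorphism φ renaming (φ to f)

    opaque
      unfolding polar

      φ-polar : ∀ {d} (a : Fin d → K.Carrier) t → f (polar a t) ≈ polar a (f t)
      φ-polar a t = trans (φ-sum (monomial a t)) (sum-cong (λ i → f (monomial a t i)) (monomial a (f t))
        (λ i → trans (φ-* _ _) (*-cong (φ-ι (a i)) (φ-^ t (ℕ.suc (toℕ i))))))

    φ-shift : ∀ a u → f ((u - ι a) ⁻¹) ≈ (f u - ι a) ⁻¹
    φ-shift a u = trans (φ-⁻¹ _) (⁻¹-cong (trans (φ-+ u (- ι a)) (+-congˡ (trans (φ-neg (ι a)) (-‿cong (φ-ι a))))))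

    φ-form : ∀ {D} (S : StandardForm D) u → f (form S u) ≈ form S (f u)
    φ-form S u = trans (φ-+ _ _) (+-cong (trans (φ-+ _ _) (+-cong (trans (φ-+ _ _) (+-cong
      (φ-polar (coefficient (F S)) u)
      (trans (φ-polar (coefficient (G S)) (u ⁻¹)) (polar-cong (coefficient (G S)) (φ-⁻¹ u)))))
      (trans (φ-polar (coefficient (H S)) ((u - ι K.1#) ⁻¹)) (polar-cong (coefficient (H S)) (φ-shift K.1# u)))))
      (trans (φ-sum (λ j → polar (coefficient (J S j)) ((u - ι (θ S j)) ⁻¹)))
        (sum-cong (λ j → f (polar (coefficient (J S j)) ((u - ι (θ S j)) ⁻¹))) (λ j → polar (coefficient (J S j)) ((f u - ι (θ S j)) ⁻¹))
          (λ j → trans (φ-polar (coefficient (J S j)) ((u - ι (θ S j)) ⁻¹)) (polar-cong (coefficient (J S j)) (φ-shift (θ S j) u))))))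

  form-cong : ∀ {D} (S : StandardForm D) {u v} → u ≈ v → form S u ≈ form S v
  form-cong S {u} {v} u≈v = +-cong (+-cong (+-cong (polar-cong (coefficient (F S)) u≈v) (polar-cong (coefficient (G S)) (⁻¹-cong u≈v)))
    (polar-cong (coefficient (H S)) (⁻¹-cong (+-congʳ u≈v))))
    (sum-cong (λ j → polar (coefficient (J S j)) ((u - ι (θ S j)) ⁻¹)) (λ j → polar (coefficient (J S j)) ((v - ι (θ S j)) ⁻¹))
      (λ j → polar-cong (coefficient (J S j)) (⁻¹-cong (+-congʳ u≈v))))

  -- Points of the projective line; `nothing` is ∞.
  Point : Set c
  Point = Maybe K.Carrier

  -- The function whose powers make up the polar part at the given point.
  parameter : Point → Carrier → Carrier
  parameter nothing  u = u
  parameter (just a) u = (u - ι a) ⁻¹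

  -- u is a coordinate that takes the value P at the point 0, to first order.
  record Centred (P : Point) (u : Carrier) : Set (c ⊔ ℓ₁ ⊔ ℓ₂ ⊔ ℓ′) where
    constructor centred
    field
      {residue}   : K.Carrier
      simple-pole : Pole (parameter P u) 1 residue
      residue#0   : residue K.# K.0#
  open Centred

  ⁻¹-involutive : ∀ x → x ⁻¹ ⁻¹ ≈ x
  ⁻¹-involutive x with ≈0? x
  ... | yes x≈0 = trans (⁻¹-zero (⁻¹-zero x≈0)) (sym x≈0)
  ... | no  x≉0 = ⁻¹-unique (trans (*-comm _ _) (⁻¹-inverse x≉0))

  centred⇒value : ∀ {a u} → Centred (just a) u → Value u a
  centred⇒value {a} {u} (centred v e#0) = value-cong
    (trans (+-congʳ (⁻¹-involutive (u - ι a))) (solve 2 (λ u a → u :- a :+ a := u) refl u (ι a)))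
    (K.+-identityˡ a) (value-+ (simple-pole⁻¹ v e#0) (value-ι a))

  value⇒regular : ∀ {a b u} → Value u a → a K.# b → Regular ((u - ι b) ⁻¹)
  value⇒regular {b = b} v a#b = let _ , _ , w = value-⁻¹ (value-- v (value-ι b)) (K.-#0 a#b) in _ , w

  -- Subtracting a constant changes neither the simple pole of u nor its residue, and the inverse of
  -- a simple pole vanishes.
  centred∞⇒vanish : ∀ {u} a → Centred nothing u → Value ((u - ι a) ⁻¹) K.0#
  centred∞⇒vanish {u} a (centred v e#0) = simple-pole⁻¹
    (pole-cong refl (K.solve 1 (λ e → e K.:+ (K.:- K.:0) K.:= e) K.refl _)
      (pole-+ v (pole-cong (-1*x≈-x′ (ι a)) (K.solve 0 ((K.:- K.:1) K.:* K.:0 K.:= K.:- K.:0) K.refl)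
        (pole-scale (K.- K.1#) (pole-< ℕ.z<s (value⇒pole (value-ι a))))))) e#0
    where
    -1*x≈-x′ : ∀ x → ι (K.- K.1#) * x ≈ - x
    -1*x≈-x′ x = trans (*-congʳ (trans (ι-neg K.1#) (-‿cong ι-1))) (solve 1 (λ x → (:- :1) :* x := :- x) refl x)

  noPart : PolarPart 0
  noPart = record { coeff = λ () ; reduced = λ () ; leading = λ () }

  -- Gives every point of the line a polar part, empty of degree 0 away from the poles, so that
  -- poles and other points are compared by one argument. Special points are recognised up to
  -- equality in K.
  data PartAt {D} (S : StandardForm D) : Point → (d : ℕ) → PolarPart d → Set (c ⊔ ℓ₁ ⊔ ℓ₂) where
    at-∞      : PartAt S nothing (d₁ D) (F S)
    at-0      : ∀ {a} → a K.≈ K.0# → PartAt S (just a) (d₂ D) (G S)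
    at-1      : ∀ {a} → a K.≈ K.1# → PartAt S (just a) (d₃ D) (H S)
    at-θ      : ∀ {a} j → a K.≈ θ S j → PartAt S (just a) (d D j) (J S j)
    elsewhere : ∀ {a} → a K.# K.0# → a K.# K.1# → (∀ j → a K.# θ S j) → PartAt S (just a) 0 noPart

  partAt : ∀ {D} (S : StandardForm D) P → ∃ λ d → ∃ λ Q → PartAt S P d Q
  partAt S nothing  = _ , _ , at-∞
  partAt S (just a) with K.#-or-≈ a K.0# | K.#-or-≈ a K.1# | any? (λ j → ¬? (a #? θ S j))
  ... | inj₂ a≈0 | _        | _              = _ , _ , at-0 a≈0
  ... | inj₁ a#0 | inj₂ a≈1 | _              = _ , _ , at-1 a≈1
  ... | inj₁ a#0 | inj₁ a#1 | yes (j , ¬a#θ) = _ , _ , at-θ j (K.¬#⇒≈ ¬a#θ)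
  ... | inj₁ a#0 | inj₁ a#1 | no ¬∃          =
    _ , _ , elsewhere a#0 a#1 (λ j → decidable-stable (a #? θ S j) (λ ¬a#θ → ¬∃ (j , ¬a#θ)))

  -- G, H and the J have no constant term, so at ∞ they are not merely regular but zero. This extra
  -- precision is what later determines a^p - a.
  form-at-∞ : ∀ {D} (S : StandardForm D) {u} → Centred nothing u →
              ∃ λ r → Value r K.0# × form S u ≈ polar (coefficient (F S)) u + r
  form-at-∞ S {u} cu = _ , value-cong refl (K.solve 0 (K.:0 K.:+ K.:0 K.:+ K.:0 K.:= K.:0) K.refl)
      (value-+ (value-+ (polar-vanish (coefficient (G S)) (value-cong (⁻¹-cong u-0) K.refl (centred∞⇒vanish K.0# cu)))
                        (polar-vanish (coefficient (H S)) (centred∞⇒vanish K.1# cu)))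
               (vanish-sum (λ j → polar (coefficient (J S j)) ((u - ι (θ S j)) ⁻¹)) (λ j → polar-vanish (coefficient (J S j)) (centred∞⇒vanish (θ S j) cu)))) ,
    solve 4 (λ f g h j → f :+ g :+ h :+ j := f :+ (g :+ h :+ j)) refl _ _ _ _
    where
    u-0 : u - ι K.0# ≈ u
    u-0 = trans (+-congˡ (-‿cong ι-0)) (solve 1 (λ u → u :- :0 := u) refl u)

  -- Partial fractions: as 0, 1 and the θ are distinct, the parameters of all other points are
  -- regular at P, and so are the polynomials in them.
  form-local : ∀ {D} (S : StandardForm D) {P u d Q} → Centred P u → PartAt S P d Q →
               ∃ λ r → Regular r × form S u ≈ polar (coefficient Q) (parameter P u) + r
  form-local S cu at-∞ = let r , v , eq = form-at-∞ S cu in r , (_ , v) , eq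
  form-local S {just a} {u} cu (at-0 a≈0) = _ ,
    regular-+ (regular-+ (polar-regular (coefficient (F S)) (a , u-val))
                         (polar-regular (coefficient (H S)) (value⇒regular u-val (K.#-congʳ (K.sym a≈0) (K.#-sym K.1#0)))))
      (regular-sum (λ j → polar (coefficient (J S j)) ((u - ι (θ S j)) ⁻¹)) (λ j → polar-regular (coefficient (J S j)) (value⇒regular u-val (K.#-congʳ (K.sym a≈0) (K.#-sym (θ≠0 S j)))))) ,
    trans (solve 4 (λ f g h j → f :+ g :+ h :+ j := g :+ (f :+ h :+ j)) refl _ _ _ _)
          (+-congʳ (polar-cong (coefficient (G S)) (⁻¹-cong (trans (solve 1 (λ u → u := u :- :0) refl u)
            (+-congˡ (-‿cong (sym (trans (ι-cong a≈0) ι-0))))))))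
    where u-val = centred⇒value cu
  form-local S {just a} {u} cu (at-1 a≈1) = _ ,
    regular-+ (regular-+ (polar-regular (coefficient (F S)) (a , u-val))
                         (polar-regular (coefficient (G S)) u⁻¹-regular))
      (regular-sum (λ j → polar (coefficient (J S j)) ((u - ι (θ S j)) ⁻¹)) (λ j → polar-regular (coefficient (J S j)) (value⇒regular u-val (K.#-congʳ (K.sym a≈1) (K.#-sym (θ≠1 S j)))))) ,
    trans (solve 4 (λ f g h j → f :+ g :+ h :+ j := h :+ (f :+ g :+ j)) refl _ _ _ _)
          (+-congʳ (polar-cong (coefficient (H S)) (⁻¹-cong (+-congˡ (-‿cong (sym (ι-cong a≈1)))))))
    where
    u-val = centred⇒value cu
    u⁻¹-regular : Regular (u ⁻¹)
    u⁻¹-regular = let _ , _ , w = value-⁻¹ u-val (K.#-congʳ (K.sym a≈1) K.1#0) in _ , w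
  form-local S {just a} {u} cu (at-θ j a≈θ) =
    let r , reg , eq = sum-extract j (λ k → polar (coefficient (J S k)) ((u - ι (θ S k)) ⁻¹))
          (λ k k≢j → polar-regular (coefficient (J S k)) (value⇒regular u-val
            (K.#-congʳ (K.sym a≈θ) (θ-distinct S j k (λ j≡k → k≢j (≡.sym j≡k))))))
    in _ ,
    regular-+ (regular-+ (regular-+ (polar-regular (coefficient (F S)) (a , u-val))
                                    (polar-regular (coefficient (G S)) u⁻¹-regular))
                         (polar-regular (coefficient (H S)) (value⇒regular u-val (K.#-congʳ (K.sym a≈θ) (θ≠1 S j)))))
              reg ,
    trans (+-congˡ eq) (trans (solve 5 (λ f g h j r → f :+ g :+ h :+ (j :+ r) := j :+ (f :+ g :+ h :+ r)) refl _ _ _ _ _)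
      (+-congʳ (polar-cong (coefficient (J S j)) (⁻¹-cong (+-congˡ (-‿cong (sym (ι-cong a≈θ))))))))
    where
    u-val = centred⇒value cu
    u⁻¹-regular : Regular (u ⁻¹)
    u⁻¹-regular = let _ , _ , w = value-⁻¹ u-val (K.#-congʳ (K.sym a≈θ) (θ≠0 S j)) in _ , w
  form-local S {just a} {u} cu (elsewhere a#0 a#1 a#θ) = _ ,
    regular-+ (regular-+ (regular-+ (polar-regular (coefficient (F S)) (a , u-val))
                                    (polar-regular (coefficient (G S)) u⁻¹-regular))
                         (polar-regular (coefficient (H S)) (value⇒regular u-val a#1)))
              (regular-sum (λ j → polar (coefficient (J S j)) ((u - ι (θ S j)) ⁻¹)) (λ j → polar-regular (coefficient (J S j)) (value⇒regular u-val (a#θ j)))) ,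
    trans (sym (+-identityˡ _)) (+-congʳ (sym (polar-≈0 (coefficient noPart) ((u - ι a) ⁻¹) λ ())))
    where
    u-val = centred⇒value cu
    u⁻¹-regular : Regular (u ⁻¹)
    u⁻¹-regular = let _ , _ , w = value-⁻¹ u-val a#0 in _ , w

  order-+-regular : ∀ {x y n} → Order x n → Regular y → Order (x + y) n
  order-+-regular {n = ℕ.zero}  v (_ , w) = order-+-0 v (regular⇒order w)
  order-+-regular {n = ℕ.suc n} v (_ , w) = order-+-> ℕ.z<s v (regular⇒order w)

  form-order : ∀ {D} (S : StandardForm D) {P u d Q} → Centred P u → PartAt S P d Q → Order (form S u) d
  form-order S {Q = Q} cu part = let r , reg , eq = form-local S cu part in
    order-cong (sym eq) (order-+-regular
      (polar-order (simple-pole cu) (residue#0 cu) (coefficient Q) (leading Q)) reg)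

  part-primeTo : ∀ {D} (S : StandardForm D) {P d Q} → PartAt S P d Q → PrimeTo p d
  part-primeTo {D} S at-∞              = inj₂ (p∤d₁ D)
  part-primeTo {D} S (at-0 _)          = inj₂ (p∤d₂ D)
  part-primeTo {D} S (at-1 _)          = inj₂ (p∤d₃ D)
  part-primeTo {D} S (at-θ j _)        = inj₂ (p∤d D j)
  part-primeTo S     (elsewhere _ _ _) = inj₁ ≡.refl

  -- In the applications v is the chart at P′ and u is M read in that chart, so that P is the image
  -- of P′ under M.
  part-orders-agree : ∀ {D a u v h P P′ d d′ Q Q′} (S S′ : StandardForm D) → 2 ℕ.≤ p → a K.# K.0# →
                      form S u ≈ ι a * form S′ v + (h ^ p - h) → Centred P u → Centred P′ v →
                      PartAt S P d Q → PartAt S′ P′ d′ Q′ → d ≡ d′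
  part-orders-agree S S′ 2≤p a#0 eq cu cv part part′ = order-invariant 2≤p a#0 eq
    (form-order S cu part) (form-order S′ cv part′) (part-primeTo S part) (part-primeTo S′ part′)

  module _ {D : PoleOrders} (d₁>d₂ : d₁ D ℕ.> d₂ D) (d₂>d₃ : d₂ D ℕ.> d₃ D)
           (d≢ : ∀ j → d D j ≢ d₁ D × d D j ≢ d₂ D × d D j ≢ d₃ D) (S : StandardForm D) where

    d₁-only-at-∞ : ∀ {a e Q} → PartAt S (just a) e Q → e ≢ d₁ D
    d₁-only-at-∞ (at-0 _)          = ℕ.<⇒≢ d₁>d₂
    d₁-only-at-∞ (at-1 _)          = ℕ.<⇒≢ (ℕ.<-trans d₂>d₃ d₁>d₂)
    d₁-only-at-∞ (at-θ j _)        = proj₁ (d≢ j)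
    -- The order d₁ is positive because p divides 0 but not d₁.
    d₁-only-at-∞ (elsewhere _ _ _) = λ 0≡d → p∤d₁ D (≡.subst (p ∣_) 0≡d (p ∣0))

    d₂-only-at-0 : ∀ {a e Q} → PartAt S (just a) e Q → e ≡ d₂ D → a K.≈ K.0#
    d₂-only-at-0 (at-0 a≈0)        _   = a≈0
    d₂-only-at-0 (at-1 _)          e≡d = ⊥-elim (ℕ.<⇒≢ d₂>d₃ e≡d)
    d₂-only-at-0 (at-θ j _)        e≡d = ⊥-elim (proj₁ (proj₂ (d≢ j)) e≡d)
    d₂-only-at-0 (elsewhere _ _ _) e≡d = ⊥-elim (p∤d₂ D (≡.subst (p ∣_) e≡d (p ∣0)))

    d₃-only-at-1 : ∀ {a e Q} → PartAt S (just a) e Q → e ≡ d₃ D → a K.≈ K.1#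
    d₃-only-at-1 (at-0 _)          e≡d = ⊥-elim (ℕ.>⇒≢ d₂>d₃ e≡d)
    d₃-only-at-1 (at-1 a≈1)        _   = a≈1
    d₃-only-at-1 (at-θ j _)        e≡d = ⊥-elim (proj₂ (proj₂ (d≢ j)) e≡d)
    d₃-only-at-1 (elsewhere _ _ _) e≡d = ⊥-elim (p∤d₃ D (≡.subst (p ∣_) e≡d (p ∣0)))

    -- The index k may differ from j, since several θ can share one order.
    d-only-at-θ : ∀ {a e Q} j → PartAt S (just a) e Q → e ≡ d D j → ∃ λ k → d D k ≡ d D j × a K.≈ θ S k
    d-only-at-θ j (at-0 _)          e≡d = ⊥-elim (proj₁ (proj₂ (d≢ j)) (≡.sym e≡d))
    d-only-at-θ j (at-1 _)          e≡d = ⊥-elim (proj₂ (proj₂ (d≢ j)) (≡.sym e≡d))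
    d-only-at-θ j (at-θ k a≈θ)      e≡d = k , e≡d , a≈θ
    d-only-at-θ j (elsewhere _ _ _) e≡d = ⊥-elim (p∤d D j (≡.subst (p ∣_) e≡d (p ∣0)))

-- Functions without poles and the Artin-Schreier equation.

module Rigidity {c ℓ₁ ℓ₂ c′ ℓ′} (p : ℕ) (2≤p : 2 ℕ.≤ p) (K : HeytingField c ℓ₁ ℓ₂)
                (isClosure : IsAlgebraicClosureOf𝔽 p K) (L : RationalFunctionField K c′ ℓ′) where

  open IsAlgebraicClosureOf𝔽 isClosure using (_#?_; algebraicallyClosed)
  private module K = DiscreteField K _#?_
  open LocalParts p K isClosure L public
  open PolarPart renaming (coeff to coefficient)
  open PoleOrders
  open StandardForm
  open SetoidReasoning setoid

  value-evalAt : ∀ {u r} f → Value u r → Value (evalAt f u) (eval f r)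
  value-evalAt []      v = value-0
  value-evalAt (a ∷ f) v = value-+ (value-ι a) (value-* v (value-evalAt f v))

  pole-X⁻¹ : Pole (X ⁻¹) 1 K.1#
  pole-X⁻¹ = pole (value-cong (begin
    1#                  ≈⟨ ⁻¹-inverse X≉0 ⟨
    X * X ⁻¹            ≈⟨ solve 2 (λ x i → x :* i := i :* (x :* :1)) refl X (X ⁻¹) ⟩
    X ⁻¹ * (X * 1#)     ∎) K.refl value-1)

  centred-linear : ∀ {u k a} → k K.# K.0# → u - ι a ≈ ι k * X → Centred (just a) u
  centred-linear {u} {k} {a} k#0 eq = let l , kl≈1 , l#0 = K.inverse k#0 in centred
    (pole-cong (sym (⁻¹-unique (begin
        (u - ι a) * (ι l * X ⁻¹)       ≈⟨ *-congʳ eq ⟩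
        ι k * X * (ι l * X ⁻¹)         ≈⟨ solve 4 (λ k x l i → k :* x :* (l :* i) := k :* l :* (x :* i)) refl (ι k) X (ι l) (X ⁻¹) ⟩
        ι k * ι l * (X * X ⁻¹)         ≈⟨ *-cong (trans (sym (ι-* k l)) (trans (ι-cong kl≈1) ι-1)) (⁻¹-inverse X≉0) ⟩
        1# * 1#                        ≈⟨ *-identityʳ 1# ⟩
        1#                             ∎))) K.refl (pole-scale l pole-X⁻¹))
    (K.x#0y#0→xy#0 l#0 K.1#0)

  -- Substituting the chart of P moves the point P of the projective line to 0.
  chart : Point → Carrier
  chart nothing  = X ⁻¹
  chart (just b) = X + ι b

  chart-centred : ∀ P → Centred P (chart P)
  chart-centred nothing  = centred pole-X⁻¹ K.1#0
  chart-centred (just b) = centred-linear K.1#0 (begin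
    X + ι b - ι b     ≈⟨ solve 2 (λ x b → x :+ b :- b := :1 :* x) refl X (ι b) ⟩
    1# * X            ≈⟨ *-congʳ ι-1 ⟨
    ι K.1# * X        ∎)

  chart-nonConstant : ∀ P → NonConstant (chart P)
  chart-nonConstant nothing r X⁻¹≈r = K.#⇒≉ K.1#0 (value-unique value-1 (value-cong (begin
    ι r * X      ≈⟨ *-congʳ X⁻¹≈r ⟨
    X ⁻¹ * X     ≈⟨ *-comm _ _ ⟩
    X * X ⁻¹     ≈⟨ ⁻¹-inverse X≉0 ⟩
    1#           ∎) (K.zeroʳ r) (value-scale r value-X)))
  chart-nonConstant (just b) r X+b≈r = X≉0 (begin
    X                ≈⟨ solve 2 (λ x b → x := x :+ b :- b) refl X (ι b) ⟩
    X + ι b - ι b    ≈⟨ +-congʳ (trans X+b≈r (ι-cong r≈b)) ⟩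
    ι b - ι b        ≈⟨ -‿inverseʳ _ ⟩
    0#               ∎)
    where
    r≈b : r K.≈ b
    r≈b = K.trans (value-unique (value-ι r) (value-cong X+b≈r K.refl (value-+ value-X (value-ι b)))) (K.+-identityˡ b)

  localize : Point → Endomorphism
  localize P = substitution algebraicallyClosed (chart P) (chart-nonConstant P)

  at[_] : Point → Carrier → Carrier
  at[ P ] = compose (chart P)

  at-X : ∀ P → at[ P ] X ≈ chart P
  at-X P = compose-X algebraicallyClosed (chart P) (chart-nonConstant P)

  ^p-id-cong : ∀ {x y} → x ≈ y → x ^ p - x ≈ y ^ p - y
  ^p-id-cong x≈y = +-cong (^-congˡ p x≈y) (-‿cong x≈y)

  -- If h had a pole of order k, the left side would have a pole of order p k.
  artin-schreier-regular : ∀ {h t e d r b} → Pole t 1 e → e K.# K.0# → (a : Fin d → K.Carrier) →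
                           (∀ i → p ∣ ℕ.suc (toℕ i) → a i K.≈ K.0#) → Value r b →
                           h ^ p - h ≈ polar a t + r → Regular h × Value (h ^ p - h) b
  artin-schreier-regular {h} {t} {r = r} {b} t-pole e#0 a a-reduced r-val eq = helper (order h) (polar-reduced t-pole e#0 a a-reduced)
    where
    helper : (∃ λ k → Order h k) → (∃ λ n → Order (polar a t) n × p ∤ n) ⊎ (∀ i → a i K.≈ K.0#) →
             Regular h × Value (h ^ p - h) b
    helper (k , h-order) (inj₁ (n , v , p∤n)) = ⊥-elim (p∤n (≡.subst (p ∣_)
      (order-unique (order-^p-id p 2≤p h-order) (order-cong (sym eq) (order-+-regular v (b , r-val)))) (m∣m*n k)))
    helper (k , h-order) (inj₂ a≈0) = h-regular , W-val
      where
      W-val : Value (h ^ p - h) b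
      W-val = value-cong (sym (trans eq (trans (+-congʳ (polar-≈0 a t a≈0)) (+-identityˡ r)))) K.refl r-val
      -- With a zero polar part the equation reads h^p - h = r, which is regular, so p k = 0.
      k≡0 : k ≡ 0
      k≡0 = [ (λ p≡0 → ⊥-elim (ℕ.<⇒≢ (ℕ.<-≤-trans ℕ.z<s 2≤p) (≡.sym p≡0))) , (λ k≡0 → k≡0) ]′
        (ℕ.m*n≡0⇒m≡0∨n≡0 p (order-unique (order-^p-id p 2≤p h-order) (regular⇒order W-val)))
      h-regular : Regular h
      h-regular with a , v , _ ← ≡.subst (Order h) k≡0 h-order = a , pole⇒value v

  eval-pole : ∀ {t e} → Pole t 1 e → e K.# K.0# → ∀ f → NonZeroᴾ f →
              ∃ λ n → ∃ λ a → a K.# K.0# × Pole (evalAt f t) n a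

  -- Separated from `eval-pole` to record that the order is positive: a nonconstant polynomial has a
  -- genuine pole at ∞.
  eval-pole-suc : ∀ {t e} → Pole t 1 e → e K.# K.0# → ∀ b f → NonZeroᴾ f →
                  ∃ λ n → ∃ λ a → a K.# K.0# × Pole (evalAt (b ∷ f) t) (ℕ.suc n) a
  eval-pole-suc v e#0 b f f≠0 = let n , a , a#0 , w = eval-pole v e#0 f f≠0 in
    n , _ , K.x#0y#0→xy#0 e#0 a#0 ,
    pole-cong refl (K.+-identityˡ _) (pole-+ (pole-< ℕ.z<s (value⇒pole (value-ι b))) (pole-* v w))

  eval-pole v e#0 (b ∷ f) nz with nonZero? f | nz
  ... | yes f≠0 | _          = let n , rest = eval-pole-suc v e#0 b f f≠0 in ℕ.suc n , rest
  ... | no ¬f≠0 | there f≠0  = ⊥-elim (¬f≠0 f≠0)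
  ... | no ¬f≠0 | here b#0   = 0 , b , b#0 , value⇒pole (value-cong
    (sym (trans (+-congˡ (trans (*-congˡ (eval-zero f _ (¬nonZero⇒≋[] ¬f≠0))) (zeroʳ _))) (+-identityʳ _))) K.refl (value-ι b))

  -- A nonconstant denominator has a root r. Regularity of h at r makes the numerator vanish there
  -- too, so x - r cancels from both; repeating this shortens the denominator to a constant, which
  -- is then inverted.
  regular-on-line⇒polynomial : ∀ {h} → (∀ b → Regular (at[ just b ] h)) → ∃ λ f → h ≈ evalAt f X
  regular-on-line⇒polynomial {h} h-regular = go (length (den h)) (num h) (den h) ≡.refl (den≠0 h) (fraction h)
    where
    go : ∀ k n d → length d ≡ k → NonZeroᴾ d → h * evalAt d X ≈ evalAt n X → ∃ λ f → h ≈ evalAt f X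
    go k [] d eq d≠0 hd≈n = [] , *-≉0ˡ (λ d≈0 → nonZero⇒≉[] d≠0 (coefficientwise (transcendental d d≈0)))
      (trans (*-comm _ _) hd≈n)
    go (ℕ.suc k) (b ∷ n) (a ∷ d) eq nz hd≈n with nonZero? d | nz
    ... | no ¬d≠0 | there d≠0 = ⊥-elim (¬d≠0 d≠0)
    ... | no ¬d≠0 | here a#0  = let l , al≈1 , _ = K.inverse a#0 in map (l K.*_) (b ∷ n) , (begin
      h                              ≈⟨ *-identityʳ h ⟨
      h * 1#                         ≈⟨ *-congˡ (trans (sym ι-1) (trans (ι-cong (K.sym al≈1)) (ι-* a l))) ⟩
      h * (ι a * ι l)                ≈⟨ solve 4 (λ h a l x → h :* (a :* l) := l :* (h :* (a :+ x :* :0))) refl h (ι a) (ι l) X ⟩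
      ι l * (h * (ι a + X * 0#))     ≈⟨ *-congˡ (*-congˡ (+-congˡ (*-congˡ (eval-zero d X (¬nonZero⇒≋[] ¬d≠0))))) ⟨
      ι l * (h * evalAt (a ∷ d) X)   ≈⟨ *-congˡ hd≈n ⟩
      ι l * evalAt (b ∷ n) X         ≈⟨ eval-scale l (b ∷ n) X ⟨
      evalAt (map (l K.*_) (b ∷ n)) X ∎)
    ... | yes d≠0 | _ = cancel (algebraicallyClosed a d d≠0)
      where
      cancel : (∃ λ r → eval (a ∷ d) r K.≈ K.0#) → ∃ λ f → h ≈ evalAt f X
      cancel (r , d[r]≈0) = cases (K.#-or-≈ (eval (b ∷ n) r) K.0#)
        where
        chart-value : Value (chart (just r)) r
        chart-value = centred⇒value (chart-centred (just r))
        factor : ∀ a f → eval (a ∷ f) r K.≈ K.0# → evalAt (a ∷ f) X ≈ (X - ι r) * evalAt (quotient f r) X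
        factor a f root = trans (division a f r X) (trans (+-congʳ (trans (ι-cong root) ι-0)) (+-identityˡ _))
        X-r≉0 : ¬ X - ι r ≈ 0#
        X-r≉0 X-r≈0 = K.#⇒≉ K.1#0 (transcendental ((K.- r) ∷ K.1# ∷ []) (begin
          ι (K.- r) + X * (ι K.1# + X * 0#)   ≈⟨ +-cong (ι-neg r) (*-congˡ (+-congʳ ι-1)) ⟩
          - ι r + X * (1# + X * 0#)           ≈⟨ solve 2 (λ x r → :- r :+ x :* (:1 :+ x :* :0) := x :- r) refl X (ι r) ⟩
          X - ι r                             ≈⟨ X-r≈0 ⟩
          0#                                  ∎) 1)
        cases : eval (b ∷ n) r K.# K.0# ⊎ eval (b ∷ n) r K.≈ K.0# → ∃ λ f → h ≈ evalAt f X
        -- Read h d = n in the chart at r: the left side has value h(r) · 0 there, the right side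
        -- n(r).
        cases (inj₁ n[r]#0) = ⊥-elim (K.#⇒≉ n[r]#0 (K.trans
          (value-unique (value-evalAt (b ∷ n) chart-value)
            (value-cong (compose-fraction algebraicallyClosed (chart (just r)) (chart-nonConstant (just r)) h (b ∷ n) (a ∷ d) hd≈n) K.refl
              (value-* (proj₂ (h-regular r)) (value-evalAt (a ∷ d) chart-value))))
          (K.trans (K.*-congˡ d[r]≈0) (K.zeroʳ _))))
        cases (inj₂ n[r]≈0) = go k (quotient n r) (quotient d r)
          (≡.trans (length-quotient d r) (ℕ.suc-injective eq)) (quotient-nonZero r d≠0)
          (*-cancelˡ X-r≉0 (begin
            (X - ι r) * (h * evalAt (quotient d r) X)     ≈⟨ solve 3 (λ x h q → x :* (h :* q) := h :* (x :* q)) refl (X - ι r) h (evalAt (quotient d r) X) ⟩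
            h * ((X - ι r) * evalAt (quotient d r) X)     ≈⟨ *-congˡ (factor a d d[r]≈0) ⟨
            h * evalAt (a ∷ d) X                          ≈⟨ hd≈n ⟩
            evalAt (b ∷ n) X                              ≈⟨ factor b n n[r]≈0 ⟩
            (X - ι r) * evalAt (quotient n r) X           ∎))

  φ-evalAt : (φ : Endomorphism) → ∀ f u → Endomorphism.φ φ (evalAt f u) ≈ evalAt f (Endomorphism.φ φ u)
  φ-evalAt φ []      u = Endomorphism.φ-0 φ
  φ-evalAt φ (a ∷ f) u = trans (Endomorphism.φ-+ φ _ _) (+-cong (Endomorphism.φ-ι φ a)
    (trans (Endomorphism.φ-* φ _ _) (*-congˡ (φ-evalAt φ f u))))

  -- Having no finite pole, h is a polynomial; were it nonconstant, substituting 1/x would produce a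
  -- pole of positive order at 0, against regularity at ∞.
  regular-everywhere⇒constant : ∀ {h} → (∀ P → Regular (at[ P ] h)) → ∃ λ a → h ≈ ι a
  regular-everywhere⇒constant {h} h-regular = helper (regular-on-line⇒polynomial (λ b → h-regular (just b)))
    where
    helper : (∃ λ f → h ≈ evalAt f X) → ∃ λ a → h ≈ ι a
    helper ([] , h≈f) = K.0# , trans h≈f (sym ι-0)
    helper (a ∷ f , h≈f) with nonZero? f
    ... | no ¬f≠0 = a , trans h≈f (trans (+-congˡ (trans (*-congˡ (eval-zero f X (¬nonZero⇒≋[] ¬f≠0))) (zeroʳ X))) (+-identityʳ _))
    ... | yes f≠0 = let n , e , e#0 , v = eval-pole-suc pole-X⁻¹ K.1#0 a f f≠0 in
      ⊥-elim (ℕ.1+n≢0 (order-unique (e , v , inj₂ e#0)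
        (order-cong (trans (Endomorphism.φ-cong (localize nothing) h≈f)
                    (trans (φ-evalAt (localize nothing) (a ∷ f) X) (eval-cong (a ∷ f) (at-X nothing))))
          (regular⇒order (proj₂ (h-regular nothing))))))

  linear-≈0 : ∀ {a b} → ι a * X + ι b ≈ 0# → a K.≈ K.0# × b K.≈ K.0#
  linear-≈0 {a} {b} eq = coeffs 1 , coeffs 0
    where
    coeffs = transcendental (b ∷ a ∷ []) (trans
      (solve 3 (λ a b x → b :+ x :* (a :+ x :* :0) := a :* x :+ b) refl (ι a) (ι b) X) eq)

  -- The Möbius map M and the shift h.

  module Moebius {D : PoleOrders} (d₁>d₂ : d₁ D ℕ.> d₂ D) (d₂>d₃ : d₂ D ℕ.> d₃ D)
                 (d≢ : ∀ j → d D j ≢ d₁ D × d D j ≢ d₂ D × d D j ≢ d₃ D)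
                 (S S′ : StandardForm D) (α β γ δ : K.Carrier)
                 (det#0 : α K.* δ K.- β K.* γ K.# K.0#) (l : K.Carrier) (l#0 : l K.# K.0#) (h : Carrier) where

    M : Carrier
    M = (ι α * X + ι β) * (ι γ * X + ι δ) ⁻¹

    private
      ¬det≈0 : ¬ α K.* δ K.- β K.* γ K.≈ K.0#
      ¬det≈0 = K.#⇒≉ det#0

      denominator≉0 : ¬ ι γ * X + ι δ ≈ 0#
      denominator≉0 eq = let γ≈0 , δ≈0 = linear-≈0 eq in ¬det≈0 (K.trans
        (K.+-cong (K.*-congˡ δ≈0) (K.-‿cong (K.*-congˡ γ≈0)))
        (K.solve 2 (λ a b → a K.:* K.:0 K.:- b K.:* K.:0 K.:= K.:0) K.refl α β))

      M*denominator : M * (ι γ * X + ι δ) ≈ ι α * X + ι β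
      M*denominator = trans (*-assoc _ _ _) (trans (*-congˡ (trans (*-comm _ _) (⁻¹-inverse denominator≉0))) (*-identityʳ _))

    -- If M = r, then α x + β = r (γ x + δ), so the rows of the matrix are proportional and its
    -- determinant is 0.
    M-nonConstant : NonConstant M
    M-nonConstant r M≈r = ¬det≈0 (K.trans
      (K.+-cong (K.*-congʳ (K.-≈0⇒≈ (proj₁ zeros))) (K.-‿cong (K.*-congʳ (K.-≈0⇒≈ (proj₂ zeros)))))
      (K.solve 3 (λ r g d → (r K.:* g) K.:* d K.:- (r K.:* d) K.:* g K.:= K.:0) K.refl r γ δ))
      where
      ι-affine : ∀ x r y → ι (x K.- r K.* y) ≈ ι x - ι r * ι y
      ι-affine x r y = trans (ι-- x (r K.* y)) (+-congˡ (-‿cong (ι-* r y)))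

      zeros : α K.- r K.* γ K.≈ K.0# × β K.- r K.* δ K.≈ K.0#
      zeros = linear-≈0 (begin
        ι (α K.- r K.* γ) * X + ι (β K.- r K.* δ)
          ≈⟨ +-cong (*-congʳ (ι-affine α r γ)) (ι-affine β r δ) ⟩
        (ι α - ι r * ι γ) * X + (ι β - ι r * ι δ)
          ≈⟨ solve 6 (λ a r g x b d → (a :- r :* g) :* x :+ (b :- r :* d) := (a :* x :+ b) :- r :* (g :* x :+ d)) refl (ι α) (ι r) (ι γ) X (ι β) (ι δ) ⟩
        (ι α * X + ι β) - ι r * (ι γ * X + ι δ)
          ≈⟨ +-congʳ (trans (sym M*denominator) (*-congʳ M≈r)) ⟩
        ι r * (ι γ * X + ι δ) - ι r * (ι γ * X + ι δ)
          ≈⟨ -‿inverseʳ _ ⟩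
        0# ∎)

    -- Here g and g′ are the forms as written in the theorem, and `hᵖ` is its power of h; they are
    -- only provably equal to the versions used in this module.
    transport : ∀ {g g′ hᵖ} → form S X ≈ g → form S′ X ≈ g′ → h ^ p ≈ hᵖ →
                compose M g ≈ ι l * g′ + (hᵖ - h) → compose M (form S X) ≈ ι l * form S′ X + (h ^ p - h)
    transport g≈ g′≈ hᵖ≈ eq = trans (Endomorphism.φ-cong (substitution algebraicallyClosed M M-nonConstant) g≈)
      (trans eq (+-cong (*-congˡ (sym g′≈)) (+-congʳ (sym hᵖ≈))))

    module _ (transforms : compose M (form S X) ≈ ι l * form S′ X + (h ^ p - h)) where

      transforms-form : form S M ≈ ι l * form S′ X + (h ^ p - h)
      transforms-form = trans (form-cong S (sym (compose-X algebraicallyClosed M M-nonConstant)))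
        (trans (sym (φ-form (substitution algebraicallyClosed M M-nonConstant) S X)) transforms)

      transforms-at : ∀ P → form S (at[ P ] M) ≈ ι l * form S′ (chart P) + (at[ P ] h ^ p - at[ P ] h)
      transforms-at P = begin
        form S (at[ P ] M)                                ≈⟨ φ-form (localize P) S M ⟨
        at[ P ] (form S M)                                ≈⟨ φ-cong transforms-form ⟩
        at[ P ] (ι l * form S′ X + (h ^ p - h))           ≈⟨ φ-+ _ _ ⟩
        at[ P ] (ι l * form S′ X) + at[ P ] (h ^ p - h)
          ≈⟨ +-cong (trans (φ-* _ _) (*-cong (φ-ι l) (trans (φ-form (localize P) S′ X) (form-cong S′ (at-X P)))))
                    (trans (φ-+ _ _) (+-cong (φ-^ h p) (φ-neg h))) ⟩
        ι l * form S′ (chart P) + (at[ P ] h ^ p - at[ P ] h) ∎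
        where open Endomorphism (localize P)

      at-M : ∀ P → at[ P ] M ≈ (ι α * chart P + ι β) * (ι γ * chart P + ι δ) ⁻¹
      at-M P = trans (φ-* _ _) (*-cong (at-linear α β) (trans (φ-⁻¹ _) (⁻¹-cong (at-linear γ δ))))
        where
        open Endomorphism (localize P)
        at-linear : ∀ a b → at[ P ] (ι a * X + ι b) ≈ ι a * chart P + ι b
        at-linear a b = trans (φ-+ _ _) (+-cong (trans (φ-* _ _) (*-cong (φ-ι a) (at-X P))) (φ-ι b))

      -- If γ were nonzero, M would send ∞ to the finite point α/γ. As g′ has order d₁ at ∞, the
      -- form g would have order d₁ at that point.
      γ≈0 : γ K.≈ K.0#
      γ≈0 = K.¬#⇒≈ impossible
        where
        impossible : ¬ γ K.# K.0#
        impossible γ#0 = d₁-only-at-∞ d₁>d₂ d₂>d₃ d≢ S (proj₂ (proj₂ part))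
          (part-orders-agree S S′ 2≤p l#0 (transforms-at nothing) v-centred (chart-centred nothing) (proj₂ (proj₂ part)) at-∞)
          where
          g = proj₁ (K.inverse γ#0)
          γg≈1 = proj₁ (proj₂ (K.inverse γ#0))
          a = α K.* g
          -- With a = α/γ one has M - a = m / (γ x + δ) and m = -(α δ - β γ) / γ, which is nonzero.
          -- The parameter at a is therefore m⁻¹ w, with a simple pole coming from γ/x.
          m = β K.- a K.* δ
          v = at[ nothing ] M
          w = ι γ * X ⁻¹ + ι δ
          part = partAt S (just a)

          aγ≈α : a K.* γ K.≈ α
          aγ≈α = K.trans (K.solve 3 (λ α g γ → α K.:* g K.:* γ K.:= α K.:* (γ K.:* g)) K.refl α g γ)
            (K.trans (K.*-congˡ γg≈1) (K.*-identityʳ α))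

          m≉0 : ¬ m K.≈ K.0#
          m≉0 m≈0 = ¬det≈0 (K.trans
            (K.solve 5 (λ α β γ δ g → α K.:* δ K.:- β K.:* γ K.:=
               (K.:1 K.:- γ K.:* g) K.:* (α K.:* δ) K.:- γ K.:* (β K.:- α K.:* g K.:* δ)) K.refl α β γ δ g)
            (K.trans (K.+-cong (K.*-congʳ (K.+-congˡ (K.-‿cong γg≈1))) (K.-‿cong (K.*-congˡ m≈0)))
                     (K.solve 2 (λ x y → (K.:1 K.:- K.:1) K.:* x K.:- y K.:* K.:0 K.:= K.:0) K.refl (α K.* δ) γ)))

          m#0 : m K.# K.0#
          m#0 = [ (λ m#0 → m#0) , (λ m≈0 → ⊥-elim (m≉0 m≈0)) ]′ (K.#-or-≈ m K.0#)

          m⁻¹ = proj₁ (K.inverse m#0)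

          w-pole : Pole w 1 γ
          w-pole = pole-cong refl (K.solve 1 (λ γ → γ K.:* K.:1 K.:+ K.:0 K.:= γ) K.refl γ)
            (pole-+ (pole-scale γ pole-X⁻¹) (pole-< ℕ.z<s (value⇒pole (value-ι δ))))

          w≉0 : ¬ w ≈ 0#
          w≉0 w≈0 = K.#⇒≉ γ#0 (pole-coefficient-unique w-pole (pole-cong (sym w≈0) K.refl pole-0#))

          numerator : (v - ι a) * w ≈ ι m
          numerator = begin
            (v - ι a) * w
              ≈⟨ solve 3 (λ v a w → (v :- a) :* w := v :* w :- a :* w) refl v (ι a) w ⟩
            v * w - ι a * w
              ≈⟨ +-congʳ (trans (*-congʳ (at-M nothing)) (trans (*-assoc _ _ _) (trans (*-congˡ (trans (*-comm _ _) (⁻¹-inverse w≉0))) (*-identityʳ _)))) ⟩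
            ι α * X ⁻¹ + ι β - ι a * (ι γ * X ⁻¹ + ι δ)
              ≈⟨ solve 6 (λ α x β a γ δ → α :* x :+ β :- a :* (γ :* x :+ δ) := (α :- a :* γ) :* x :+ (β :- a :* δ)) refl (ι α) (X ⁻¹) (ι β) (ι a) (ι γ) (ι δ) ⟩
            (ι α - ι a * ι γ) * X ⁻¹ + (ι β - ι a * ι δ)
              ≈⟨ +-cong (*-congʳ (trans (+-congˡ (-‿cong (trans (sym (ι-* a γ)) (ι-cong aγ≈α)))) (-‿inverseʳ _)))
                        (sym (trans (ι-- β (a K.* δ)) (+-congˡ (-‿cong (ι-* a δ))))) ⟩
            0# * X ⁻¹ + ι m
              ≈⟨ solve 2 (λ x m → :0 :* x :+ m := m) refl (X ⁻¹) (ι m) ⟩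
            ι m ∎

          v-centred : Centred (just a) v
          v-centred = centred (pole-cong (sym (⁻¹-unique (begin
              (v - ι a) * (ι m⁻¹ * w)   ≈⟨ solve 3 (λ v n w → v :* (n :* w) := v :* w :* n) refl (v - ι a) (ι m⁻¹) w ⟩
              (v - ι a) * w * ι m⁻¹     ≈⟨ *-congʳ numerator ⟩
              ι m * ι m⁻¹               ≈⟨ ι-* m m⁻¹ ⟨
              ι (m K.* m⁻¹)             ≈⟨ trans (ι-cong (proj₁ (proj₂ (K.inverse m#0)))) ι-1 ⟩
              1#                        ∎))) K.refl (pole-scale m⁻¹ w-pole))
            (K.x#0y#0→xy#0 (proj₂ (proj₂ (K.inverse m#0))) γ#0)

      private
        αδ#0 : α K.* δ K.# K.0#
        αδ#0 = K.#-congʳ (K.trans (K.+-congˡ (K.-‿cong (K.trans (K.*-congˡ γ≈0) (K.zeroʳ β))))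
          (K.solve 1 (λ x → x K.:- K.:0 K.:= x) K.refl (α K.* δ))) det#0

        α#0 : α K.# K.0#
        α#0 = [ (λ α#0 → α#0) , (λ α≈0 → ⊥-elim (K.#⇒≉ αδ#0 (K.trans (K.*-congʳ α≈0) (K.zeroˡ δ)))) ]′ (K.#-or-≈ α K.0#)

        δ#0 : δ K.# K.0#
        δ#0 = [ (λ δ#0 → δ#0) , (λ δ≈0 → ⊥-elim (K.#⇒≉ αδ#0 (K.trans (K.*-congˡ δ≈0) (K.zeroʳ α)))) ]′ (K.#-or-≈ δ K.0#)

        δ⁻¹ k m : K.Carrier
        δ⁻¹ = proj₁ (K.inverse δ#0)
        k   = α K.* δ⁻¹
        m   = β K.* δ⁻¹

        k#0 : k K.# K.0#
        k#0 = K.x#0y#0→xy#0 α#0 (proj₂ (proj₂ (K.inverse δ#0)))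

        M-affine : M ≈ ι k * X + ι m
        M-affine = begin
          (ι α * X + ι β) * (ι γ * X + ι δ) ⁻¹
            ≈⟨ *-congˡ (trans (⁻¹-cong (trans (+-congʳ (*-congʳ (trans (ι-cong γ≈0) ι-0))) (solve 2 (λ x d → :0 :* x :+ d := d) refl X (ι δ))))
                 (⁻¹-unique (trans (sym (ι-* δ δ⁻¹)) (trans (ι-cong (proj₁ (proj₂ (K.inverse δ#0)))) ι-1)))) ⟩
          (ι α * X + ι β) * ι δ⁻¹
            ≈⟨ solve 4 (λ a x b d → (a :* x :+ b) :* d := a :* d :* x :+ b :* d) refl (ι α) X (ι β) (ι δ⁻¹) ⟩
          ι α * ι δ⁻¹ * X + ι β * ι δ⁻¹
            ≈⟨ +-cong (*-congʳ (ι-* α δ⁻¹)) (ι-* β δ⁻¹) ⟨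
          ι k * X + ι m ∎

        -- The slope k is nonzero, so M read in the chart at b is again a local coordinate, now at
        -- the image of b.
        at-M-centred : ∀ b → Centred (just (k K.* b K.+ m)) (at[ just b ] M)
        at-M-centred b = centred-linear k#0 (begin
          at[ just b ] M - ι (k K.* b K.+ m)
            ≈⟨ +-cong (trans (φ-cong M-affine) (trans (φ-+ _ _) (+-cong (trans (φ-* _ _) (*-cong (φ-ι k) (at-X (just b)))) (φ-ι m))))
                      (-‿cong (trans (ι-+ _ _) (+-congʳ (ι-* k b)))) ⟩
          ι k * (X + ι b) + ι m - (ι k * ι b + ι m)
            ≈⟨ solve 4 (λ k x b m → k :* (x :+ b) :+ m :- (k :* b :+ m) := k :* x) refl (ι k) X (ι b) (ι m) ⟩
          ι k * X ∎)
          where open Endomorphism (localize (just b))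

        affine-orders-agree : ∀ b {e e′ Q Q′} → PartAt S (just (k K.* b K.+ m)) e Q → PartAt S′ (just b) e′ Q′ → e ≡ e′
        affine-orders-agree b = part-orders-agree S S′ 2≤p l#0 (transforms-at (just b)) (at-M-centred b) (chart-centred (just b))

        m≈0 : m K.≈ K.0#
        m≈0 = let _ , _ , part = partAt S (just (k K.* K.0# K.+ m)) in K.trans
          (K.solve 2 (λ k m → m K.:= k K.:* K.:0 K.:+ m) K.refl k m)
          (d₂-only-at-0 d₁>d₂ d₂>d₃ d≢ S part (affine-orders-agree K.0# part (at-0 K.refl)))

        k≈1 : k K.≈ K.1#
        k≈1 = let _ , _ , part = partAt S (just (k K.* K.1# K.+ m)) in K.trans
          (K.trans (K.solve 1 (λ k → k K.:= k K.:* K.:1 K.:+ K.:0) K.refl k) (K.+-congˡ (K.sym m≈0)))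
          (d₃-only-at-1 d₁>d₂ d₂>d₃ d≢ S part (affine-orders-agree K.1# part (at-1 K.refl)))

      M≈X : M ≈ X
      M≈X = begin
        M                    ≈⟨ M-affine ⟩
        ι k * X + ι m        ≈⟨ +-cong (*-congʳ (trans (ι-cong k≈1) ι-1)) (trans (ι-cong m≈0) ι-0) ⟩
        1# * X + 0#          ≈⟨ solve 1 (λ x → :1 :* x :+ :0 := x) refl X ⟩
        X                    ∎

      -- Now that M = X, each point is its own image and both sides are read in the same chart.
      same-part-orders : ∀ P {e e′ Q Q′} → PartAt S P e Q → PartAt S′ P e′ Q′ → e ≡ e′
      same-part-orders P part part′ = part-orders-agree S S′ 2≤p l#0 (trans (form-cong S (sym (at-M≈chart P))) (transforms-at P))
        (chart-centred P) (chart-centred P) part part′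
        where
        at-M≈chart : ∀ P → at[ P ] M ≈ chart P
        at-M≈chart P = trans (Endomorphism.φ-cong (localize P) M≈X) (at-X P)

      θ-match : ∀ j → ∃ λ i → d D i ≡ d D j × θ S′ j K.≈ θ S i
      θ-match j = let _ , _ , part = partAt S (just (θ S′ j)) in
        d-only-at-θ d₁>d₂ d₂>d₃ d≢ S j part (same-part-orders (just (θ S′ j)) part (at-θ j K.refl))

      θ-match⁻¹ : ∀ j → ∃ λ i → d D i ≡ d D j × θ S j K.≈ θ S′ i
      θ-match⁻¹ j = let _ , _ , part = partAt S′ (just (θ S j)) in
        d-only-at-θ d₁>d₂ d₂>d₃ d≢ S′ j part (≡.sym (same-part-orders (just (θ S j)) (at-θ j K.refl) part))

      -- The two matchings are mutually inverse because the θ of each form are distinct: θ S j = θ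
      -- S′ (τ j) = θ S (σ (τ j)), and symmetrically.
      θ-permutation : ∃ λ (σ : Permutation′ (n D)) → ∀ j → d D (σ ⟨$⟩ʳ j) ≡ d D j × θ S′ j K.≈ θ S (σ ⟨$⟩ʳ j)
      θ-permutation =
        permutation σ τ
          (λ j → θ-injective S (K.sym (K.trans (proj₂ (proj₂ (θ-match⁻¹ j))) (proj₂ (proj₂ (θ-match (τ j)))))))
          (λ j → θ-injective S′ (K.sym (K.trans (proj₂ (proj₂ (θ-match j))) (proj₂ (proj₂ (θ-match⁻¹ (σ j))))))) ,
        λ j → proj₂ (θ-match j)
        where
        σ τ : Fin (n D) → Fin (n D)
        σ j = proj₁ (θ-match j)
        τ j = proj₁ (θ-match⁻¹ j)
        θ-injective : (S : StandardForm D) → ∀ {i j} → θ S i K.≈ θ S j → i ≡ j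
        θ-injective S {i} {j} eq with i ≟ j
        ... | yes i≡j = i≡j
        ... | no  i≢j = ⊥-elim (K.#⇒≉ (θ-distinct S i j i≢j) eq)

      h-equation : ∀ P → at[ P ] h ^ p - at[ P ] h ≈ form S (chart P) - ι l * form S′ (chart P)
      h-equation P = begin
        at[ P ] h ^ p - at[ P ] h
          ≈⟨ solve 2 (λ x y → x := y :+ x :- y) refl (at[ P ] h ^ p - at[ P ] h) (ι l * form S′ (chart P)) ⟩
        ι l * form S′ (chart P) + (at[ P ] h ^ p - at[ P ] h) - ι l * form S′ (chart P)
          ≈⟨ +-congʳ (transforms-at P) ⟨
        form S (at[ P ] M) - ι l * form S′ (chart P)
          ≈⟨ +-congʳ (form-cong S (trans (Endomorphism.φ-cong (localize P) M≈X) (at-X P))) ⟩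
        form S (chart P) - ι l * form S′ (chart P) ∎

      -- Both polar parts have the same degree and parameter, so g - λ g′ has the polar part with
      -- coefficients a_i - λ b_i, which is still reduced, plus a regular remainder. This is the
      -- input of `artin-schreier-regular`.
      regular-from-parts : ∀ P {e r r′ b b′} (Q Q′ : PolarPart e) → Value r b → Value r′ b′ →
                           form S (chart P) ≈ polar (coefficient Q) (parameter P (chart P)) + r →
                           form S′ (chart P) ≈ polar (coefficient Q′) (parameter P (chart P)) + r′ →
                           Regular (at[ P ] h) × Value (at[ P ] h ^ p - at[ P ] h) (b K.- l K.* b′)
      regular-from-parts P {r = r} {r′} Q Q′ v v′ eq eq′ = artin-schreier-regular
        (Centred.simple-pole (chart-centred P)) (Centred.residue#0 (chart-centred P))
        (λ i → coefficient Q i K.- l K.* coefficient Q′ i)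
        (λ i p∣i → K.trans (K.+-cong (PolarPart.reduced Q i p∣i) (K.-‿cong (K.*-congˡ (PolarPart.reduced Q′ i p∣i))))
                           (K.solve 1 (λ l → K.:0 K.:- l K.:* K.:0 K.:= K.:0) K.refl l))
        (value-- v (value-scale l v′))
        (begin
          at[ P ] h ^ p - at[ P ] h
            ≈⟨ h-equation P ⟩
          form S (chart P) - ι l * form S′ (chart P)
            ≈⟨ +-cong eq (-‿cong (*-congˡ eq′)) ⟩
          q + r - ι l * (q′ + r′)
            ≈⟨ solve 5 (λ q r l q′ r′ → q :+ r :- l :* (q′ :+ r′) := (q :- l :* q′) :+ (r :- l :* r′)) refl q r (ι l) q′ r′ ⟩
          (q - ι l * q′) + (r - ι l * r′)
            ≈⟨ +-congʳ (polar-- (coefficient Q) (coefficient Q′) l (parameter P (chart P))) ⟩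
          polar (λ i → coefficient Q i K.- l K.* coefficient Q′ i) (parameter P (chart P)) + (r - ι l * r′) ∎)
        where
        q  = polar (coefficient Q) (parameter P (chart P))
        q′ = polar (coefficient Q′) (parameter P (chart P))

      h-regular : ∀ P → Regular (at[ P ] h)
      h-regular P =
        let e , Q , part = partAt S P
            e′ , Q′ , part′ = partAt S′ P
        in go part part′ (same-part-orders P part part′)
        where
        go : ∀ {e e′ Q Q′} → PartAt S P e Q → PartAt S′ P e′ Q′ → e ≡ e′ → Regular (at[ P ] h)
        -- Only the equality of the orders gives the two polar parts a common type and lets them be
        -- subtracted.
        go {Q = Q} {Q′} part part′ ≡.refl =
          let r , (_ , v) , eq = form-local S (chart-centred P) part
              r′ , (_ , v′) , eq′ = form-local S′ (chart-centred P) part′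
          in proj₁ (regular-from-parts P Q Q′ v v′ eq eq′)

      -- At ∞ the remainders of both forms vanish, so the value of h^p - h there is 0 - λ · 0, while
      -- h = a makes it a^p - a.
      h-constant : ∃ λ a → h ≈ ι a × a K^.^ p K.≈ a
      h-constant =
        let a , h≈a = regular-everywhere⇒constant h-regular
            r , v , eq = form-at-∞ S (chart-centred nothing)
            r′ , v′ , eq′ = form-at-∞ S′ (chart-centred nothing)
            _ , w = regular-from-parts nothing (F S) (F S′) v v′ eq eq′
            at-h≈a = trans (Endomorphism.φ-cong (localize nothing) h≈a) (Endomorphism.φ-ι (localize nothing) a)
            h-val = value-cong (sym at-h≈a) K.refl (value-ι a)
        in a , h≈a , K.-≈0⇒≈ (K.trans (value-unique (value-- (value-^ p h-val) h-val) w)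
             (K.solve 1 (λ l → K.:0 K.:- l K.:* K.:0 K.:= K.:0) K.refl l))

      private
        X-nonConstant : NonConstant X
        X-nonConstant r X≈r = M-nonConstant r (trans M≈X X≈r)

      -- The base of a composite of two plane maps with base X is not X itself but X substituted
      -- into X.
      M≈X∘X : M ≈ compose X X
      M≈X∘X = trans M≈X (sym (compose-X algebraicallyClosed X X-nonConstant))

      -- The right side is the shift that `_∘ᴹ_` computes for y ↦ y + a after y ↦ λ y.
      shift≈ : ∀ {a} → h ≈ ι a → h ≈ ι K.1# * ι K.0# + compose X (ι a)
      shift≈ {a} h≈a = begin
        h                                     ≈⟨ h≈a ⟩
        ι a                                   ≈⟨ Endomorphism.φ-ι (substitution algebraicallyClosed X X-nonConstant) a ⟨
        compose X (ι a)                       ≈⟨ +-identityˡ _ ⟨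
        0# + compose X (ι a)                  ≈⟨ +-congʳ (trans (*-congˡ ι-0) (zeroʳ _)) ⟨
        ι K.1# * ι K.0# + compose X (ι a)     ∎

      -- As h = a with a^p = a, the term h^p - h is zero; with M = X what remains is g = λ g′.
      form-scaled : ∀ {g g′} → form S X ≈ g → form S′ X ≈ g′ → g′ ≈ g * ι l ⁻¹
      form-scaled {g} {g′} g≈ g′≈ = let a , h≈a , a^p≈a = h-constant in trans (sym g′≈) (trans (*-cancelˡ (ι-≉0 l#0) (begin
        ι l * form S′ X
          ≈⟨ +-identityʳ _ ⟨
        ι l * form S′ X + 0#
          ≈⟨ +-congˡ (trans (^p-id-cong h≈a) (trans (+-congʳ (ι-^ a p)) (trans (+-congʳ (ι-cong a^p≈a)) (-‿inverseʳ _)))) ⟨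
        ι l * form S′ X + (h ^ p - h)
          ≈⟨ transforms-form ⟨
        form S M
          ≈⟨ form-cong S M≈X ⟩
        form S X
          ≈⟨ *-identityʳ _ ⟨
        form S X * 1#
          ≈⟨ *-congˡ (⁻¹-inverse (ι-≉0 l#0)) ⟨
        form S X * (ι l * ι l ⁻¹)
          ≈⟨ solve 3 (λ f l i → f :* (l :* i) := l :* (f :* i)) refl (form S X) (ι l) (ι l ⁻¹) ⟩
        ι l * (form S X * ι l ⁻¹) ∎)) (*-congʳ g≈))
        where
        ι-^ : ∀ a k → ι a ^ k ≈ ι (a K^.^ k)
        ι-^ a ℕ.zero    = sym ι-1
        ι-^ a (ℕ.suc k) = trans (*-congˡ (ι-^ a k)) (sym (ι-* a (a K^.^ k)))

-- Factorials and binomial coefficients modulo p.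

prime⇒coprime : ∀ {p m} → Prime p → 0 ℕ.< m → m ℕ.< p → Coprime p m
prime⇒coprime {m = m} p-prime 0<m m<p (d∣p , d∣m) = [ (λ d≡1 → d≡1) ,
  (λ d≡p → ⊥-elim (>⇒∤ {{ℕ.>-nonZero 0<m}} m<p (≡.subst (_∣ m) d≡p d∣m))) ]′ (prime⇒irreducible p-prime d∣p)

prime∤! : ∀ {p} → Prime p → ∀ k → k ℕ.< p → p ∤ k !
prime∤! p-prime ℕ.zero    0<p p∣1 = ℕ.nonTrivial⇒≢1 {{prime⇒nonTrivial p-prime}} (∣1⇒≡1 p∣1)
prime∤! p-prime (ℕ.suc k) k<p p∣k! = [ >⇒∤ k<p , prime∤! p-prime k (ℕ.<-trans (ℕ.n<1+n k) k<p) ]′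
  (euclidsLemma (ℕ.suc k) (k !) p-prime p∣k!)

-- In (p C k) k! (p - k)! = p! the prime divides the right side, but neither factorial on the left,
-- as both arguments are below p.
prime∣nCk : ∀ {p} → Prime p → ∀ k → 0 ℕ.< k → k ℕ.< p → p ∣ p C k
prime∣nCk {p} p-prime k 0<k k<p = [ (λ p∣C → p∣C) , (λ p∣k!l! → ⊥-elim ([ prime∤! p-prime k k<p ,
    prime∤! p-prime (p ℕ.∸ k) (ℕ.∸-monoʳ-< 0<k (ℕ.<⇒≤ k<p)) ]′ (euclidsLemma (k !) ((p ℕ.∸ k) !) p-prime p∣k!l!))) ]′
  (euclidsLemma (p C k) (k ! ℕ.* (p ℕ.∸ k) !) p-prime (≡.subst (p ∣_) (≡.sym C*k!l!≡p!) (p∣p! p 0<p)))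
  where
  instance k!l!≢0 = k ℕ.!* (p ℕ.∸ k) !≢0
  0<p = ℕ.<-trans 0<k k<p
  C*k!l!≡p! : (p C k) ℕ.* (k ! ℕ.* (p ℕ.∸ k) !) ≡ p !
  C*k!l!≡p! = ≡.trans (≡.cong (ℕ._* (k ! ℕ.* (p ℕ.∸ k) !)) (nCk≡n!/k![n-k]! (ℕ.<⇒≤ k<p)))
    (m/n*n≡m (k![n∸k]!∣n! (ℕ.<⇒≤ k<p)))
  p∣p! : ∀ p → 0 ℕ.< p → p ∣ p !
  p∣p! (ℕ.suc q) _ = m∣m*n (q !)

-- The prime field as the fixed points of Frobenius.

module PrimeField {c ℓ₁ ℓ₂} (p : ℕ) (p-prime : Prime p) (K : HeytingField c ℓ₁ ℓ₂)
                  (isClosure : IsAlgebraicClosureOf𝔽 p K) where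

  open IsAlgebraicClosureOf𝔽 isClosure using (_#?_; characteristic)
  open DiscreteField K _#?_
  open PolynomialRing K _#?_
  open SemiringMult semiring using (×-homo-+; ×1-homo-*; ×-congˡ; ×-assoc-*; ×-congʳ) renaming (_×_ to _·_)
  open SemiringExp semiring using (_^_; ^-congˡ)
  open CommutativeMonoidSum +-commutativeMonoid using (sum; sum-init-last; sum-cong-≋; sum-replicate-zero)
  module Binomial = CommutativeSemiringBinomial (CommutativeRing.commutativeSemiring commutativeRing)
  open SetoidReasoning setoid

  -- K over itself makes the division by linear factors available for evaluation in K.
  selfAlgebra : AlgebraOver K c ℓ₁
  selfAlgebra = record
    { commutativeRing = commutativeRing ; ι = λ a → a ; ι-cong = λ eq → eq
    ; ι-+ = λ _ _ → refl ; ι-* = λ _ _ → refl ; ι-1 = refl }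

  module E = Evaluation K _#?_ selfAlgebra

  1<p : 1 ℕ.< p
  1<p = ℕ.nonTrivial⇒n>1 p {{prime⇒nonTrivial p-prime}}

  multiple-of-p : ∀ {m} → p ∣ m → ∀ x → m · x ≈ 0#
  multiple-of-p (divides q ≡.refl) x = begin
    (q ℕ.* p) · x         ≈⟨ ×-congʳ (q ℕ.* p) (*-identityˡ x) ⟨
    (q ℕ.* p) · (1# * x)  ≈⟨ ×-assoc-* (q ℕ.* p) 1# x ⟨
    (q ℕ.* p) · 1# * x    ≈⟨ *-congʳ (trans (×1-homo-* q p) (trans (*-congˡ characteristic) (zeroʳ _))) ⟩
    0# * x                ≈⟨ zeroˡ x ⟩
    0#                    ∎

  -- All binomial coefficients but the two outer ones are divisible by p and vanish in K.
  frobenius-+ : ∀ x y → (x + y) ^ p ≈ x ^ p + y ^ p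
  frobenius-+ x y = go p ≡.refl
    where
    -- The binomial sum can be split only at a visible successor; p is a module parameter, so q is
    -- matched in its place.
    go : ∀ q → q ≡ p → (x + y) ^ q ≈ x ^ q + y ^ q
    go ℕ.zero    eq = ⊥-elim (ℕ.<⇒≢ (ℕ.<-trans ℕ.z<s 1<p) eq)
    go (ℕ.suc q) eq = begin
      (x + y) ^ ℕ.suc q
        ≈⟨ Binomial.theorem (ℕ.suc q) x y ⟩
      term zero + sum (λ i → term (suc i))
        ≈⟨ +-congˡ (sum-init-last (λ i → term (suc i))) ⟩
      term zero + (sum (λ i → term (suc (inject₁ i))) + term (suc (fromℕ q)))
        ≈⟨ +-cong first (+-cong (trans (sum-cong-≋ middle) (sum-replicate-zero q)) last) ⟩
      y ^ ℕ.suc q + (0# + x ^ ℕ.suc q)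
        ≈⟨ solve 2 (λ x y → y :+ (:0 :+ x) := x :+ y) refl (x ^ ℕ.suc q) (y ^ ℕ.suc q) ⟩
      x ^ ℕ.suc q + y ^ ℕ.suc q ∎
      where
      term : Fin (2 ℕ.+ q) → Carrier
      term = Binomial.binomialTerm x y (ℕ.suc q)

      first : term zero ≈ y ^ ℕ.suc q
      first = trans (+-identityʳ _) (*-identityˡ _)

      middle : ∀ i → term (suc (inject₁ i)) ≈ 0#
      middle i = multiple-of-p (≡.subst (λ r → p ∣ r C k) (≡.sym eq)
          (prime∣nCk p-prime k ℕ.z<s (≡.subst (k ℕ.<_) eq (ℕ.s<s (≡.subst (ℕ._< q) (≡.sym (toℕ-inject₁ i)) (toℕ<n i))))))
        (Binomial.binomial x y (ℕ.suc q) (suc (inject₁ i)))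
        where k = ℕ.suc (toℕ (inject₁ i))

      last : term (suc (fromℕ q)) ≈ x ^ ℕ.suc q
      last = ≡.subst (λ k → (ℕ.suc q C ℕ.suc k) · (x ^ ℕ.suc k * y ^ (q ℕ.∸ k)) ≈ x ^ ℕ.suc q) (≡.sym (toℕ-fromℕ q))
        (≡.subst₂ (λ k l → k · (x ^ ℕ.suc q * y ^ l) ≈ x ^ ℕ.suc q) (≡.sym (nCn≡1 (ℕ.suc q))) (≡.sym (ℕ.n∸n≡0 q))
          (trans (+-identityʳ _) (*-identityʳ _)))

  1^ : ∀ k → 1# ^ k ≈ 1#
  1^ ℕ.zero    = refl
  1^ (ℕ.suc k) = trans (*-identityˡ _) (1^ k)

  -- Induction by additivity of Frobenius: (1 + i)^p = 1 + i^p. The case of 0 uses that p is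
  -- positive.
  fermat : ∀ i → (i · 1#) ^ p ≈ i · 1#
  fermat ℕ.zero    = go p ≡.refl
    where
    go : ∀ q → q ≡ p → 0# ^ q ≈ 0#
    go ℕ.zero    eq = ⊥-elim (ℕ.<⇒≢ (ℕ.<-trans ℕ.z<s 1<p) eq)
    go (ℕ.suc q) eq = zeroˡ _
  fermat (ℕ.suc i) = trans (frobenius-+ 1# (i · 1#)) (+-cong (1^ p) (fermat i))

  -- Read in K, the equation would say 1 = 0 if m and n both vanished. Its shape serves both signs
  -- of a Bézout identity, with p once as n and once as m.
  multiples-differ-by-1 : ∀ y m x n → 1 ℕ.+ y ℕ.* m ≡ x ℕ.* n → m · 1# ≈ 0# → ¬ n · 1# ≈ 0#
  multiples-differ-by-1 y m x n eq m≈0 n≈0 = #⇒≉ 1#0 (begin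
    1#                          ≈⟨ solve 2 (λ o y → o := (o :+ :0) :+ y :* :0) refl 1# (y · 1#) ⟩
    1 · 1# + y · 1# * 0#        ≈⟨ +-congˡ (*-congˡ m≈0) ⟨
    1 · 1# + y · 1# * m · 1#    ≈⟨ +-congˡ (×1-homo-* y m) ⟨
    1 · 1# + (y ℕ.* m) · 1#     ≈⟨ ×-homo-+ 1# 1 (y ℕ.* m) ⟨
    (1 ℕ.+ y ℕ.* m) · 1#        ≈⟨ ×-congˡ eq ⟩
    (x ℕ.* n) · 1#              ≈⟨ ×1-homo-* x n ⟩
    x · 1# * n · 1#             ≈⟨ *-congˡ n≈0 ⟩
    x · 1# * 0#                 ≈⟨ zeroʳ _ ⟩
    0#                          ∎)

  ·1-≉0 : ∀ m → 0 ℕ.< m → m ℕ.< p → ¬ m · 1# ≈ 0#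
  ·1-≉0 m 0<m m<p m·1≈0 with coprime-Bézout (prime⇒coprime p-prime 0<m m<p)
  ... | +- x y eq = multiples-differ-by-1 y m x p eq m·1≈0 characteristic
  ... | -+ x y eq = multiples-differ-by-1 x p y m eq characteristic m·1≈0

  ·1-distinct : ∀ {i j} → i ℕ.< j → j ℕ.< p → ¬ i · 1# ≈ j · 1#
  ·1-distinct {i} i<j j<p eq with k , ≡.refl ← ℕ.m≤n⇒∃[o]m+o≡n i<j =
    ·1-≉0 (ℕ.suc k) ℕ.z<s (ℕ.≤-<-trans (ℕ.≤-trans (ℕ.m≤n+m (ℕ.suc k) i) (ℕ.≤-reflexive (ℕ.+-suc i k))) j<p) (begin
      ℕ.suc k · 1#
        ≈⟨ solve 2 (λ i k → k := i :+ k :- i) refl (i · 1#) (ℕ.suc k · 1#) ⟩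
      i · 1# + ℕ.suc k · 1# - i · 1#
        ≈⟨ +-congʳ (×-homo-+ 1# i (ℕ.suc k)) ⟨
      (i ℕ.+ ℕ.suc k) · 1# - i · 1#
        ≈⟨ +-congʳ (trans (×-congˡ (ℕ.+-suc i k)) (sym eq)) ⟩
      i · 1# - i · 1#
        ≈⟨ -‿inverseʳ _ ⟩
      0# ∎)

  -- A list of length at most n has degree below n. Dividing by x - r₀ shortens it, and the other
  -- r_i remain roots of the quotient because r_i - r₀ is nonzero.
  too-many-roots : ∀ n f → length f ℕ.≤ n → NonZeroᴾ f → (r : Fin n → Carrier) →
                   (∀ i j → i ≢ j → r i # r j) → ¬ (∀ i → eval f (r i) ≈ 0#)
  too-many-roots (ℕ.suc n) (a ∷ f) (ℕ.s≤s len) nz r distinct roots with nonZero? f | nz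
  ... | no ¬f≠0 | there f≠0 = ¬f≠0 f≠0
  ... | no ¬f≠0 | here a#0  = #⇒≉ a#0 (begin
      a                              ≈⟨ solve 2 (λ a r → a := a :+ r :* :0) refl a (r zero) ⟩
      a + r zero * 0#                ≈⟨ +-congˡ (*-congˡ (E.eval-zero f (r zero) (¬nonZero⇒≋[] ¬f≠0))) ⟨
      a + r zero * eval f (r zero)   ≈⟨ roots zero ⟩
      0#                             ∎)
  ... | yes f≠0 | _ = too-many-roots n (E.quotient f (r zero))
      (≡.subst (ℕ._≤ n) (≡.sym (E.length-quotient f (r zero))) len) (E.quotient-nonZero (r zero) f≠0)
      (λ i → r (suc i)) (λ i j i≢j → distinct (suc i) (suc j) (λ eq → i≢j (suc-injective eq)))
      (λ i → xy≈0⇒x≈0 (-#0 (distinct (suc i) zero λ ())) (begin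
        eval (E.quotient f (r zero)) (r (suc i)) * (r (suc i) - r zero)
          ≈⟨ *-comm _ _ ⟩
        (r (suc i) - r zero) * eval (E.quotient f (r zero)) (r (suc i))
          ≈⟨ +-identityˡ _ ⟨
        0# + (r (suc i) - r zero) * eval (E.quotient f (r zero)) (r (suc i))
          ≈⟨ +-congʳ (roots zero) ⟨
        eval (a ∷ f) (r zero) + (r (suc i) - r zero) * eval (E.quotient f (r zero)) (r (suc i))
          ≈⟨ E.division a f (r zero) (r (suc i)) ⟨
        eval (a ∷ f) (r (suc i))
          ≈⟨ roots (suc i) ⟩
        0# ∎))

  power : ℕ → Poly
  power ℕ.zero    = 1# ∷ []
  power (ℕ.suc n) = 0# ∷ power n

  eval-power : ∀ n x → eval (power n) x ≈ x ^ n
  eval-power ℕ.zero    x = solve 1 (λ x → :1 :+ x :* :0 := :1) refl x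
  eval-power (ℕ.suc n) x = trans (+-identityˡ _) (*-congˡ (eval-power n x))

  length-power : ∀ n → length (power n) ≡ ℕ.suc n
  length-power ℕ.zero    = ≡.refl
  length-power (ℕ.suc n) = ≡.cong ℕ.suc (length-power n)

  power-nonZero : ∀ n → NonZeroᴾ (power n)
  power-nonZero ℕ.zero    = here 1#0
  power-nonZero (ℕ.suc n) = there (power-nonZero n)

  -- If a differed from all p multiples of 1, then a together with them would give p + 1 distinct
  -- roots of x^p - x.
  fixed-by-frobenius⇒prime-field : ∀ {a} → a ^ p ≈ a → InPrimeField p K a
  fixed-by-frobenius⇒prime-field {a} a^p≈a with any? (λ (i : Fin p) → ¬? (a #? (toℕ i · 1#)))
  ... | yes (i , ¬a#i) = i , ¬#⇒≈ ¬a#i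
  ... | no  ¬∃i        = ⊥-elim (go p ≡.refl)
    where
    r : Fin (ℕ.suc p) → Carrier
    r zero    = a
    r (suc i) = toℕ i · 1#

    a#r : ∀ i → a # toℕ {p} i · 1#
    a#r i = decidable-stable (a #? (toℕ i · 1#)) (λ ¬a#i → ¬∃i (i , ¬a#i))

    ≉⇒# : ∀ {x y} → ¬ x ≈ y → x # y
    ≉⇒# {x} {y} x≉y = [ (λ x#y → x#y) , (λ x≈y → ⊥-elim (x≉y x≈y)) ]′ (#-or-≈ x y)

    distinct : ∀ i j → i ≢ j → r i # r j
    distinct zero    zero    i≢j = ⊥-elim (i≢j ≡.refl)
    distinct zero    (suc j) i≢j = a#r j
    distinct (suc i) zero    i≢j = #-sym (a#r i)
    distinct (suc i) (suc j) i≢j with ℕ.<-cmp (toℕ i) (toℕ j)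
    ... | tri< i<j _ _ = ≉⇒# (·1-distinct i<j (toℕ<n j))
    ... | tri≈ _ i≡j _ = ⊥-elim (i≢j (≡.cong suc (toℕ-injective i≡j)))
    ... | tri> _ _ j<i = ≉⇒# (λ eq → ·1-distinct j<i (toℕ<n i) (sym eq))

    root : ∀ i → r i ^ p ≈ r i
    root zero    = a^p≈a
    root (suc i) = fermat (toℕ i)

    go : ∀ q → q ≡ p → ⊥
    go ℕ.zero                 eq = ℕ.<⇒≢ (ℕ.<-trans ℕ.z<s 1<p) eq
    go (ℕ.suc ℕ.zero)         eq = ℕ.<⇒≢ 1<p eq
    -- The list is x^p - x with p = q + 2: the two initial entries shift `power q` up to degree p,
    -- and the length p + 1 equals the number of roots.
    go (ℕ.suc (ℕ.suc q)) eq = too-many-roots (ℕ.suc p) (0# ∷ - 1# ∷ power q)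
      (ℕ.≤-reflexive (≡.trans (≡.cong (2 ℕ.+_) (length-power q)) (≡.cong ℕ.suc eq)))
      (there (there (power-nonZero q))) r distinct (λ i → begin
        0# + r i * (- 1# + r i * eval (power q) (r i))
          ≈⟨ +-congˡ (*-congˡ (+-congˡ (*-congˡ (eval-power q (r i))))) ⟩
        0# + r i * (- 1# + r i * r i ^ q)
          ≈⟨ solve 2 (λ x y → :0 :+ x :* (:- :1 :+ x :* y) := x :* (x :* y) :- x) refl (r i) (r i ^ q) ⟩
        r i ^ (2 ℕ.+ q) - r i
          ≈⟨ +-congʳ (≡.subst (λ k → r i ^ k ≈ r i) (≡.sym eq) (root i)) ⟩
        r i - r i
          ≈⟨ -‿inverseʳ _ ⟩
        0# ∎)

-- Transfer to the definitions in the statement.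

module ConcreteForms {c ℓ₁ ℓ₂} (p : ℕ) (K : HeytingField c ℓ₁ ℓ₂) (isClosure : IsAlgebraicClosureOf𝔽 p K) where

  open IsAlgebraicClosureOf𝔽 isClosure using (_#?_)
  private module AS = ArtinSchreierCurves p K isClosure
  open AS using (⟦_⟧; _⟨_⟩)
  open FractionField K _#?_ using (rationalFunctionField; _≃_)
  open LocalParts p K isClosure rationalFunctionField
  open StandardForm

  -- The two powers are built on raw structures with different equalities, so they coincide only
  -- after recursion on k.
  ^-agree : ∀ t k → t ^ k ≡ t AS.^ k
  ^-agree t ℕ.zero    = ≡.refl
  ^-agree t (ℕ.suc k) = ≡.cong (t *_) (^-agree t k)

  opaque
    unfolding polar

    polar≃⟨⟩ : ∀ {d} (P : PolarPart d) t → polar (PolarPart.coeff P) t ≃ P ⟨ t ⟩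
    polar≃⟨⟩ {d} P t = sum-cong {d} (monomial a t) (λ i → ι (a i) * t AS.^ ℕ.suc (toℕ i))
      (λ i → reflexive (≡.cong (ι (a i) *_) (^-agree t (ℕ.suc (toℕ i)))))
      where
      a : Fin d → HeytingField.Carrier K
      a = PolarPart.coeff P

  form≃⟦⟧ : ∀ {D} (S : StandardForm D) → form S X ≃ ⟦ S ⟧
  form≃⟦⟧ S = +-cong {F̂ + Ĝ + Ĥ} {F S ⟨ X ⟩ + G S ⟨ X ⁻¹ ⟩ + H S ⟨ (X - ι K.1#) ⁻¹ ⟩}
    (+-cong {F̂ + Ĝ} {F S ⟨ X ⟩ + G S ⟨ X ⁻¹ ⟩}
      (+-cong {F̂} {F S ⟨ X ⟩} (polar≃⟨⟩ (F S) X) (polar≃⟨⟩ (G S) (X ⁻¹)))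
      (polar≃⟨⟩ (H S) ((X - ι K.1#) ⁻¹)))
    (sum-cong (λ j → polar (PolarPart.coeff (J S j)) ((X - ι (θ S j)) ⁻¹)) (λ j → J S j ⟨ (X - ι (θ S j)) ⁻¹ ⟩)
      (λ j → polar≃⟨⟩ (J S j) ((X - ι (θ S j)) ⁻¹)))
    where
    module K = HeytingField K
    F̂ = polar (PolarPart.coeff (F S)) X
    Ĝ = polar (PolarPart.coeff (G S)) (X ⁻¹)
    Ĥ = polar (PolarPart.coeff (H S)) ((X - ι K.1#) ⁻¹)

theorem6p6 : ∀ {c ℓ₁ ℓ₂} (p : ℕ) → Prime p → 2 ∤ p →
    (K : HeytingField c ℓ₁ ℓ₂) (isClosure : IsAlgebraicClosureOf𝔽 p K) →
    let open ArtinSchreierCurves p K isClosure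
        open PoleOrders
        open StandardForm
        open Transformation
    in
    (D : PoleOrders) →
    d₁ D > d₂ D → d₂ D > d₃ D →
    (∀ j → d D j ≢ d₁ D × d D j ≢ d₂ D × d D j ≢ d₃ D) →
    (S S′ : StandardForm D) (T : Transformation) →
    Transforms T ⟦ S ⟧ ⟦ S′ ⟧ →
      M T ≈ X
    × (∃ λ a → InPrimeField p K a × h T ≈ const a
             × toPlaneMap T ≈ᴹ (y↦y+ a) ∘ᴹ (y↦ scale T *y))
    × ⟦ S′ ⟧ ≈ ⟦ S ⟧ / const (scale T)
    × (∃ λ (σ : Permutation′ (n D)) → ∀ j →
         d D (σ ⟨$⟩ʳ j) ≡ d D j × HeytingField._≈_ K (θ S′ j) (θ S (σ ⟨$⟩ʳ j)))
theorem6p6 p p-prime _ K isClosure D d₁>d₂ d₂>d₃ d≢ S S′ T transforms =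
    unwrap (M≈X transforms′)
  , (a , PrimeField.fixed-by-frobenius⇒prime-field p p-prime K isClosure a^p≈a , unwrap h≃a
      -- The three components of `_≈ᴹ_`; the scale of the composite is 1 · λ, hence the unit law.
      , unwrap (M≈X∘X transforms′) , K.sym (K.*-identityˡ T.scale) , unwrap (shift≈ transforms′ h≃a))
  , unwrap (form-scaled transforms′ (form≃⟦⟧ S) (form≃⟦⟧ S′))
  , θ-permutation transforms′
  where
  open IsAlgebraicClosureOf𝔽 isClosure using (_#?_)
  module K = DiscreteField K _#?_
  open FractionField K _#?_
  open PolynomialRing K _#?_ using (at; coefficientwise)
  open ConcreteForms p K isClosure using (form≃⟦⟧; ^-agree)
  module T = ArtinSchreierCurves.Transformation T
  module R = Rigidity p (ℕ.nonTrivial⇒n>1 p {{prime⇒nonTrivial p-prime}}) K isClosure rationalFunctionField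
  open R.Moebius d₁>d₂ d₂>d₃ d≢ S S′ T.α T.β T.γ T.δ T.det≠0 T.scale T.scale≠0 T.h

  open RawRing (RationalFunctions.ratFunRing K _#?_) using () renaming (_≈_ to _≈ᴿ_)

  unwrap : ∀ {f g} → f ≃ g → f ≈ᴿ g
  unwrap f≃g = at (cross-multiplied f≃g)

  transforms′ : R.compose M (R.form S R.X) ≃ (R.ι T.scale R.* R.form S′ R.X R.+ (T.h R.^ p R.- T.h))
  transforms′ = transport (form≃⟦⟧ S) (form≃⟦⟧ S′) (R.reflexive (^-agree T.h p)) (cross (coefficientwise transforms))

  a = proj₁ (h-constant transforms′)
  h≃a = proj₁ (proj₂ (h-constant transforms′))
  a^p≈a = proj₂ (proj₂ (h-constant transforms′))
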